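{- There is a deterministic algorithm that, given a set $S$ of $n$ permutations over $[d]$, the number $k$ of medians, and $p\in[0,1)$, finds a $1.999$-approximate solution to the $k$-median with outliers problem with parameter $p$ under the Ulam metric, in time $n^{O(k)}d\log d+n^5d^3$.
   Context: $[d]=\{1,\dots,d\}$ and $\mathcal{S}_d$ is the set of all permutations of $[d]$, viewed as sequences of length $d$. The Ulam distance $\Delta(x,y)$ between $x,y\in\mathcal{S}_d$ is the minimum number of character-move operations (pick up one symbol and reinsert it at another position) transforming $x$ into $y$; equivalently $\Delta(x,y)=d-|\mathrm{LCS}(x,y)|$, where $\mathrm{LCS}(x,y)$ is a longest common subsequence. For $Y\subseteq\mathcal{S}_d$ let $\Delta(x,Y)=\min_{y\in Y}\Delta(x,y)$, and for $S\subseteq\mathcal{S}_d$ let $\mathrm{Obj}(S,Y)=\sum_{x\in S}\Delta(x,Y)$. For $p\in[0,1)$ define $$\mathrm{Obj}_p(S,Y)=\min_{S'\subseteq S:\ |S'|\ge(1-p)|S|}\mathrm{Obj}(S',Y).$$ The $k$-median with outliers problem with parameter $p$: given $S$, find a set $Y\subseteq\mathcal{S}_d$ (not necessarily contained in $S$) with $|Y|\le k$ minimizing $\mathrm{Obj}_p(S,Y)$. A set $\tilde Y\subseteq\mathcal{S}_d$ with $|\tilde Y|\le k$ is a $c$-approximate solution if $\mathrm{Obj}_p(S,\tilde Y)\le c\cdot\min_{Y\subseteq\mathcal{S}_d,\,|Y|\le k}\mathrm{Obj}_p(S,Y)$.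
   Formalization: The outlier parameter p ∈ [0,1) is taken rational and given to the algorithm as numerator and denominator; for each n, a real p defines the same problem as the rational 1 − ⌈(1−p)n⌉/n. -}

module Defs where

open import Data.Bool using (if_then_else_)
open import Data.Fin using (Fin; toℕ; fromℕ<; combine; remQuot)
open import Data.Fin.Permutation using (Permutation′; _⟨$⟩ʳ_; _≈_)
open import Data.Fin.Subset using (Subset; _∈_; _∉_; ∣_∣)
open import Data.Integer as ℤ using (+_)
open import Data.Nat
  using (ℕ; zero; suc; _+_; _∸_; _*_; _^_; _/_; _%_; _≤_; _≟_; _<?_; _<ᵇ_)
open import Data.Nat.Properties using (+-0-commutativeMonoid; m^n≢0)
open import Data.Product using (Σ-syntax; ∃-syntax; _×_; _,_)
open import Data.Rational as ℚ using (ℚ; 1ℚ)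
open import Data.Vec using (Vec; insertAt; lookup; removeAt; tabulate)
open import Function.Definitions using (Injective)
open import Relation.Binary.PropositionalEquality using (_≡_; _≢_; refl)
open import Relation.Nullary using (contradiction; yes; no)
open import Relation.Nullary.Decidable using (does)
open import Algebra.Properties.CommutativeMonoid.Sum +-0-commutativeMonoid
  using (sum)

IsMin : (ℕ → Set) → ℕ → Set
IsMin P m = P m × (∀ m′ → P m′ → m ≤ m′)

ℕ→ℚ : ℕ → ℚ
ℕ→ℚ n = + n ℚ./ 1

------------------------------------------------------------------------
-- The Ulam metric

-- The symbols are 0, …, d - 1 instead of 1, …, d.
Perm : ℕ → Set
Perm d = Permutation′ d

sequence : ∀ {d} → Perm d → Vec (Fin d) d
sequence x = tabulate (x ⟨$⟩ʳ_)

-- The family S enumerates a subset of the symmetric group without repetition,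
-- so that the size of its index set is the size of the subset.
IsSet : ∀ {d n} → (Fin n → Perm d) → Set
IsSet S = Injective _≡_ _≈_ S

data Move {A : Set} : ∀ {d} → Vec A d → Vec A d → Set where
  move : ∀ {d} (xs : Vec A (suc d)) (i j : Fin (suc d)) → i ≢ j →
         Move xs (insertAt (removeAt xs i) j (lookup xs i))

data Moves {A : Set} {d} : ℕ → Vec A d → Vec A d → Set where
  []  : ∀ {xs} → Moves 0 xs xs
  _∷_ : ∀ {t xs ys zs} → Move xs ys → Moves t ys zs → Moves (suc t) xs zs

IsUlam : ∀ {d} → Perm d → Perm d → ℕ → Set
IsUlam x y = IsMin λ t → Moves t (sequence x) (sequence y)

------------------------------------------------------------------------
-- k-median with outliers
--
-- A set of medians is given by a family Y : Fin m → Perm d.  Repetitions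
-- are harmless: the sets of at most k permutations are exactly the images
-- of the families with m ≤ k.  For m = 0 there is no minimum in IsDist, so
-- an empty Y has no objective value on a nonempty S′ and does not compete.

IsDist : ∀ {d m} → Perm d → (Fin m → Perm d) → ℕ → Set
IsDist x Y = IsMin λ t → ∃[ j ] IsUlam x (Y j) t

-- The sum over S′ is taken as a sum over all of S, with summand 0 off S′.
IsObj : ∀ {d n m} → (Fin n → Perm d) → Subset n → (Fin m → Perm d) → ℕ → Set
IsObj {n = n} S S′ Y v =
  Σ[ δ ∈ (Fin n → ℕ) ]
    (∀ i → i ∈ S′ → IsDist (S i) Y (δ i)) ×
    (∀ i → i ∉ S′ → δ i ≡ 0) ×
    v ≡ sum δ

IsObjₚ : ∀ {d n m} → ℚ → (Fin n → Perm d) → (Fin m → Perm d) → ℕ → Set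
IsObjₚ {n = n} p S Y = IsMin λ v →
  Σ[ S′ ∈ Subset n ]
    ((1ℚ ℚ.- p) ℚ.* ℕ→ℚ n ℚ.≤ ℕ→ℚ ∣ S′ ∣) × IsObj S S′ Y v

IsOpt : ∀ {d n} → ℚ → (Fin n → Perm d) → ℕ → ℕ → Set
IsOpt {d} p S k = IsMin λ v →
  ∃[ m ] m ≤ k × Σ[ Y ∈ (Fin m → Perm d) ] IsObjₚ p S Y v

IsApproximate : ∀ {d n m} → ℚ → ℚ → (Fin n → Perm d) → ℕ →
                (Fin m → Perm d) → Set
IsApproximate {m = m} c p S k Y =
  m ≤ k ×
  ∃[ v ] ∃[ opt ]
    IsObjₚ p S Y v × IsOpt p S k opt × (ℕ→ℚ v ℚ.≤ c ℚ.* ℕ→ℚ opt)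

------------------------------------------------------------------------
-- Algorithms: programs for a word RAM with word length w, written with
-- structured control flow.  A program mentions finitely many registers and
-- does not depend on w or on the input.  Arithmetic is modulo 2 ^ w, except
-- that subtraction is truncated at 0 and division by 0 gives 0.

data Op : Set where
  add sub mul div mod lt : Op

data Expr : Set where
  lit    : ℕ → Expr
  reg    : ℕ → Expr
  load   : Expr → Expr
  binary : Op → Expr → Expr → Expr

infix  6 _≔_
infixr 5 _⨾_

data Program : Set where
  skip  : Program
  _≔_   : ℕ → Expr → Program
  store : (address value : Expr) → Program
  _⨾_   : Program → Program → Program
  if    : Expr → Program → Program → Program
  while : Expr → Program → Program

record State : Set where
  constructor state
  field
    register : ℕ → ℕ
    memory   : ℕ → ℕ

open State public

_[_↦_] : (ℕ → ℕ) → ℕ → ℕ → (ℕ → ℕ)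
(f [ a ↦ v ]) b = if does (a ≟ b) then v else f b

apply : Op → ℕ → ℕ → ℕ
apply add a b       = a + b
apply sub a b       = a ∸ b
apply mul a b       = a * b
apply div a zero    = 0
apply div a (suc b) = a / suc b
apply mod a zero    = 0
apply mod a (suc b) = a % suc b
apply lt  a b       = if a <ᵇ b then 1 else 0

truncate : ℕ → ℕ → ℕ
truncate w a = _%_ a (2 ^ w) {{m^n≢0 2 w}}

eval : ℕ → State → Expr → ℕ
eval w s (lit a)         = truncate w a
eval w s (reg r)         = register s r
eval w s (load e)        = memory s (eval w s e)
eval w s (binary o e e′) = truncate w (apply o (eval w s e) (eval w s e′))

cost : Expr → ℕ
cost (lit a)         = 1
cost (reg r)         = 1
cost (load e)        = 1 + cost e
cost (binary o e e′) = 1 + (cost e + cost e′)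

-- Run w c s t s′: started in s, the program c halts in s′ after t steps.
data Run (w : ℕ) : Program → State → ℕ → State → Set where
  skip : ∀ {s} → Run w skip s 1 s
  assign : ∀ {s r e} →
    Run w (r ≔ e) s (1 + cost e)
      (state (register s [ r ↦ eval w s e ]) (memory s))
  store : ∀ {s e e′} →
    Run w (store e e′) s (1 + (cost e + cost e′))
      (state (register s) (memory s [ eval w s e ↦ eval w s e′ ]))
  seq : ∀ {s s′ s″ c c′ t t′} →
    Run w c s t s′ → Run w c′ s′ t′ s″ → Run w (c ⨾ c′) s (t + t′) s″
  if-true : ∀ {s s′ e c c′ t} → eval w s e ≢ 0 →
    Run w c s t s′ → Run w (if e c c′) s (1 + (cost e + t)) s′
  if-false : ∀ {s s′ e c c′ t} → eval w s e ≡ 0 →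
    Run w c′ s t s′ → Run w (if e c c′) s (1 + (cost e + t)) s′
  while-done : ∀ {s e c} → eval w s e ≡ 0 →
    Run w (while e c) s (1 + cost e) s
  while-step : ∀ {s s′ s″ e c t t′} → eval w s e ≢ 0 →
    Run w c s t s′ → Run w (while e c) s′ t′ s″ →
    Run w (while e c) s (1 + (cost e + (t + t′))) s″

deterministic : ∀ {w c s t t′ s′ s″} →
  Run w c s t s′ → Run w c s t′ s″ → (t , s′) ≡ (t′ , s″)
deterministic skip skip = refl
deterministic assign assign = refl
deterministic store store = refl
deterministic (seq a b) (seq a′ b′)
  with refl ← deterministic a a′ with refl ← deterministic b b′ = refl
deterministic (if-true _ a) (if-true _ a′)
  with refl ← deterministic a a′ = refl
deterministic (if-true h _) (if-false h′ _) = contradiction h′ h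
deterministic (if-false h _) (if-true h′ _) = contradiction h h′
deterministic (if-false _ a) (if-false _ a′)
  with refl ← deterministic a a′ = refl
deterministic (while-done _) (while-done _) = refl
deterministic (while-done h) (while-step h′ _ _) = contradiction h h′
deterministic (while-step h _ _) (while-done h′) = contradiction h′ h
deterministic (while-step _ a b) (while-step _ a′ b′)
  with refl ← deterministic a a′ with refl ← deterministic b b′ = refl

------------------------------------------------------------------------
-- Input and output.  A family of permutations is laid out row by row: entry
-- j of permutation i is at offset toℕ (combine i j) = d * i + j.

inputRegister : ∀ {d n} → (Fin n → Perm d) → ℕ → ℚ → ℕ → ℕ
inputRegister {d} {n} S k p 0 = n
inputRegister {d} {n} S k p 1 = d
inputRegister {d} {n} S k p 2 = k
inputRegister {d} {n} S k p 3 = ℤ.∣ ℚ.↥ p ∣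
inputRegister {d} {n} S k p 4 = ℚ.↧ₙ p
inputRegister {d} {n} S k p _ = 0

inputMemory : ∀ {d n} → (Fin n → Perm d) → ℕ → ℕ
inputMemory {d} {n} S a with a <? n * d
... | no _    = 0
... | yes a<nd with remQuot {n} d (fromℕ< a<nd)
...   | i , j = toℕ (S i ⟨$⟩ʳ j)

input : ∀ {d n} → (Fin n → Perm d) → ℕ → ℚ → State
input S k p = state (inputRegister S k p) (inputMemory S)

-- Register 0 holds the number of medians, register 1 their base address.
Outputs : ∀ {d m} → State → (Fin m → Perm d) → Set
Outputs {m = m} s Y =
  register s 0 ≡ m ×
  (∀ i j → memory s (register s 1 + toℕ (combine i j)) ≡ toℕ (Y i ⟨$⟩ʳ j))

-- The word length must be at least b times the logarithm of the sum of the
-- numbers n, d, k and the denominator of p in the input.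
WordLength : ℕ → ℕ → ℕ → ℕ → ℚ → ℕ → Set
WordLength b n d k p w = (n + d + k + ℚ.↧ₙ p) ^ b ≤ 2 ^ w

{-# OPTIONS --safe #-}
module Submission where

-- An input permutation x agrees with an optimal median y of its cluster off a
-- set I x of Δ x y symbols.  Let the cluster have s points and cost W.  Two of
-- its points x and x′ are at distance at most |I x ∪ I x′|, so if no point of
-- the cluster is a 1.999-approximate median, then the numbers |I x ∩ I x′| add
-- up to at most s W / 1000 over all pairs of points.  By averaging there are
-- five points for which the ten pairwise overlaps add up to some P with
-- s P ≤ 30 W / 1000.  The majority of these five orders two symbols as y does
-- unless one of the symbols is in two of the five sets, which happens for at
-- most P symbols.  Every cyclic triangle of the majority tournament contains
-- such a symbol, so greedily deleting cyclic triangles removes at most 3 P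
-- symbols, and sorting what is left gives a candidate at distance at most 4 P
-- from y, whose cost is at most W + 4 s P ≤ 1.12 W.
--
-- A point taken five times gives the point itself, so it suffices to try all
-- k-tuples of the n^5 candidates, which are at distance d minus the length of a
-- longest increasing subsequence from the points.  For fixed medians the
-- outliers are the points outside the ⌈(1 - p) n⌉ smallest distances.

open import Defs
open import Data.Bool using (Bool; true; false; T; not; _∧_; _∨_; if_then_else_)
open import Data.Bool.Properties using (T-≡)
open import Data.Empty using (⊥)
open import Data.Fin as Fin using (Fin; toℕ; fromℕ<; combine; remQuot; punchIn; punchOut)
open import Data.Fin.Permutation as Permutation
  using (_⟨$⟩ʳ_; _⟨$⟩ˡ_; inverseˡ; inverseʳ; permutation)
import Data.Fin.Properties as Finₚ
open import Data.Fin.Subset using (Subset; _∈_; _∉_; ∣_∣)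
open import Data.Integer as ℤ using ()
import Data.Integer.Properties as ℤₚ
open import Data.List using (List; []; _∷_; _++_)
open import Data.Nat
open import Data.Nat.Coprimality using (Coprime)
open import Data.Nat.DivMod hiding (_mod_; _div_)
open import Data.Nat.Logarithm using (⌈log₂_⌉; ⌈log₂⌉-mono-≤)
open import Data.Nat.Properties
open import Data.Nat.Tactic.RingSolver using (solve-∀)
open import Data.Product using (Σ-syntax; ∃-syntax; _×_; _,_; proj₁; proj₂; ∃)
open import Data.Rational as ℚ using (ℚ; 0ℚ; 1ℚ)
import Data.Rational.Properties as ℚₚ
open import Data.Rational.Unnormalised as ℚᵘ using (mkℚᵘ)
import Data.Rational.Unnormalised.Properties as ℚᵘₚ
open import Data.Sum using (_⊎_; inj₁; inj₂)
open import Data.Unit using (⊤; tt)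
open import Data.Vec as Vec using (Vec; []; _∷_; lookup; insertAt; removeAt)
import Data.Vec.Properties as Vecₚ
open import Function using (_∘_; id; Equivalence)
open import Relation.Binary.Definitions using (tri<; tri≈; tri>)
open import Relation.Binary.PropositionalEquality
open import Relation.Nullary using (¬_; yes; no; Dec; contradiction)
open import Relation.Nullary.Decidable using (_→-dec_)
open import Algebra.Properties.CommutativeMonoid.Sum +-0-commutativeMonoid using (sum)

-- Two obstacles shape the proof. Distances come from the quadratic dynamic program for increasing
-- subsequences, although the time bound grants only d log d next to n^O(k). The excess is absorbed:
-- either d is at most the power of n in front, and one factor d is paid by doubling the exponent,
-- or d exceeds that power and the whole term is below d^3. The term n^5 d^3 itself pays for the
-- cubic search for cyclic triangles, made once per candidate. The other obstacle is the machine. No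
-- sorting is programmed: candidates and outliers are read off ranks, obtained by counting
-- predecessors. The commands use countdown loops only, and absence of overflow, of interference and
-- of costly loops is decided by evaluating syntactic checks, so that only functional correctness
-- needs proofs. Permutations are handled as position functions on ℕ and distances as least numbers
-- of deleted symbols; character moves occur only in the translation near the end. If k ≥ n, the
-- points themselves are the medians.

∑ : ℕ → (ℕ → ℕ) → ℕ
∑ zero    f = 0
∑ (suc m) f = ∑ m f + f m

ι : Bool → ℕ
ι b = if b then 1 else 0

count : ℕ → (ℕ → Bool) → ℕ
count m χ = ∑ m λ i → ι (χ i)

∑-cong : ∀ m {f g} → (∀ i → i < m → f i ≡ g i) → ∑ m f ≡ ∑ m g
∑-cong zero    h = refl
∑-cong (suc m) h =
  cong₂ _+_ (∑-cong m λ i i<m → h i (m≤n⇒m≤1+n i<m)) (h m ≤-refl)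

∑-mono : ∀ m {f g} → (∀ i → i < m → f i ≤ g i) → ∑ m f ≤ ∑ m g
∑-mono zero    h = z≤n
∑-mono (suc m) h =
  +-mono-≤ (∑-mono m λ i i<m → h i (m≤n⇒m≤1+n i<m)) (h m ≤-refl)

+-interchange : ∀ a b c e → (a + b) + (c + e) ≡ (a + c) + (b + e)
+-interchange = solve-∀

∑-+ : ∀ m {f g} → ∑ m (λ i → f i + g i) ≡ ∑ m f + ∑ m g
∑-+ zero            = refl
∑-+ (suc m) {f} {g} =
  trans (cong (_+ (f m + g m)) (∑-+ m)) (+-interchange (∑ m f) _ _ _)

∑-*ˡ : ∀ m c {f} → ∑ m (λ i → c * f i) ≡ c * ∑ m f
∑-*ˡ zero    c     = sym (*-zeroʳ c)
∑-*ˡ (suc m) c {f} =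
  trans (cong (_+ c * f m) (∑-*ˡ m c)) (sym (*-distribˡ-+ c (∑ m f) (f m)))

∑-*ʳ : ∀ m c {f} → ∑ m (λ i → f i * c) ≡ ∑ m f * c
∑-*ʳ m c {f} =
  trans (∑-cong m λ i _ → *-comm (f i) c) (trans (∑-*ˡ m c) (*-comm c (∑ m f)))

∑-const : ∀ m c → ∑ m (λ _ → c) ≡ m * c
∑-const zero    c = refl
∑-const (suc m) c = trans (cong (_+ c) (∑-const m c)) (+-comm (m * c) c)

∑-zero : ∀ m → ∑ m (λ _ → 0) ≡ 0
∑-zero m = trans (∑-const m 0) (*-zeroʳ m)

∑-swap : ∀ m l (f : ℕ → ℕ → ℕ) →
         ∑ m (λ i → ∑ l (f i)) ≡ ∑ l (λ j → ∑ m (λ i → f i j))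
∑-swap zero    l f = sym (∑-zero l)
∑-swap (suc m) l f = trans (cong (_+ ∑ l (f m)) (∑-swap m l f)) (sym (∑-+ l))

∑-term : ∀ m {f i} → i < m → f i ≤ ∑ m f
∑-term (suc m) {f} i<1+m with m<1+n⇒m<n∨m≡n i<1+m
... | inj₁ i<m  = ≤-trans (∑-term m i<m) (m≤m+n _ _)
... | inj₂ refl = m≤n+m _ _

∑-bound : ∀ m {f c} → (∀ i → i < m → f i ≤ c) → ∑ m f ≤ m * c
∑-bound m {c = c} h = ≤-trans (∑-mono m h) (≤-reflexive (∑-const m c))

∑-strict : ∀ m {f g i} → (∀ i → i < m → f i ≤ g i) → i < m → f i < g i →
           ∑ m f < ∑ m g
∑-strict (suc m) h i<1+m fi<gi with m<1+n⇒m<n∨m≡n i<1+m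
... | inj₁ i<m  =
  +-mono-<-≤ (∑-strict m (λ i i<m → h i (m≤n⇒m≤1+n i<m)) i<m fi<gi) (h m ≤-refl)
... | inj₂ refl =
  +-mono-≤-< (∑-mono m (λ i i<m → h i (m≤n⇒m≤1+n i<m))) fi<gi

∑-≡0 : ∀ m {f i} → ∑ m f ≡ 0 → i < m → f i ≡ 0
∑-≡0 m e i<m = n≤0⇒n≡0 (subst (_ ≤_) e (∑-term m i<m))

ι≤1 : ∀ b → ι b ≤ 1
ι≤1 true  = ≤-refl
ι≤1 false = z≤n

ι-not : ∀ b → ι b + ι (not b) ≡ 1
ι-not true  = refl
ι-not false = refl

count≤ : ∀ m {χ} → count m χ ≤ m
count≤ m {χ} = ≤-trans (∑-bound m λ i _ → ι≤1 (χ i)) (≤-reflexive (*-identityʳ m))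

count-not : ∀ m χ → count m χ + count m (λ i → not (χ i)) ≡ m
count-not m χ =
  trans (sym (∑-+ m)) (trans (∑-cong m λ i _ → ι-not (χ i))
    (trans (∑-const m 1) (*-identityʳ m)))

≡ᵇ-refl : ∀ m → (m ≡ᵇ m) ≡ true
≡ᵇ-refl zero    = refl
≡ᵇ-refl (suc m) = ≡ᵇ-refl m

≡ᵇ-≢ : ∀ {m n} → m ≢ n → (m ≡ᵇ n) ≡ false
≡ᵇ-≢ {m} {n} m≢n with m ≡ᵇ n in eq
... | true  = contradiction (≡ᵇ⇒≡ m n (subst T (sym eq) tt)) m≢n
... | false = refl

≡ᵇ-true : ∀ {m n} → (m ≡ᵇ n) ≡ true → m ≡ n
≡ᵇ-true {m} {n} eq = ≡ᵇ⇒≡ m n (subst T (sym eq) tt)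

<ᵇ-true : ∀ {m n} → m < n → (m <ᵇ n) ≡ true
<ᵇ-true m<n = Equivalence.to T-≡ (<⇒<ᵇ m<n)

<ᵇ-false : ∀ {m n} → n ≤ m → (m <ᵇ n) ≡ false
<ᵇ-false {m} {n} n≤m with m <ᵇ n in eq
... | true  = contradiction (<ᵇ⇒< m n (subst T (sym eq) tt)) (≤⇒≯ n≤m)
... | false = refl

<ᵇ-true⁻¹ : ∀ {m n} → (m <ᵇ n) ≡ true → m < n
<ᵇ-true⁻¹ {m} {n} eq = <ᵇ⇒< m n (subst T (sym eq) tt)

<ᵇ-false⁻¹ : ∀ {m n} → (m <ᵇ n) ≡ false → n ≤ m
<ᵇ-false⁻¹ {m} {n} eq with m <? n
... | yes m<n = contradiction (trans (sym (<ᵇ-true m<n)) eq) λ ()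
... | no  m≮n = ≮⇒≥ m≮n

∑-δ : ∀ m {j} (f : ℕ → ℕ) → j < m → ∑ m (λ i → ι (i ≡ᵇ j) * f i) ≡ f j
∑-δ (suc m) {j} f j<1+m with m<1+n⇒m<n∨m≡n j<1+m
... | inj₁ j<m  rewrite ≡ᵇ-≢ (>⇒≢ j<m) = trans (+-identityʳ _) (∑-δ m f j<m)
... | inj₂ refl rewrite ≡ᵇ-refl m =
  trans (cong₂ _+_ (trans (∑-cong m λ i i<m → off i i<m) (∑-zero m)) (+-identityʳ (f m))) refl
  where
  off : ∀ i → i < m → ι (i ≡ᵇ m) * f i ≡ 0
  off i i<m rewrite ≡ᵇ-≢ (<⇒≢ i<m) = refl

-- Injective self-maps of an initial segment of ℕ

Inj : ℕ → (ℕ → ℕ) → Set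
Inj m ρ = ∀ a b → a < m → b < m → ρ a ≡ ρ b → a ≡ b

Bounded : ℕ → (ℕ → ℕ) → Set
Bounded m ρ = ∀ a → a < m → ρ a < m

fibre≤1 : ∀ m {ρ} l r → Inj l ρ → m ≤ l → ∑ m (λ a → ι (ρ a ≡ᵇ r)) ≤ 1
fibre≤1 zero        l r inj m≤l = z≤n
fibre≤1 (suc m) {ρ} l r inj m<l with ρ m ≡ᵇ r in eq
... | false = ≤-trans (≤-reflexive (+-identityʳ _)) (fibre≤1 m l r inj (<⇒≤ m<l))
... | true  = ≤-reflexive (cong (_+ 1) (trans (∑-cong m off) (∑-zero m)))
  where
  off : ∀ a → a < m → ι (ρ a ≡ᵇ r) ≡ 0
  off a a<m with ρ a ≡ᵇ r in eq′
  ... | false = refl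
  ... | true  = contradiction
    (inj a m (<-trans a<m m<l) m<l (trans (≡ᵇ-true eq′) (sym (≡ᵇ-true eq)))) (<⇒≢ a<m)

-- Pigeonhole by double counting: fibres have at most one point and their sizes add up to m, so an
-- empty fibre would make the total smaller than m.
fibre≡1 : ∀ m {ρ} r → Inj m ρ → Bounded m ρ → r < m →
          ∑ m (λ a → ι (ρ a ≡ᵇ r)) ≡ 1
fibre≡1 m {ρ} r inj bnd r<m with ∑ m (λ a → ι (ρ a ≡ᵇ r)) <? 1
... | no  ≥1 = ≤-antisym (fibre≤1 m m r inj ≤-refl) (≮⇒≥ ≥1)
... | yes <1 = contradiction total (<⇒≢ (subst (∑ m (λ r → ∑ m (λ a → ι (ρ a ≡ᵇ r))) <_)
    (trans (∑-const m 1) (*-identityʳ m))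
    (∑-strict m {λ r → ∑ m (λ a → ι (ρ a ≡ᵇ r))} {λ _ → 1} (λ r _ → fibre≤1 m m r inj ≤-refl) r<m <1)))
  where
  total : ∑ m (λ r → ∑ m (λ a → ι (ρ a ≡ᵇ r))) ≡ m
  total = trans (∑-swap m m λ r a → ι (ρ a ≡ᵇ r))
    (trans (∑-cong m λ a a<m → trans (∑-cong m λ r _ → flip a r) (∑-δ m (λ _ → 1) (bnd a a<m)))
      (trans (∑-const m 1) (*-identityʳ m)))
    where
    flip : ∀ a r → ι (ρ a ≡ᵇ r) ≡ ι (r ≡ᵇ ρ a) * 1
    flip a r with ρ a ≟ r
    ... | yes refl rewrite ≡ᵇ-refl (ρ a) = refl
    ... | no  ≢    rewrite ≡ᵇ-≢ ≢ | ≡ᵇ-≢ (≢ ∘ sym) = refl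

search : ∀ m (χ : ℕ → Bool) →
         (∃[ i ] i < m × χ i ≡ true) ⊎ (∀ i → i < m → χ i ≡ false)
search zero    χ = inj₂ λ _ ()
search (suc m) χ with χ m in eq | search m χ
... | true  | _                   = inj₁ (m , ≤-refl , eq)
... | false | inj₁ (i , i<m , χi) = inj₁ (i , m≤n⇒m≤1+n i<m , χi)
... | false | inj₂ none           = inj₂ λ i i<1+m → case i i<1+m
  where
  case : ∀ i → i < suc m → χ i ≡ false
  case i i<1+m with m<1+n⇒m<n∨m≡n i<1+m
  ... | inj₁ i<m  = none i i<m
  ... | inj₂ refl = eq

onto : ∀ m {ρ} → Inj m ρ → Bounded m ρ → ∀ r → r < m → ∃[ a ] a < m × ρ a ≡ r
onto m {ρ} inj bnd r r<m with search m (λ a → ρ a ≡ᵇ r)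
... | inj₁ (a , a<m , eq) = a , a<m , ≡ᵇ-true eq
... | inj₂ none = contradiction
  (trans (sym (fibre≡1 m r inj bnd r<m))
    (trans (∑-cong m λ a a<m → cong ι (none a a<m)) (∑-zero m))) λ ()

≡ᵇ-comm : ∀ a b → (a ≡ᵇ b) ≡ (b ≡ᵇ a)
≡ᵇ-comm zero    zero    = refl
≡ᵇ-comm zero    (suc b) = refl
≡ᵇ-comm (suc a) zero    = refl
≡ᵇ-comm (suc a) (suc b) = ≡ᵇ-comm a b

-- Write `f (ρ a)` as a sum over r of `f r` against an indicator and exchange the sums; each r is
-- then counted as often as it is attained, which is once.
reindex : ∀ m {ρ} (f : ℕ → ℕ) → Inj m ρ → Bounded m ρ → ∑ m (λ a → f (ρ a)) ≡ ∑ m f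
reindex m {ρ} f inj bnd = trans
  (∑-cong m λ a a<m → trans (sym (∑-δ m f (bnd a a<m)))
    (∑-cong m λ r _ → cong (λ b → ι b * f r) (≡ᵇ-comm r (ρ a))))
  (trans (∑-swap m m _) (∑-cong m λ r r<m →
    trans (∑-*ʳ m (f r)) (trans (cong (_* f r) (fibre≡1 m r inj bnd r<m)) (+-identityʳ (f r)))))

-- Ranks with respect to a strict total order on [0, m)

record StrictOrder (m : ℕ) (R : ℕ → ℕ → Bool) : Set where
  field
    irr : ∀ a → a < m → R a a ≡ false
    tot : ∀ a b → a < m → b < m → a ≢ b → R a b ≡ false → R b a ≡ true
    tra : ∀ a b c → a < m → b < m → c < m → R a b ≡ true → R b c ≡ true → R a c ≡ true

-- The place in the sorted order, obtained by counting predecessors. It replaces sorting both for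
-- the candidate permutations and for the selection of the inliers.
rank : ℕ → (ℕ → ℕ → Bool) → ℕ → ℕ
rank m R a = count m λ b → R b a

module _ {m R} (ord : StrictOrder m R) where
  open StrictOrder ord

  rank-mono : ∀ a b → a < m → b < m → R a b ≡ true → rank m R a < rank m R b
  rank-mono a b a<m b<m ab = ∑-strict m le a<m lower
    where
    le : ∀ c → c < m → ι (R c a) ≤ ι (R c b)
    le c c<m with R c a in ca
    ... | false = z≤n
    ... | true  rewrite tra c a b c<m a<m b<m ca ab = ≤-refl
    lower : ι (R a a) < ι (R a b)
    lower rewrite irr a a<m | ab = ≤-refl

  rank-bounded : Bounded m (rank m R)
  rank-bounded a a<m = subst (rank m R a <_) (trans (∑-const m 1) (*-identityʳ m))
    (∑-strict m (λ b _ → ι≤1 (R b a)) a<m (subst (λ b → ι b < 1) (sym (irr a a<m)) ≤-refl))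

  rank-inj : Inj m (rank m R)
  rank-inj a b a<m b<m eq with a ≟ b
  ... | yes a≡b = a≡b
  ... | no  a≢b with R a b in ab
  ...   | true  = contradiction eq (<⇒≢ (rank-mono a b a<m b<m ab))
  ...   | false = contradiction (sym eq)
    (<⇒≢ (rank-mono b a b<m a<m (tot a b a<m b<m a≢b ab)))

  rank-reflects : ∀ a b → a < m → b < m → rank m R a < rank m R b → R a b ≡ true
  rank-reflects a b a<m b<m lower with R a b in ab
  ... | true  = refl
  ... | false with a ≟ b
  ...   | yes refl = contradiction lower (<-irrefl refl)
  ...   | no  a≢b  = contradiction lower
    (<⇒≯ (rank-mono b a b<m a<m (tot a b a<m b<m a≢b ab)))

-- Programs over a store with named variables and arrays

-- Definitionally the same as the machine update `_[_↦_]`, because `does (a ≟ b)` reduces to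
-- `a ≡ᵇ b`; the lemmas below are applied to both.
_⟨_↦_⟩ : {X : Set} → (ℕ → X) → ℕ → X → ℕ → X
(f ⟨ a ↦ v ⟩) b = if a ≡ᵇ b then v else f b

upd-same : ∀ {X : Set} (f : ℕ → X) a v → (f ⟨ a ↦ v ⟩) a ≡ v
upd-same f a v rewrite ≡ᵇ-refl a = refl

upd-other : ∀ {X : Set} (f : ℕ → X) a b v → a ≢ b → (f ⟨ a ↦ v ⟩) b ≡ f b
upd-other f a b v a≢b rewrite ≡ᵇ-≢ a≢b = refl

record Store : Set where
  constructor ⟪_,_,_⟫
  field
    vars  : ℕ → ℕ
    cells : ℕ → ℕ → ℕ
    tape  : ℕ → ℕ
open Store

-- `con` reads a register that commands never write, `given` reads the input. Input addresses, like
-- those of `output`, are reduced modulo the input size, so that they cannot reach the arrays stored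
-- behind it and the simulation needs no proof that they are in bounds.
data Exp : Set where
  #_    : ℕ → Exp
  con   : ℕ → Exp
  var   : ℕ → Exp
  get   : ℕ → Exp → Exp
  given : Exp → Exp
  bin   : Op → Exp → Exp → Exp

infixl 6 _⊕_ _⊖_
infixl 7 _⊗_ _⊘_ _⊛_
infix  5 _⊲_
infix  4 _:=_
infixr 3 _∙_

_⊕_ _⊖_ _⊗_ _⊘_ _⊛_ _⊲_ : Exp → Exp → Exp
_⊕_ = bin add
_⊖_ = bin sub
_⊗_ = bin mul
_⊘_ = bin div
_⊛_ = bin mod
_⊲_ = bin lt

-- for x y c runs c with x counting down from con y ∸ 1 to 0.
data Cmd : Set where
  _:=_   : ℕ → Exp → Cmd
  put    : ℕ → Exp → Exp → Cmd
  output : Exp → Exp → Cmd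
  _∙_    : Cmd → Cmd → Cmd
  when   : Exp → Cmd → Cmd
  for    : ℕ → ℕ → Cmd → Cmd

set : ℕ → ℕ → Store → Store
set x v σ = ⟪ vars σ ⟨ x ↦ v ⟩ , cells σ , tape σ ⟫

iterate : (Store → Store) → ℕ → ℕ → Store → Store
iterate f x zero    σ = σ
iterate f x (suc m) σ = iterate f x m (f (set x m σ))

-- A function of the value of the condition and of both outcomes, so that a property of `when` can
-- be transported along an equation for the condition alone.
choose : ℕ → Store → Store → Store
choose zero    σ τ = σ
choose (suc _) σ τ = τ

-- Computed from the syntax, so that for a concrete command every framing condition is proved by
-- `refl`.
modifiesVar modifiesCells : Cmd → ℕ → Bool
modifiesVar (x := e)     y = x ≡ᵇ y
modifiesVar (put _ _ _)  y = false
modifiesVar (output _ _) y = false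
modifiesVar (c ∙ c′)     y = modifiesVar c y ∨ modifiesVar c′ y
modifiesVar (when _ c)   y = modifiesVar c y
modifiesVar (for x _ c)  y = (x ≡ᵇ y) ∨ modifiesVar c y
modifiesCells (x := e)     A = false
modifiesCells (put B _ _)  A = B ≡ᵇ A
modifiesCells (output _ _) A = false
modifiesCells (c ∙ c′)     A = modifiesCells c A ∨ modifiesCells c′ A
modifiesCells (when _ c)   A = modifiesCells c A
modifiesCells (for _ _ c)  A = modifiesCells c A

modifiesTape : Cmd → Bool
modifiesTape (x := e)     = false
modifiesTape (put _ _ _)  = false
modifiesTape (output _ _) = true
modifiesTape (c ∙ c′)     = modifiesTape c ∨ modifiesTape c′
modifiesTape (when _ c)   = modifiesTape c
modifiesTape (for _ _ c)  = modifiesTape c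

record Frame (c : Cmd) (σ τ : Store) : Set where
  field
    sameVar   : ∀ x → modifiesVar c x ≡ false → vars τ x ≡ vars σ x
    sameCells : ∀ A → modifiesCells c A ≡ false → ∀ i → cells τ A i ≡ cells σ A i
    sameTape  : modifiesTape c ≡ false → ∀ i → tape τ i ≡ tape σ i
open Frame

∨-false : ∀ {a b} → (a ∨ b) ≡ false → a ≡ false × b ≡ false
∨-false {false} {false} _ = refl , refl

∧-T : ∀ {a b} → T (a ∧ b) → T a × T b
∧-T {true} {true} _ = tt , tt

not-T : ∀ {b} → T (not b) → b ≡ false
not-T {false} _ = refl

frame-refl : ∀ {c σ} → Frame c σ σ
frame-refl = record
  { sameVar = λ _ _ → refl ; sameCells = λ _ _ _ → refl ; sameTape = λ _ _ → refl }

-- Compilation to the word RAM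

cell : ℕ → Expr → Expr
cell A e = binary add (reg 5) (binary add (binary mul (lit 16) e) (lit A))

⌈_⌉ : Exp → Expr
⌈ # a ⌉       = lit a
⌈ con r ⌉     = reg r
⌈ var x ⌉     = reg (10 + x)
⌈ get A e ⌉   = load (cell A ⌈ e ⌉)
⌈ given e ⌉   = load (binary mod ⌈ e ⌉ (reg 5))
⌈ bin o e f ⌉ = binary o ⌈ e ⌉ ⌈ f ⌉

compile : Cmd → Program
compile (x := e)     = (10 + x) ≔ ⌈ e ⌉
compile (put A e f)  = store (cell A ⌈ e ⌉) ⌈ f ⌉
compile (output e f) = store (binary mod ⌈ e ⌉ (reg 5)) ⌈ f ⌉
compile (c ∙ c′)     = compile c ⨾ compile c′
compile (when e c)   = if ⌈ e ⌉ (compile c) skip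
compile (for x y c)  = (10 + x) ≔ reg y ⨾
  while (reg (10 + x)) ((10 + x) ≔ binary sub (reg (10 + x)) (lit 1) ⨾ compile c)

-- The constants κ 0, …, κ 9 are the contents of the registers that the
-- commands do not modify: κ 5 is the size of the input array, at whose end
-- the arrays cells σ A, A < 16, are stored interleaved.
module Semantics (κ : ℕ → ℕ) where

  ⟦_⟧ᵉ : Exp → Store → ℕ
  ⟦ # a ⟧ᵉ       σ = a
  ⟦ con r ⟧ᵉ     σ = κ r
  ⟦ var x ⟧ᵉ     σ = vars σ x
  ⟦ get A e ⟧ᵉ   σ = cells σ A (⟦ e ⟧ᵉ σ)
  ⟦ given e ⟧ᵉ   σ = tape σ (apply mod (⟦ e ⟧ᵉ σ) (κ 5))
  ⟦ bin o e f ⟧ᵉ σ = apply o (⟦ e ⟧ᵉ σ) (⟦ f ⟧ᵉ σ)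

  ⟦_⟧ : Cmd → Store → Store
  ⟦ x := e ⟧     σ = set x (⟦ e ⟧ᵉ σ) σ
  ⟦ put A e f ⟧  σ =
    ⟪ vars σ , cells σ ⟨ A ↦ cells σ A ⟨ ⟦ e ⟧ᵉ σ ↦ ⟦ f ⟧ᵉ σ ⟩ ⟩ , tape σ ⟫
  ⟦ output e f ⟧ σ =
    ⟪ vars σ , cells σ , tape σ ⟨ apply mod (⟦ e ⟧ᵉ σ) (κ 5) ↦ ⟦ f ⟧ᵉ σ ⟩ ⟫
  ⟦ c ∙ c′ ⟧     σ = ⟦ c′ ⟧ (⟦ c ⟧ σ)
  ⟦ when e c ⟧   σ = choose (⟦ e ⟧ᵉ σ) σ (⟦ c ⟧ σ)
  ⟦ for x y c ⟧  σ = iterate ⟦ c ⟧ x (κ y) (set x (κ y) σ)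

  frame-trans : ∀ c c′ c″ {σ τ υ} →
    (∀ x → modifiesVar c″ x ≡ false → modifiesVar c x ≡ false × modifiesVar c′ x ≡ false) →
    (∀ A → modifiesCells c″ A ≡ false → modifiesCells c A ≡ false × modifiesCells c′ A ≡ false) →
    (modifiesTape c″ ≡ false → modifiesTape c ≡ false × modifiesTape c′ ≡ false) →
    Frame c σ τ → Frame c′ τ υ → Frame c″ σ υ
  frame-trans c c′ c″ v a t F G = record
    { sameVar   = λ x h → trans (sameVar G x (proj₂ (v x h))) (sameVar F x (proj₁ (v x h)))
    ; sameCells = λ A h i →
        trans (sameCells G A (proj₂ (a A h)) i) (sameCells F A (proj₁ (a A h)) i)
    ; sameTape  = λ h i → trans (sameTape G (proj₂ (t h)) i) (sameTape F (proj₁ (t h)) i) }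

  set-frame : ∀ x y c v σ → Frame (for x y c) σ (set x v σ)
  set-frame x y c v σ = record
    { sameVar   = λ z h → upd-other (vars σ) x z v λ { refl → contradiction
        (trans (sym (≡ᵇ-refl x)) (proj₁ (∨-false {x ≡ᵇ z} h))) λ () }
    ; sameCells = λ _ _ _ → refl
    ; sameTape  = λ _ _ → refl }

  body-frame : ∀ x y c {σ τ} → Frame c σ τ → Frame (for x y c) σ τ
  body-frame x y c F = record
    { sameVar   = λ z h → sameVar F z (proj₂ (∨-false {x ≡ᵇ z} h))
    ; sameCells = sameCells F
    ; sameTape  = sameTape F }

  loop-trans : ∀ x y c {σ τ υ} → Frame (for x y c) σ τ → Frame (for x y c) τ υ →
               Frame (for x y c) σ υ
  loop-trans x y c =
    frame-trans (for x y c) (for x y c) (for x y c)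
      (λ _ h → h , h) (λ _ h → h , h) (λ h → h , h)

  frame : ∀ c σ → Frame c σ (⟦ c ⟧ σ)
  iterate-frame : ∀ x y c m σ → Frame (for x y c) σ (iterate ⟦ c ⟧ x m σ)

  frame (x := e) σ = record
    { sameVar   = λ z h → upd-other (vars σ) x z (⟦ e ⟧ᵉ σ) λ { refl → contradiction
        (trans (sym (≡ᵇ-refl x)) h) λ () }
    ; sameCells = λ _ _ _ → refl
    ; sameTape  = λ _ _ → refl }
  frame (put A e f) σ = record
    { sameVar   = λ _ _ → refl
    ; sameCells = λ B h i → cong (λ g → g i) (upd-other (cells σ) A B (cells σ A ⟨ ⟦ e ⟧ᵉ σ ↦ ⟦ f ⟧ᵉ σ ⟩) λ { refl → contradiction
        (trans (sym (≡ᵇ-refl A)) h) λ () })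
    ; sameTape  = λ _ _ → refl }
  frame (output e f) σ = record
    { sameVar   = λ _ _ → refl
    ; sameCells = λ _ _ _ → refl
    ; sameTape  = λ () }
  frame (c ∙ c′) σ = frame-trans c c′ (c ∙ c′)
    (λ x → ∨-false) (λ A → ∨-false) ∨-false (frame c σ) (frame c′ (⟦ c ⟧ σ))
  frame (when e c) σ with ⟦ e ⟧ᵉ σ
  ... | zero  = frame-refl {when e c}
  ... | suc _ = record
    { sameVar = sameVar F ; sameCells = sameCells F ; sameTape = sameTape F }
    where F = frame c σ
  frame (for x y c) σ = loop-trans x y c
    (set-frame x y c (κ y) σ) (iterate-frame x y c (κ y) (set x (κ y) σ))

  iterate-frame x y c zero    σ = frame-refl {for x y c}
  iterate-frame x y c (suc m) σ = loop-trans x y c (set-frame x y c m σ)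
    (loop-trans x y c (body-frame x y c (frame c (set x m σ)))
      (iterate-frame x y c m (⟦ c ⟧ (set x m σ))))

  -- As loops count down, `I i` describes the store when the iterations with index at least i are
  -- done. The step also receives the frame from the initial store, so an invariant need mention
  -- only what the body changes.
  for-rule : ∀ x y c σ (I : ℕ → Store → Set) →
    I (κ y) (set x (κ y) σ) →
    (∀ i τ → i < κ y → Frame (for x y c) σ τ → I (suc i) τ → I i (⟦ c ⟧ (set x i τ))) →
    I 0 (⟦ for x y c ⟧ σ)
  for-rule x y c σ I init step =
    go (κ y) (set x (κ y) σ) ≤-refl (set-frame x y c (κ y) σ) init
    where
    go : ∀ m τ → m ≤ κ y → Frame (for x y c) σ τ → I m τ → I 0 (iterate ⟦ c ⟧ x m τ)
    go zero    τ _ F h = h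
    go (suc m) τ m<y F h = go m (⟦ c ⟧ (set x m τ)) (<⇒≤ m<y)
      (loop-trans x y c F (loop-trans x y c (set-frame x y c m τ)
        (body-frame x y c (frame c (set x m τ)))))
      (step m τ m<y F h)

  time : Cmd → ℕ
  time (x := e)     = 1 + cost ⌈ e ⌉
  time (put A e f)  = 1 + (cost (cell A ⌈ e ⌉) + cost ⌈ f ⌉)
  time (output e f) = 1 + (cost (binary mod ⌈ e ⌉ (reg 5)) + cost ⌈ f ⌉)
  time (c ∙ c′)     = time c + time c′
  time (when e c)   = 1 + (cost ⌈ e ⌉ + (1 + time c))
  -- An iteration pays 2 for the test and 4 for the decrement; the outer 2s pay for the initial
  -- assignment and for the failing test.
  time (for x y c)  = 2 + (κ y * (6 + time c) + 2)

-- Every value is bounded by a power of M = n + d + k + (denominator of p).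

-- A literal a is charged as `M ^ a`, so the stride 16 alone makes cell addresses exceed degree 16.
-- The value 64 is above the degree of every expression that the programs evaluate.
wordExponent : ℕ
wordExponent = 64

-- Registers 0 to 4 hold n, d, k and the numerator and denominator of p; registers 5 to 8 hold n d,
-- n^5, n d + 1 and the number of inliers, with the degrees that `deg` gives to the expressions in
-- `setup`.
rdeg : ℕ → ℕ
rdeg 0 = 1
rdeg 1 = 1
rdeg 2 = 1
rdeg 3 = 1
rdeg 4 = 1
rdeg 5 = 2
rdeg 6 = 5
rdeg 7 = 4
rdeg 8 = 4
rdeg _ = 6

rdeg≤6 : ∀ y → rdeg y ≤ 6
rdeg≤6 0 = s≤s z≤n
rdeg≤6 1 = s≤s z≤n
rdeg≤6 2 = s≤s z≤n
rdeg≤6 3 = s≤s z≤n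
rdeg≤6 4 = s≤s z≤n
rdeg≤6 5 = s≤s (s≤s z≤n)
rdeg≤6 6 = s≤s (s≤s (s≤s (s≤s (s≤s z≤n))))
rdeg≤6 7 = s≤s (s≤s (s≤s (s≤s z≤n)))
rdeg≤6 8 = s≤s (s≤s (s≤s (s≤s z≤n)))
rdeg≤6 (suc (suc (suc (suc (suc (suc (suc (suc (suc _))))))))) = ≤-refl

deg : Expr → ℕ
deg (lit a)          = a
deg (reg r)          = rdeg r
deg (load e)         = 6
deg (binary add e f) = suc (deg e + deg f)
deg (binary sub e f) = deg e
deg (binary mul e f) = deg e + deg f
deg (binary div e f) = deg e
deg (binary mod e f) = deg f
deg (binary lt e f)  = 0

fits : Expr → Bool
fits (lit a)        = a <ᵇ wordExponent
fits (reg r)        = rdeg r <ᵇ wordExponent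
fits (load e)       = fits e
fits (binary o e f) = (deg (binary o e f) <ᵇ wordExponent) ∧ (fits e ∧ fits f)

wellFormed : Exp → Bool
wellFormed (# a)       = true
wellFormed (con r)     = r <ᵇ 10
wellFormed (var x)     = true
wellFormed (get A e)   = (A <ᵇ 16) ∧ wellFormed e
wellFormed (given e)   = wellFormed e
wellFormed (bin o e f) = wellFormed e ∧ wellFormed f

checkExp checkAddress checkTape : ℕ → Exp → Bool
checkExp     _ e = wellFormed e ∧ fits ⌈ e ⌉
checkAddress A e = (A <ᵇ 16) ∧ (wellFormed e ∧ fits (cell A ⌈ e ⌉))
checkTape    _ e = wellFormed e ∧ fits (binary mod ⌈ e ⌉ (reg 5))

-- Everything stored must stay below `M ^ 6`. A bare increment `var r ⊕ # 1` has degree 8 and fails,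
-- which is why the programs reduce counters modulo `cmax`, without effect on the values that occur,
-- or modulo `cN`, where digits have to wrap around.
checkValue : Exp → Bool
checkValue e = checkExp 0 e ∧ (deg ⌈ e ⌉ ≤ᵇ 6)

check : Cmd → Bool
check (x := e)     = checkValue e
check (put A e f)  = checkAddress A e ∧ checkValue f
check (output e f) = checkTape 0 e ∧ checkValue f
check (c ∙ c′)     = check c ∧ check c′
check (when e c)   = checkExp 0 e ∧ check c
check (for x y c)  = (y <ᵇ 10) ∧ (not (modifiesVar c x) ∧ check c)

-- Compiled commands compute their denotations in the stated time

module Simulation (κ : ℕ → ℕ) (w M : ℕ) (2≤M : 2 ≤ M) (fit : M ^ wordExponent ≤ 2 ^ w) where
  open Semantics κ

  instance
    M-nonZero : NonZero M
    M-nonZero = >-nonZero (≤-trans (s≤s z≤n) 2≤M)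

  evalℕ : State → Expr → ℕ
  evalℕ s (lit a)        = a
  evalℕ s (reg r)        = register s r
  evalℕ s (load e)       = memory s (evalℕ s e)
  evalℕ s (binary o e f) = apply o (evalℕ s e) (evalℕ s f)

  record Small (s : State) : Set where
    field
      smallReg : ∀ r → register s r ≤ M ^ rdeg r
      smallMem : ∀ a → memory s a ≤ M ^ 6
  open Small

  a≤M^a : ∀ a → a ≤ M ^ a
  a≤M^a zero    = z≤n
  a≤M^a (suc a) = begin
    1 + a         ≤⟨ +-monoʳ-≤ 1 (a≤M^a a) ⟩
    1 + M ^ a     ≤⟨ +-monoˡ-≤ (M ^ a) (m^n>0 M a) ⟩
    M ^ a + M ^ a ≡⟨ cong (_+_ (M ^ a)) (+-identityʳ (M ^ a)) ⟨
    2 * M ^ a     ≤⟨ *-monoˡ-≤ (M ^ a) 2≤M ⟩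
    M * M ^ a     ∎
    where open ≤-Reasoning

  apply-bound : ∀ o s e f → evalℕ s e ≤ M ^ deg e → evalℕ s f ≤ M ^ deg f →
                apply o (evalℕ s e) (evalℕ s f) ≤ M ^ deg (binary o e f)
  apply-bound add s e f h h′ = begin
    evalℕ s e + evalℕ s f                   ≤⟨ +-mono-≤ h h′ ⟩
    M ^ deg e + M ^ deg f                   ≤⟨ +-mono-≤
      (^-monoʳ-≤ M (m≤m+n (deg e) (deg f))) (^-monoʳ-≤ M (m≤n+m (deg f) (deg e))) ⟩
    M ^ (deg e + deg f) + M ^ (deg e + deg f) ≡⟨ cong (_+_ (M ^ (deg e + deg f))) (+-identityʳ _) ⟨
    2 * M ^ (deg e + deg f)                 ≤⟨ *-monoˡ-≤ _ 2≤M ⟩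
    M * M ^ (deg e + deg f)                 ∎
    where open ≤-Reasoning
  apply-bound sub s e f h h′ = ≤-trans (m∸n≤m _ (evalℕ s f)) h
  apply-bound mul s e f h h′ =
    ≤-trans (*-mono-≤ h h′) (≤-reflexive (sym (^-distribˡ-+-* M (deg e) (deg f))))
  apply-bound div s e f h h′ with evalℕ s f
  ... | zero  = z≤n
  ... | suc b = ≤-trans (m/n≤m (evalℕ s e) (suc b)) h
  apply-bound mod s e f h h′ with evalℕ s f
  ... | zero  = z≤n
  ... | suc b = ≤-trans (m%n≤n (evalℕ s e) (suc b)) h′
  apply-bound lt  s e f h h′ = ι≤1 (evalℕ s e <ᵇ evalℕ s f)

  evalℕ-bound : ∀ {s} → Small s → ∀ e → evalℕ s e ≤ M ^ deg e
  evalℕ-bound S (lit a)        = a≤M^a a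
  evalℕ-bound S (reg r)        = smallReg S r
  evalℕ-bound S (load e)       = smallMem S _
  evalℕ-bound {s} S (binary o e f) =
    apply-bound o s e f (evalℕ-bound S e) (evalℕ-bound S f)

  truncate-id : ∀ v a → v ≤ M ^ a → T (a <ᵇ wordExponent) → truncate w v ≡ v
  truncate-id v a v≤ a< = m<n⇒m%n≡m {{m^n≢0 2 w}}
    (≤-<-trans v≤ (<-≤-trans (^-monoʳ-< M 2≤M (<ᵇ⇒< a wordExponent a<)) fit))

  -- Every intermediate value is at most a power of M with exponent below 64, hence less than 2^w,
  -- so the reduction modulo 2^w does nothing.
  eval-exact : ∀ {s} → Small s → ∀ e → T (fits e) → eval w s e ≡ evalℕ s e
  eval-exact S (lit a)        h = truncate-id a a (a≤M^a a) h
  eval-exact S (reg r)        h = refl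
  eval-exact {s} S (load e)   h = cong (memory s) (eval-exact S e h)
  eval-exact {s} S (binary o e f) h
    with h₁ , h₂ ← ∧-T {deg (binary o e f) <ᵇ wordExponent} h
    with h₃ , h₄ ← ∧-T {fits e} h₂
    rewrite eval-exact S e h₃ | eval-exact S f h₄ =
    truncate-id _ (deg (binary o e f)) (evalℕ-bound S (binary o e f)) h₁

  record Represents (σ : Store) (s : State) : Set where
    field
      constant  : ∀ r → r < 10 → register s r ≡ κ r
      variable′ : ∀ x → register s (10 + x) ≡ vars σ x
      array     : ∀ A i → A < 16 → memory s (κ 5 + (16 * i + A)) ≡ cells σ A i
      tape≡     : ∀ i → i < κ 5 → memory s i ≡ tape σ i
  open Represents

  module _ (0<κ5 : 0 < κ 5) where

    mod-< : ∀ a → apply mod a (κ 5) < κ 5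
    mod-< a = go (κ 5) 0<κ5
      where
      go : ∀ b → 0 < b → apply mod a b < b
      go (suc b) _ = m%n<n a (suc b)

    evalℕ-⌈⌉ : ∀ {σ s} → Represents σ s → ∀ e → T (wellFormed e) →
               evalℕ s ⌈ e ⌉ ≡ ⟦ e ⟧ᵉ σ
    evalℕ-⌈⌉ R (# a)     h = refl
    evalℕ-⌈⌉ R (con r)   h = constant R r (<ᵇ⇒< r 10 h)
    evalℕ-⌈⌉ R (var x)   h = variable′ R x
    evalℕ-⌈⌉ {s = s} R (get A e) h with h₁ , h₂ ← ∧-T {A <ᵇ 16} h
      rewrite evalℕ-⌈⌉ R e h₂ | constant R 5 (s≤s (s≤s (s≤s (s≤s (s≤s (s≤s z≤n)))))) =
      array R A _ (<ᵇ⇒< A 16 h₁)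
    evalℕ-⌈⌉ R (given e) h
      rewrite evalℕ-⌈⌉ R e h | constant R 5 (s≤s (s≤s (s≤s (s≤s (s≤s (s≤s z≤n)))))) =
      tape≡ R _ (mod-< _)
    evalℕ-⌈⌉ R (bin o e f) h with h₁ , h₂ ← ∧-T {wellFormed e} h =
      cong₂ (apply o) (evalℕ-⌈⌉ R e h₁) (evalℕ-⌈⌉ R f h₂)

    eval-⌈⌉ : ∀ {σ s} → Small s → Represents σ s → ∀ e → T (checkExp 0 e) →
              eval w s ⌈ e ⌉ ≡ ⟦ e ⟧ᵉ σ
    eval-⌈⌉ S R e h with h₁ , h₂ ← ∧-T {wellFormed e} h =
      trans (eval-exact S ⌈ e ⌉ h₂) (evalℕ-⌈⌉ R e h₁)

    eval-small : ∀ {s} → Small s → ∀ e → T (checkValue e) → eval w s ⌈ e ⌉ ≤ M ^ 6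
    eval-small {s} S e h
      with h₁ , h₂ ← ∧-T {checkExp 0 e} h with _ , h₃ ← ∧-T {wellFormed e} h₁
      rewrite eval-exact S ⌈ e ⌉ h₃ =
      ≤-trans (evalℕ-bound S ⌈ e ⌉) (^-monoʳ-≤ M (≤ᵇ⇒≤ (deg ⌈ e ⌉) 6 h₂))

    eval-cell : ∀ {σ s} → Small s → Represents σ s → ∀ A e → T (checkAddress A e) →
                eval w s (cell A ⌈ e ⌉) ≡ κ 5 + (16 * ⟦ e ⟧ᵉ σ + A)
    eval-cell S R A e h
      with _ , h₁ ← ∧-T {A <ᵇ 16} h with h₂ , h₃ ← ∧-T {wellFormed e} h₁
      rewrite eval-exact S (cell A ⌈ e ⌉) h₃
            | constant R 5 (s≤s (s≤s (s≤s (s≤s (s≤s (s≤s z≤n)))))) | evalℕ-⌈⌉ R e h₂ = refl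

    eval-tape : ∀ {σ s} → Small s → Represents σ s → ∀ e → T (checkTape 0 e) →
                eval w s (binary mod ⌈ e ⌉ (reg 5)) ≡ apply mod (⟦ e ⟧ᵉ σ) (κ 5)
    eval-tape S R e h with h₂ , h₃ ← ∧-T {wellFormed e} h
      rewrite eval-exact S (binary mod ⌈ e ⌉ (reg 5)) h₃
            | constant R 5 (s≤s (s≤s (s≤s (s≤s (s≤s (s≤s z≤n)))))) | evalℕ-⌈⌉ R e h₂ = refl

    small-upd : ∀ (f g : ℕ → ℕ) a v → (∀ b → f b ≤ g b) → v ≤ g a →
                ∀ b → (f [ a ↦ v ]) b ≤ g b
    small-upd f g a v h v≤ b with a ≡ᵇ b in eq
    ... | true  = subst (λ c → _ ≤ g c) (≡ᵇ-true eq) v≤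
    ... | false = h b

    assign-small : ∀ {s x v} → Small s → v ≤ M ^ 6 →
                   Small (state (register s [ 10 + x ↦ v ]) (memory s))
    assign-small {s} {x} {v} S v≤ = record
      { smallReg = small-upd (register s) (λ r → M ^ rdeg r) (10 + x) v (smallReg S) v≤ ; smallMem = smallMem S }

    assign-represents : ∀ {σ s x v} → Represents σ s →
      Represents (set x v σ) (state (register s [ 10 + x ↦ v ]) (memory s))
    assign-represents {σ} {s} {x} {v} R = record
      { constant  = λ r r<10 → trans
          (upd-other (register s) (10 + x) r v (>⇒≢ (<-≤-trans r<10 (m≤m+n 10 x)))) (constant R r r<10)
      ; variable′ = go
      ; array     = array R
      ; tape≡     = tape≡ R }
      where
      go : ∀ y → (register s [ 10 + x ↦ v ]) (10 + y) ≡ (vars σ ⟨ x ↦ v ⟩) y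
      go y with x ≡ᵇ y
      ... | true  = refl
      ... | false = variable′ R y

    cell-injective : ∀ {A B i j} → A < 16 → B < 16 → 16 * i + A ≡ 16 * j + B → A ≡ B × i ≡ j
    cell-injective {A} {B} {i} {j} A< B< eq = A≡B ,
      *-cancelˡ-≡ i j 16 (+-cancelʳ-≡ B (16 * i) (16 * j)
        (subst (λ C → 16 * i + C ≡ 16 * j + B) A≡B eq))
      where
      rem : ∀ C k → C < 16 → (16 * k + C) % 16 ≡ C
      rem C k C< = trans (cong (_% 16) (trans (+-comm (16 * k) C) (cong (C +_) (*-comm 16 k))))
        (trans ([m+kn]%n≡m%n C k 16) (m<n⇒m%n≡m C<))
      A≡B : A ≡ B
      A≡B = trans (sym (rem A i A<)) (trans (cong (_% 16) eq) (rem B j B<))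

    put-represents : ∀ {σ s A i v} → A < 16 → Represents σ s →
      Represents ⟪ vars σ , cells σ ⟨ A ↦ cells σ A ⟨ i ↦ v ⟩ ⟩ , tape σ ⟫
        (state (register s) (memory s [ κ 5 + (16 * i + A) ↦ v ]))
    put-represents {σ} {s} {A} {i} {v} A< R = record
      { constant  = constant R
      ; variable′ = variable′ R
      ; array     = go
      ; tape≡     = λ j j< →
          trans (upd-other (memory s) (κ 5 + (16 * i + A)) j v (>⇒≢ (<-≤-trans j< (m≤m+n (κ 5) _)))) (tape≡ R j j<) }
      where
      go : ∀ B j → B < 16 → (memory s [ κ 5 + (16 * i + A) ↦ v ]) (κ 5 + (16 * j + B)) ≡
                            (cells σ ⟨ A ↦ cells σ A ⟨ i ↦ v ⟩ ⟩) B j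
      go B j B< with A ≟ B
      ... | no A≢B rewrite ≡ᵇ-≢ A≢B = trans
        (upd-other (memory s) (κ 5 + (16 * i + A)) _ v λ eq → A≢B (proj₁ (cell-injective {i = i} {j} A< B< (+-cancelˡ-≡ (κ 5) _ _ eq))))
        (array R B j B<)
      ... | yes refl rewrite ≡ᵇ-refl A with i ≟ j
      ...   | yes refl rewrite ≡ᵇ-refl i | ≡ᵇ-refl (κ 5 + (16 * i + A)) = refl
      ...   | no i≢j rewrite ≡ᵇ-≢ i≢j = trans
        (upd-other (memory s) (κ 5 + (16 * i + A)) _ v λ eq → i≢j (proj₂ (cell-injective {i = i} {j} A< A< (+-cancelˡ-≡ (κ 5) _ _ eq))))
        (array R A j A<)

    output-represents : ∀ {σ s i v} → i < κ 5 → Represents σ s →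
      Represents ⟪ vars σ , cells σ , tape σ ⟨ i ↦ v ⟩ ⟫
        (state (register s) (memory s [ i ↦ v ]))
    output-represents {σ} {s} {i} {v} i< R = record
      { constant  = constant R
      ; variable′ = variable′ R
      ; array     = λ A j A< →
          trans (upd-other (memory s) i _ v (<⇒≢ (<-≤-trans i< (m≤m+n (κ 5) _)))) (array R A j A<)
      ; tape≡     = go }
      where
      go : ∀ j → j < κ 5 → (memory s [ i ↦ v ]) j ≡ (tape σ ⟨ i ↦ v ⟩) j
      go j j< with i ≡ᵇ j
      ... | true  = refl
      ... | false = tape≡ R j j<

    Simulates : Program → ℕ → State → Store → Set
    Simulates c bound s τ = ∃[ t ] ∃[ s′ ]
      Run w c s t s′ × t ≤ bound × Small s′ × Represents τ s′

    simulate : ∀ c → T (check c) → ∀ {σ s} → Small s → Represents σ s →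
               Simulates (compile c) (time c) s (⟦ c ⟧ σ)
    -- The register of the loop variable drives the `while` loop. It still holds m when the body has
    -- run because the check forbids the body to assign it.
    simulate-loop : ∀ x c → T (not (modifiesVar c x)) → T (check c) → ∀ m {σ s} →
      Small s → Represents σ s → register s (10 + x) ≡ m →
      Simulates (while (reg (10 + x)) ((10 + x) ≔ binary sub (reg (10 + x)) (lit 1) ⨾ compile c))
        (m * (6 + time c) + 2) s (iterate ⟦ c ⟧ x m σ)

    simulate (x := e) h {σ} {s} S R = _ , _ , assign , ≤-refl ,
      assign-small S (eval-small S e h) ,
      subst (λ v → Represents (set x v σ) _) (eval-⌈⌉ S R e (proj₁ (∧-T {checkExp 0 e} h)))
        (assign-represents R)
    simulate (put A e f) h {σ} {s} S R
      with h₁ , h₂ ← ∧-T {checkAddress A e} h =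
      _ , _ , store , ≤-refl ,
      record { smallReg = smallReg S
             ; smallMem = small-upd (memory s) (λ _ → M ^ 6) (eval w s (cell A ⌈ e ⌉)) _ (smallMem S) (eval-small S f h₂) } ,
      subst₂ (λ a v → Represents (⟦ put A e f ⟧ σ) (state (register s) (memory s [ a ↦ v ])))
        (sym (eval-cell S R A e h₁)) (sym (eval-⌈⌉ S R f (proj₁ (∧-T {checkExp 0 f} h₂))))
        (put-represents {i = ⟦ e ⟧ᵉ σ} (<ᵇ⇒< A 16 (proj₁ (∧-T {A <ᵇ 16} h₁))) R)
    simulate (output e f) h {σ} {s} S R
      with h₁ , h₂ ← ∧-T {checkTape 0 e} h =
      _ , _ , store , ≤-refl ,
      record { smallReg = smallReg S
             ; smallMem = small-upd (memory s) (λ _ → M ^ 6) (eval w s (binary mod ⌈ e ⌉ (reg 5))) _ (smallMem S) (eval-small S f h₂) } ,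
      subst₂ (λ a v → Represents (⟦ output e f ⟧ σ) (state (register s) (memory s [ a ↦ v ])))
        (sym (eval-tape S R e h₁)) (sym (eval-⌈⌉ S R f (proj₁ (∧-T {checkExp 0 f} h₂))))
        (output-represents (mod-< _) R)
    simulate (c ∙ c′) h S R
      with h₁ , h₂ ← ∧-T {check c} h
      with _ , _ , r₁ , t₁ , S₁ , R₁ ← simulate c h₁ S R
      with _ , _ , r₂ , t₂ , S₂ , R₂ ← simulate c′ h₂ S₁ R₁ =
      _ , _ , seq r₁ r₂ , +-mono-≤ t₁ t₂ , S₂ , R₂
    simulate (when e c) h {σ} {s} S R
      with h₁ , h₂ ← ∧-T {checkExp 0 e} h
      with ⟦ e ⟧ᵉ σ in eq
    ... | zero  = _ , _ , if-false (trans (eval-⌈⌉ S R e h₁) eq) skip ,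
      s≤s (+-monoʳ-≤ (cost ⌈ e ⌉) (s≤s z≤n)) , S , R
    ... | suc v
      with _ , _ , r₁ , t₁ , S₁ , R₁ ← simulate c h₂ S R =
      _ , _ , if-true (λ z → contradiction (trans (sym eq) (trans (sym (eval-⌈⌉ S R e h₁)) z)) λ ()) r₁ ,
      s≤s (+-monoʳ-≤ (cost ⌈ e ⌉) (m≤n⇒m≤1+n t₁)) , S₁ , R₁
    simulate (for x y c) h {σ} {s} S R
      with h₁ , h₂ ← ∧-T {y <ᵇ 10} h with h₃ , h₄ ← ∧-T {not (modifiesVar c x)} h₂
      with κy ← constant R y (<ᵇ⇒< y 10 h₁)
      with _ , _ , r , t≤ , S₁ , R₁ ← simulate-loop x c h₃ h₄ (κ y)
        {set x (κ y) σ} {state (register s [ 10 + x ↦ register s y ]) (memory s)}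
        (assign-small S (≤-trans (smallReg S y) (^-monoʳ-≤ M (rdeg≤6 y))))
        (subst (λ v → Represents (set x v σ) _) κy (assign-represents R))
        (trans (upd-same (register s) (10 + x) (register s y)) κy) =
      _ , _ , seq assign r , +-monoʳ-≤ 2 t≤ , S₁ , R₁

    simulate-loop x c h h′ zero    S R eq = _ , _ , while-done eq , ≤-refl , S , R
    simulate-loop x c h h′ (suc m) {σ} {s} S R eq
      with dec ← trans (eval-exact S (binary sub (reg (10 + x)) (lit 1)) tt) (cong (_∸ 1) eq)
      with _ , _ , r₁ , t₁ , S₁ , R₁ ← simulate c h′
        {set x m σ} {state (register s [ 10 + x ↦ _ ]) (memory s)}
        (assign-small S (≤-trans (≤-reflexive dec) (≤-trans (n≤1+n m) (subst (_≤ M ^ 6) eq (smallReg S (10 + x))))))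
        (subst (λ v → Represents (set x v σ) (state (register s [ 10 + x ↦ _ ]) (memory s))) dec (assign-represents R))
      with _ , _ , r₂ , t₂ , S₂ , R₂ ← simulate-loop x c h h′ m S₁ R₁
        (trans (variable′ R₁ x) (trans (sameVar (frame c (set x m σ)) x (not-T h)) (upd-same (vars σ) x m))) =
      _ , _ , while-step (λ z → contradiction (trans (sym eq) z) λ ()) (seq assign r₁) r₂ ,
      bound t₁ t₂ , S₂ , R₂
      where
      bound : ∀ {t t′} → t ≤ time c → t′ ≤ m * (6 + time c) + 2 →
              1 + (1 + ((4 + t) + t′)) ≤ suc m * (6 + time c) + 2
      bound {t} {t′} t≤ t′≤ = ≤-trans (+-monoʳ-≤ 6 (+-mono-≤ t≤ t′≤))
        (≤-reflexive (sym (+-assoc (6 + time c) (m * (6 + time c)) 2)))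

-- The algorithm

-- Polynomials in n and d: coefficients with the exponents of n and d.
Polynomial : Set
Polynomial = List (ℕ × ℕ × ℕ)

-- Loops over k are charged as loops over n, which is right because these commands run only if k <
-- n.
loopDegree : ℕ → ℕ × ℕ
loopDegree 1 = 0 , 1
loopDegree 6 = 5 , 0
loopDegree _ = 1 , 0

limit : ℕ → Bool
limit 0 = true
limit 1 = true
limit 2 = true
limit 6 = true
limit _ = false

scale : ℕ × ℕ → Polynomial → Polynomial
scale _       []                = []
scale (a , b) ((c , x , y) ∷ p) = (c , a + x , b + y) ∷ scale (a , b) p

polynomialTime : Cmd → Polynomial
polynomialTime (x := e)     = (1 + cost ⌈ e ⌉ , 0 , 0) ∷ []
polynomialTime (put A e f)  = (1 + (cost (cell A ⌈ e ⌉) + cost ⌈ f ⌉) , 0 , 0) ∷ []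
polynomialTime (output e f) = (1 + (cost (binary mod ⌈ e ⌉ (reg 5)) + cost ⌈ f ⌉) , 0 , 0) ∷ []
polynomialTime (c ∙ c′)     = polynomialTime c ++ polynomialTime c′
polynomialTime (when e c)   = (1 + (cost ⌈ e ⌉ + 1) , 0 , 0) ∷ polynomialTime c
polynomialTime (for x y c)  =
  (4 , 0 , 0) ∷ scale (loopDegree y) ((6 , 0 , 0) ∷ polynomialTime c)

limits : Cmd → Bool
limits (x := e)     = true
limits (put A e f)  = true
limits (output e f) = true
limits (c ∙ c′)     = limits c ∧ limits c′
limits (when e c)   = limits c
limits (for x y c)  = limit y ∧ limits c

size : Polynomial → ℕ
size []                = 0
size ((c , _ , _) ∷ p) = c + size p

allTerms : (ℕ → ℕ → Bool) → Polynomial → Bool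
allTerms χ []                = true
allTerms χ ((_ , x , y) ∷ p) = χ x y ∧ allTerms χ p

-- Three factors d arise only in the loops of `untangle` over triples of symbols, for n^5
-- candidates. All other terms have at most d^2, and for them the exponent 12 of n leaves room.
cheap affordable : ℕ → ℕ → Bool
cheap      x y = (x ≤ᵇ 12) ∧ (y ≤ᵇ 2)
affordable x y = cheap x y ∨ ((x ≤ᵇ 5) ∧ (y ≤ᵇ 3))

module _ (n d : ℕ) where

  term : Polynomial → ℕ
  term []                = 0
  term ((c , x , y) ∷ p) = c * (n ^ x * d ^ y) + term p

  term-++ : ∀ p q → term (p ++ q) ≡ term p + term q
  term-++ []                q = refl
  term-++ ((c , x , y) ∷ p) q =
    trans (cong (_ +_) (term-++ p q)) (sym (+-assoc (c * (n ^ x * d ^ y)) _ _))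

  term-scale : ∀ a b p → term (scale (a , b) p) ≡ (n ^ a * d ^ b) * term p
  term-scale a b []                = sym (*-zeroʳ (n ^ a * d ^ b))
  term-scale a b ((c , x , y) ∷ p)
    rewrite term-scale a b p | ^-distribˡ-+-* n a x | ^-distribˡ-+-* d b y =
    go c (n ^ a) (n ^ x) (d ^ b) (d ^ y) (term p)
    where
    go : ∀ c a x b y p → c * ((a * x) * (b * y)) + (a * b) * p ≡ (a * b) * (c * (x * y) + p)
    go = solve-∀

  term-bound : ∀ χ B → (∀ x y → T (χ x y) → n ^ x * d ^ y ≤ B) →
               ∀ p → T (allTerms χ p) → term p ≤ size p * B
  term-bound χ B h []                _ = z≤n
  term-bound χ B h ((c , x , y) ∷ p) t with t₁ , t₂ ← ∧-T {χ x y} t =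
    ≤-trans (+-mono-≤ (*-monoʳ-≤ c (h x y t₁)) (term-bound χ B h p t₂))
      (≤-reflexive (sym (*-distribʳ-+ B c (size p))))

  cheap-bound : .{{_ : NonZero n}} .{{_ : NonZero d}} → ∀ x y → T (cheap x y) →
                n ^ x * d ^ y ≤ n ^ 12 * d ^ 2
  cheap-bound x y h with h₁ , h₂ ← ∧-T {x ≤ᵇ 12} h =
    *-mono-≤ (^-monoʳ-≤ n (≤ᵇ⇒≤ x 12 h₁)) (^-monoʳ-≤ d (≤ᵇ⇒≤ y 2 h₂))

  affordable-bound : .{{_ : NonZero n}} .{{_ : NonZero d}} → ∀ x y → T (affordable x y) →
                     n ^ x * d ^ y ≤ n ^ 12 * d ^ 2 + n ^ 5 * d ^ 3
  affordable-bound x y h with cheap x y in eq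
  ... | true  = ≤-trans (cheap-bound x y (subst T (sym eq) tt)) (m≤m+n _ _)
  ... | false with h₁ , h₂ ← ∧-T {x ≤ᵇ 5} h =
    ≤-trans (*-mono-≤ (^-monoʳ-≤ n (≤ᵇ⇒≤ x 5 h₁)) (^-monoʳ-≤ d (≤ᵇ⇒≤ y 3 h₂))) (m≤n+m _ _)

  module _ (κ : ℕ → ℕ) (κ0 : κ 0 ≡ n) (κ1 : κ 1 ≡ d) (κ2 : κ 2 ≤ n) (κ6 : κ 6 ≡ n ^ 5) where
    open Semantics κ

    limit-bound : ∀ y → T (limit y) →
                  κ y ≤ n ^ proj₁ (loopDegree y) * d ^ proj₂ (loopDegree y)
    limit-bound 0 _ rewrite κ0 | *-identityʳ n | *-identityʳ n = ≤-refl
    limit-bound 1 _ rewrite κ1 | *-identityʳ d | +-identityʳ d = ≤-refl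
    limit-bound 2 _ rewrite *-identityʳ n | *-identityʳ n = κ2
    limit-bound 6 _ rewrite κ6 | *-identityʳ (n ^ 5) = ≤-refl

    time-polynomial : ∀ c → T (limits c) → time c ≤ term (polynomialTime c)
    time-polynomial (x := e) _ =
      ≤-reflexive (sym (trans (+-identityʳ _) (*-identityʳ _)))
    time-polynomial (put A e f) _ =
      ≤-reflexive (sym (trans (+-identityʳ _) (*-identityʳ _)))
    time-polynomial (output e f) _ =
      ≤-reflexive (sym (trans (+-identityʳ _) (*-identityʳ _)))
    time-polynomial (c ∙ c′) h
      with h₁ , h₂ ← ∧-T {limits c} h
      rewrite term-++ (polynomialTime c) (polynomialTime c′) =
      +-mono-≤ (time-polynomial c h₁) (time-polynomial c′ h₂)
    time-polynomial (when e c) h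
      rewrite *-identityʳ (cost ⌈ e ⌉ + 1) | +-assoc (cost ⌈ e ⌉) 1 (term (polynomialTime c)) =
      s≤s (+-monoʳ-≤ (cost ⌈ e ⌉) (s≤s (time-polynomial c h)))
    time-polynomial (for x y c) h
      with h₁ , h₂ ← ∧-T {limit y} h
      with a , b ← loopDegree y | bound ← limit-bound y h₁
      rewrite term-scale a b ((6 , 0 , 0) ∷ polynomialTime c) = begin
      2 + (κ y * (6 + time c) + 2)       ≡⟨ shift (κ y * (6 + time c)) ⟩
      4 + κ y * (6 + time c)             ≤⟨ +-monoʳ-≤ 4
        (*-mono-≤ bound (+-monoʳ-≤ 6 (time-polynomial c h₂))) ⟩
      4 + (n ^ a * d ^ b) * (6 + term (polynomialTime c)) ∎
      where
      open ≤-Reasoning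
      shift : ∀ u → 2 + (u + 2) ≡ 4 + u
      shift = solve-∀

-- The commands of the algorithm

pattern vc = 0
pattern vi = 1
pattern vj = 2
pattern va = 3
pattern vb = 4
pattern ve = 5
pattern vrank = 6
pattern vmin = 7
pattern vmax = 8
pattern vtotal = 9
pattern vcarry = 10
pattern vopt = 11
pattern vi′ = 12
pattern apos = 0
pattern aalive = 1
pattern acand = 2
pattern achain = 3
pattern adist = 4
pattern aidx = 5
pattern abest = 6
pattern amin = 7

cn cd cN cmax : Exp
cn   = con 0
cd   = con 1
cN   = con 6
cmax = con 7

-- The input lists the symbol at each position, whereas comparing two symbols in the order of a
-- point needs the position of each symbol.
invert : Cmd
invert = for vi 0 (for vj 1
  (put apos (var vi ⊗ cd ⊕ given (var vi ⊗ cd ⊕ var vj)) (var vj)))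

digit₁ digit₂ digit₃ digit₄ digit₅ : Exp
digit₁ = var vc ⊛ cn
digit₂ = var vc ⊘ cn ⊛ cn
digit₃ = var vc ⊘ cn ⊘ cn ⊛ cn
digit₄ = var vc ⊘ cn ⊘ cn ⊘ cn ⊛ cn
digit₅ = var vc ⊘ cn ⊘ cn ⊘ cn ⊘ cn ⊛ cn

vote : Exp → Exp → Exp → Exp
vote i x y = get apos (i ⊗ cd ⊕ x) ⊲ get apos (i ⊗ cd ⊕ y)

majority : Exp → Exp → Exp
majority x y = # 2 ⊲ vote digit₁ x y ⊕ vote digit₂ x y ⊕ vote digit₃ x y
                   ⊕ vote digit₄ x y ⊕ vote digit₅ x y

alive dead : Exp → Exp
alive x = get aalive x
dead  x = # 1 ⊖ alive x

-- The arithmetic form of `beforeᵇ`: survivors in majority order, then the deleted symbols by name.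
-- Any order of the latter would do, as the error bound charges for all of them.
before : Exp → Exp → Exp
before x y = alive x ⊗ dead y ⊕ alive x ⊗ alive y ⊗ majority x y
                              ⊕ dead x ⊗ dead y ⊗ (x ⊲ y)

cyclic : Exp → Exp → Exp → Exp
cyclic x y z = alive x ⊗ alive y ⊗ alive z ⊗
               majority x y ⊗ majority y z ⊗ majority z x

kill : Exp → Cmd
kill x = put aalive x (# 0)

-- One sweep over the triples suffices: deletions create no cyclic triangle among the survivors, so
-- a triple stays harmless once it has been examined.
untangle : Cmd
untangle = for va 1 (for vb 1 (for ve 1
  (when (cyclic (var va) (var vb) (var ve)) (kill (var va) ∙ kill (var vb) ∙ kill (var ve)))))

arrange : Cmd
arrange = for va 1
  (vrank := # 0 ∙
   for vb 1 (when (before (var vb) (var va)) (vrank := (var vrank ⊕ # 1) ⊛ cmax)) ∙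
   put acand (var vc ⊗ cd ⊕ var vrank) (var va))

construct : Cmd
construct = for va 1 (put aalive (var va) (# 1)) ∙ untangle ∙ arrange

image : Exp → Exp
image j = get apos (var vi ⊗ cd ⊕ get acand (var vc ⊗ cd ⊕ j))

-- The surrounding loop counts down, so the longest chains that start after `va` are already known.
-- Here `vmin` accumulates a maximum, the longest chain that can follow `va`.
extend : Cmd
extend = for vb 1
  (when ((var va ⊲ var vb) ⊗ (image (var va) ⊲ image (var vb)) ⊗ (var vmin ⊲ get achain (var vb)))
    (vmin := get achain (var vb)))

measure : Cmd
measure =
  vmax := # 0 ∙
  for va 1
    (vmin := # 0 ∙ extend ∙
     put achain (var va) ((var vmin ⊕ # 1) ⊛ cmax) ∙
     when (var vmax ⊲ get achain (var va)) (vmax := get achain (var va))) ∙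
  put adist (var vc ⊗ cn ⊕ var vi) (cd ⊖ var vmax)

-- The initial value `cmax` of `vopt` is n d + 1, which exceeds every objective value and serves as
-- infinity.
prepare : Cmd
prepare = invert ∙ for vc 6 construct ∙ for vc 6 (for vi 0 measure) ∙
          vopt := cmax ∙ vcarry := # 0

nearest : Cmd
nearest = for vi 0
  (vmin := cd ∙
   for vj 2 (when (get adist (get aidx (var vj) ⊗ cn ⊕ var vi) ⊲ var vmin)
                  (vmin := get adist (get aidx (var vj) ⊗ cn ⊕ var vi))) ∙
   put amin (var vi) (var vmin))

-- The keys compare distances first and indices second. They are distinct, so exactly as many points
-- have rank below `con 8` as are to be kept.
select : Cmd
select =
  vtotal := # 0 ∙
  for vi 0
    (vrank := # 0 ∙
     for vi′ 0
       (when (get amin (var vi′) ⊗ cn ⊕ var vi′ ⊲ get amin (var vi) ⊗ cn ⊕ var vi)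
         (vrank := (var vrank ⊕ # 1) ⊛ cmax)) ∙
     when (var vrank ⊲ con 8) (vtotal := (var vtotal ⊕ get amin (var vi)) ⊛ cmax))

record′ : Cmd
record′ = when (var vtotal ⊲ var vopt)
  (vopt := var vtotal ∙ for vj 2 (put abest (var vj) (get aidx (var vj))))

-- A counter with k digits in base n^5. The carry that remains after the last digit ends the
-- enumeration.
increment : Cmd
increment =
  vcarry := # 1 ∙
  for vj 2 (when (var vcarry)
    (put aidx (var vj) ((get aidx (var vj) ⊕ # 1) ⊛ cN) ∙
     when (get aidx (var vj)) (vcarry := # 0)))

round : Cmd
round = nearest ∙ select ∙ record′ ∙ increment

-- The medians overwrite the input, which is no longer read. They fit into its n d cells because k <
-- n.
deliver : Cmd
deliver = for vj 2 (for va 1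
  (output (var vj ⊗ cd ⊕ var va) (get acand (get abest (var vj) ⊗ cd ⊕ var va))))

setup : Program
setup =
  5 ≔ binary mul (reg 0) (reg 1) ⨾
  6 ≔ binary mul (reg 0) (binary mul (reg 0) (binary mul (reg 0) (binary mul (reg 0) (reg 0)))) ⨾
  7 ≔ binary add (reg 5) (lit 1) ⨾
  8 ≔ binary div (binary add (binary mul (binary sub (reg 4) (reg 3)) (reg 0))
                             (binary sub (reg 4) (lit 1))) (reg 4)

-- Register 20 holds `vcarry`. This loop lies outside the command language because its number of
-- rounds, n^(5 k), is in no constant register and need not even fit into a word.
enumerate : Program
enumerate = while (binary lt (reg 20) (lit 1)) (compile round)

-- In the second branch k ≥ n and the points are their own medians: register 0 already holds n, and
-- base address 0 is that of the input.
algorithm : Program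
algorithm = if (binary lt (reg 2) (reg 0))
  (setup ⨾ compile prepare ⨾ enumerate ⨾ compile deliver ⨾ 0 ≔ reg 2 ⨾ 1 ≔ lit 0)
  (1 ≔ lit 0)

prepare-check : T (check prepare)
prepare-check = tt
round-check : T (check round)
round-check = tt
deliver-check : T (check deliver)
deliver-check = tt
prepare-limits : T (limits prepare)
prepare-limits = tt
prepare-affordable : T (allTerms affordable (polynomialTime prepare))
prepare-affordable = tt
round-cheap : T (allTerms cheap (polynomialTime round))
round-cheap = tt
deliver-cheap : T (allTerms cheap (polynomialTime deliver))
deliver-cheap = tt

-- Distances, tournaments and selection on initial segments of ℕ

∧-split : ∀ {x y} → (x ∧ y) ≡ true → x ≡ true × y ≡ true
∧-split {true} {true} _ = refl , refl

Agree : ℕ → (ℕ → Bool) → (ℕ → ℕ) → (ℕ → ℕ) → Set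
Agree d A P Q = ∀ a b → a < d → b < d → A a ≡ false → A b ≡ false →
                P a < P b → Q a < Q b

-- The Ulam distance of two permutations given by the positions of their
-- symbols: the least number of symbols to delete to make the orders agree.
record Dist (d : ℕ) (P Q : ℕ → ℕ) (t : ℕ) : Set where
  constructor dist
  field
    deleted : ∃[ A ] Agree d A P Q × count d A ≡ t
    minimal : ∀ A → Agree d A P Q → t ≤ count d A
open Dist

agree-sym : ∀ {d A P Q} → Inj d P → Agree d A P Q → Agree d A Q P
agree-sym {P = P} {Q} inj h a b a<d b<d Aa Ab Qa<Qb with <-cmp (P a) (P b)
... | tri< Pa<Pb _ _ = Pa<Pb
... | tri≈ _ Pa≡Pb _ = contradiction Qa<Qb (<-irrefl (cong Q (inj a b a<d b<d Pa≡Pb)))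
... | tri> _ _ Pb<Pa = contradiction Qa<Qb (<⇒≯ (h b a b<d a<d Ab Aa Pb<Pa))

agree-trans : ∀ {d A B P Q R} → Agree d A P Q → Agree d B Q R →
              Agree d (λ a → A a ∨ B a) P R
agree-trans f g a b a<d b<d ha hb Pa<Pb
  with Aa , Ba ← ∨-false ha with Ab , Bb ← ∨-false hb =
  g a b a<d b<d Ba Bb (f a b a<d b<d Aa Ab Pa<Pb)

count-∨ : ∀ m A B → count m (λ a → A a ∨ B a) + count m (λ a → A a ∧ B a) ≡
                    count m A + count m B
count-∨ m A B = trans (sym (∑-+ m)) (trans (∑-cong m λ a _ → go (A a) (B a)) (∑-+ m))
  where
  go : ∀ x y → ι (x ∨ y) + ι (x ∧ y) ≡ ι x + ι y
  go true  true  = refl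
  go true  false = refl
  go false true  = refl
  go false false = refl

dist≤ : ∀ {d P Q t} → Dist d P Q t → t ≤ d
dist≤ {d} (dist (A , _ , refl) _) = count≤ d

-- Longest increasing subsequences

Increasing : ℕ → (ℕ → ℕ) → (ℕ → Bool) → Set
Increasing d q χ = ∀ i j → i < j → j < d → χ i ≡ true → χ j ≡ true → q i < q j

-- L j is the maximal length of an increasing subsequence of q 0, …, q (d - 1)
-- whose first entry is q j.
record Chain (d : ℕ) (q L : ℕ → ℕ) (j : ℕ) : Set where
  field
    positive : 1 ≤ L j
    upper    : ∀ i → j < i → i < d → q j < q i → L i < L j
    attained : L j ≡ 1 ⊎ ∃[ i ] j < i × i < d × q j < q i × L j ≡ suc (L i)

module _ {d q L B} (chain : ∀ j → j < d → Chain d q L j)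
         (top : ∀ j → j < d → L j ≤ B) (hit : B ≡ 0 ⊎ ∃[ j ] j < d × L j ≡ B) where
  open Chain

  -- Descending through the positions, the number l of selected positions from i on is at most L at
  -- the first of them, since `upper` makes L grow with each further selected position.
  increasing-count : ∀ χ → Increasing d q χ → count d χ ≤ B
  increasing-count χ inc = finish (go d ≤-refl (0 , ≤-reflexive (sym (+-identityʳ _)) , inj₁ refl))
    where
    Tail : ℕ → Set
    Tail i = ∃[ l ] count d χ ≤ count i χ + l ×
      (l ≡ 0 ⊎ ∃[ j ] i ≤ j × j < d × χ j ≡ true × l ≤ L j)
    step : ∀ i → i < d → Tail (suc i) → Tail i
    step i i<d (l , le , w) with χ i in χi
    ... | false = l , ≤-trans le (≤-reflexive (cong (_+ l) (+-identityʳ _))) , weaken w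
      where
      weaken : l ≡ 0 ⊎ (∃[ j ] suc i ≤ j × j < d × χ j ≡ true × l ≤ L j) →
               l ≡ 0 ⊎ (∃[ j ] i ≤ j × j < d × χ j ≡ true × l ≤ L j)
      weaken (inj₁ z) = inj₁ z
      weaken (inj₂ (j , i<j , r)) = inj₂ (j , <⇒≤ i<j , r)
    ... | true = suc l , ≤-trans le (≤-reflexive (+-assoc _ 1 l)) ,
      inj₂ (i , ≤-refl , i<d , χi , longer w)
      where
      longer : l ≡ 0 ⊎ (∃[ j ] suc i ≤ j × j < d × χ j ≡ true × l ≤ L j) → suc l ≤ L i
      longer (inj₁ refl) = positive (chain i i<d)
      longer (inj₂ (j , i<j , j<d , χj , l≤)) =
        ≤-<-trans l≤ (upper (chain i i<d) j i<j j<d (inc i j i<j j<d χi χj))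
    go : ∀ i → i ≤ d → Tail i → Tail 0
    go zero    _   w = w
    go (suc i) i<d w = go i (<⇒≤ i<d) (step i i<d w)
    finish : Tail 0 → count d χ ≤ B
    finish (l , le , w) = ≤-trans le (bound w)
      where
      bound : ∀ {l} → l ≡ 0 ⊎ (∃[ i ] 0 ≤ i × i < d × χ i ≡ true × l ≤ L i) → l ≤ B
      bound (inj₁ refl) = z≤n
      bound (inj₂ (i , _ , i<d , _ , l≤)) = ≤-trans l≤ (top i i<d)

  -- Follow the witnesses of `attained`; they move to the right, so d - j steps are enough. Adding j
  -- keeps the set increasing because all its other members are at j′ or, with larger q, after it.
  chain-set : ∀ fuel j → j < d → d ∸ j ≤ fuel →
    ∃[ χ ] (∀ i → χ i ≡ true → j ≤ i) × χ j ≡ true × Increasing d q χ × count d χ ≡ L j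
  chain-set fuel j j<d le with attained (chain j j<d)
  ... | inj₁ one = (_≡ᵇ j) , (λ i e → ≤-reflexive (sym (≡ᵇ-true e))) , ≡ᵇ-refl j ,
    (λ i i′ i<i′ _ e e′ → contradiction (trans (≡ᵇ-true e) (sym (≡ᵇ-true e′))) (<⇒≢ i<i′)) ,
    trans (∑-cong d λ i _ → sym (*-identityʳ _)) (trans (∑-δ d (λ _ → 1) j<d) (sym one))
  chain-set zero j j<d le | inj₂ _ =
    contradiction (n≤0⇒n≡0 le) (m>n⇒m∸n≢0 j<d)
  chain-set (suc fuel) j j<d le | inj₂ (j′ , j<j′ , j′<d , qj<qj′ , eq)
    with χ , low , χj′ , inc , cnt ← chain-set fuel j′ j′<d
      (≤-pred (≤-trans (∸-monoʳ-< j<j′ (<⇒≤ j′<d)) le)) =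
    χ⁺ , low⁺ , cong (_∨ χ j) (≡ᵇ-refl j) , inc⁺ , cnt⁺
    where
    χ⁺ : ℕ → Bool
    χ⁺ i = (i ≡ᵇ j) ∨ χ i
    split : ∀ i → χ⁺ i ≡ true → i ≡ j ⊎ χ i ≡ true
    split i e with i ≡ᵇ j in eq
    ... | true  = inj₁ (≡ᵇ-true eq)
    ... | false = inj₂ e
    low⁺ : ∀ i → χ⁺ i ≡ true → j ≤ i
    low⁺ i e with split i e
    ... | inj₁ refl = ≤-refl
    ... | inj₂ χi   = ≤-trans (<⇒≤ j<j′) (low i χi)
    inc⁺ : Increasing d q χ⁺
    inc⁺ i i′ i<i′ i′<d e e′ with split i e | split i′ e′
    ... | inj₁ refl | inj₁ refl = contradiction i<i′ (<-irrefl refl)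
    ... | inj₂ χi   | inj₁ refl = contradiction i<i′ (≤⇒≯ (≤-trans (<⇒≤ j<j′) (low i χi)))
    ... | inj₂ χi   | inj₂ χi′  = inc i i′ i<i′ i′<d χi χi′
    ... | inj₁ refl | inj₂ χi′ with m≤n⇒m<n∨m≡n (low i′ χi′)
    ...   | inj₁ j′<i′ = <-trans qj<qj′ (inc j′ i′ j′<i′ i′<d χj′ χi′)
    ...   | inj₂ refl  = qj<qj′
    χj : χ j ≡ false
    χj with χ j in e
    ... | true  = contradiction j<j′ (≤⇒≯ (low j e))
    ... | false = refl
    cnt⁺ : count d χ⁺ ≡ L j
    cnt⁺ = trans (∑-cong d λ i _ → pw i) (trans (∑-+ d)
      (trans (cong₂ _+_ (∑-δ d (λ _ → 1) j<d) cnt) (sym eq)))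
      where
      pw : ∀ i → ι (χ⁺ i) ≡ ι (i ≡ᵇ j) * 1 + ι (χ i)
      pw i with i ≡ᵇ j in e
      ... | false = refl
      ... | true  = sym (cong (λ b → suc (ι b)) (trans (cong χ (≡ᵇ-true e)) χj))

  longest : ∃[ χ ] Increasing d q χ × count d χ ≡ B
  longest = go hit
    where
    go : B ≡ 0 ⊎ (∃[ j ] j < d × L j ≡ B) → ∃[ χ ] Increasing d q χ × count d χ ≡ B
    go (inj₁ B≡0) = (λ _ → false) , (λ _ _ _ _ ()) , trans (∑-zero d) (sym B≡0)
    go (inj₂ (j , j<d , eq)) with χ , _ , _ , inc , cnt ← chain-set (d ∸ j) j j<d ≤-refl =
      χ , inc , trans cnt eq

  -- q lists the P-positions of the symbols in the order of ρ, so its increasing subsequences are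
  -- the common subsequences, and the symbols outside a longest one form a smallest set to delete.
  chain-dist : ∀ {P ρ s} → Inj d P → Inj d ρ → Bounded d ρ → Bounded d s →
    (∀ a → a < d → s (ρ a) ≡ a) → (∀ j → j < d → ρ (s j) ≡ j) →
    (∀ j → j < d → q j ≡ P (s j)) → Dist d P ρ (d ∸ B)
  chain-dist {P} {ρ} {s} iP iρ bρ bs sρ ρs q≡ with χ , inc , cnt ← longest = dist
    ((λ a → not (χ (ρ a))) , agree χ inc , number χ cnt) least
    where
    not-false : ∀ {b} → not b ≡ false → b ≡ true
    not-false {true} _ = refl
    agree : ∀ χ → Increasing d q χ → Agree d (λ a → not (χ (ρ a))) P ρ
    agree χ inc a b a<d b<d ha hb Pa<Pb with <-cmp (ρ a) (ρ b)
    ... | tri< ρa<ρb _ _ = ρa<ρb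
    ... | tri≈ _ ρa≡ρb _ = contradiction Pa<Pb (<-irrefl (cong P (iρ a b a<d b<d ρa≡ρb)))
    ... | tri> _ _ ρb<ρa = contradiction Pa<Pb (<⇒≯ (subst₂ _<_ (back b b<d) (back a a<d)
      (inc (ρ b) (ρ a) ρb<ρa (bρ a a<d) (not-false hb) (not-false ha))))
      where
      back : ∀ a → a < d → q (ρ a) ≡ P a
      back a a<d = trans (q≡ (ρ a) (bρ a a<d)) (cong P (sρ a a<d))
    number : ∀ χ → count d χ ≡ B → count d (λ a → not (χ (ρ a))) ≡ d ∸ B
    number χ eq = trans (reindex d (λ j → ι (not (χ j))) iρ bρ)
      (trans (sym (m+n∸m≡n (count d χ) _)) (cong₂ _∸_ (count-not d χ) eq))
    s-inj : Inj d s
    s-inj i j i<d j<d eq = trans (sym (ρs i i<d)) (trans (cong ρ eq) (ρs j j<d))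
    least : ∀ A → Agree d A P ρ → d ∸ B ≤ count d A
    least A h = m≤n+o⇒m∸n≤o d B (begin
      d                                        ≡⟨ count-not d (A ∘ s) ⟨
      count d (A ∘ s) + count d (not ∘ A ∘ s)  ≤⟨ +-mono-≤
        (≤-reflexive (reindex d (ι ∘ A) s-inj bs)) (increasing-count (not ∘ A ∘ s) kept) ⟩
      count d A + B                            ≡⟨ +-comm (count d A) B ⟩
      B + count d A                            ∎)
      where
      open ≤-Reasoning
      not-true : ∀ {b} → not b ≡ true → b ≡ false
      not-true {false} _ = refl
      kept : Increasing d q (not ∘ A ∘ s)
      kept i j i<j j<d hi hj with i<d ← <-trans i<j j<d | <-cmp (P (s i)) (P (s j))
      ... | tri< lo _ _ = subst₂ _<_ (sym (q≡ i i<d)) (sym (q≡ j j<d)) lo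
      ... | tri≈ _ eq _ = contradiction
        (s-inj i j i<d j<d (iP (s i) (s j) (bs i i<d) (bs j j<d) eq)) (<⇒≢ i<j)
      ... | tri> _ _ hi′ = contradiction i<j (<⇒≯ (subst₂ _<_ (ρs j j<d) (ρs i i<d)
        (h (s j) (s i) (bs j j<d) (bs i i<d) (not-true hj) (not-true hi) hi′)))

-- Tournaments

record Tournament (d : ℕ) (mj : ℕ → ℕ → Bool) : Set where
  field
    irreflexive : ∀ a → mj a a ≡ false
    total       : ∀ a b → a < d → b < d → a ≢ b → mj a b ≡ false → mj b a ≡ true
    asymmetric  : ∀ a b → mj a b ≡ true → mj b a ≡ false

triangle : (ℕ → ℕ → Bool) → ℕ → ℕ → ℕ → Bool
triangle mj x y z = mj x y ∧ (mj y z ∧ mj z x)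

Hits : ℕ → (ℕ → ℕ → Bool) → (ℕ → Bool) → Set
Hits d mj χ = ∀ x y z → x < d → y < d → z < d → triangle mj x y z ≡ true →
              χ x ≡ true ⊎ χ y ≡ true ⊎ χ z ≡ true

-- `few` expresses that greedy deletion of triangles is a 3-approximation to hitting them. Counting
-- only those points of χ that are themselves deleted makes it an invariant of the deletions.
record Untangled (d : ℕ) (mj : ℕ → ℕ → Bool) (A : ℕ → Bool) : Set where
  field
    acyclic : ∀ x y z → x < d → y < d → z < d → A x ≡ true → A y ≡ true → A z ≡ true →
              triangle mj x y z ≡ false
    few     : ∀ χ → Hits d mj χ → count d (not ∘ A) ≤ 3 * count d (λ a → not (A a) ∧ χ a)

beforeᵇ : (ℕ → ℕ → Bool) → (ℕ → Bool) → ℕ → ℕ → Bool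
beforeᵇ mj A x y =
  if A x then (if A y then mj x y else true) else (if A y then false else x <ᵇ y)

record Candidate (d : ℕ) (mj : ℕ → ℕ → Bool) (ρ : ℕ → ℕ) : Set where
  field
    injective : Inj d ρ
    bounded   : Bounded d ρ
    close     : ∀ y χ → Inj d y →
      (∀ a b → a < d → b < d → χ a ≡ false → χ b ≡ false → y a < y b → mj a b ≡ true) →
      ∃[ A ] Agree d A ρ y × count d A ≤ 4 * count d χ

module _ {d mj A} (tour : Tournament d mj) (unt : Untangled d mj A) where
  open Tournament tour
  open Untangled unt

  -- A tournament without cyclic triangles is transitive: if a beats b and b beats c but a does not
  -- beat c, then c beats a and closes a triangle.
  before-order : StrictOrder d (beforeᵇ mj A)
  before-order = record { irr = irr ; tot = tot ; tra = tra }
    where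
    irr : ∀ a → a < d → beforeᵇ mj A a a ≡ false
    irr a _ with A a
    ... | true  = irreflexive a
    ... | false = <ᵇ-false {a} ≤-refl
    tot : ∀ a b → a < d → b < d → a ≢ b → beforeᵇ mj A a b ≡ false → beforeᵇ mj A b a ≡ true
    tot a b a<d b<d a≢b h with A a | A b
    ... | true  | true  = total a b a<d b<d a≢b h
    ... | false | true  = refl
    ... | false | false = <ᵇ-true (≤∧≢⇒< (<ᵇ-false⁻¹ {a} {b} h) (a≢b ∘ sym))
    tra : ∀ a b c → a < d → b < d → c < d →
          beforeᵇ mj A a b ≡ true → beforeᵇ mj A b c ≡ true → beforeᵇ mj A a c ≡ true
    tra a b c a<d b<d c<d h h′
      with A a in Aa | A b in Ab | A c in Ac
    ... | true  | _     | false = refl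
    ... | false | false | false =
      <ᵇ-true (<-trans (<ᵇ-true⁻¹ {a} {b} h) (<ᵇ-true⁻¹ {b} {c} h′))
    ... | true  | true  | true with mj a c in ac
    ...   | true  = refl
    ...   | false with a ≟ c
    ...     | yes refl = contradiction (trans (sym h) (asymmetric b a h′)) λ ()
    ...     | no  a≢c  = contradiction
      (trans (sym (cong₂ _∧_ h (cong₂ _∧_ h′ (total a c a<d c<d a≢c ac))))
        (acyclic a b c a<d b<d c<d Aa Ab Ac)) λ ()

  candidate : Candidate d mj (rank d (beforeᵇ mj A))
  candidate = record
    { injective = rank-inj before-order
    ; bounded   = rank-bounded before-order
    ; close     = λ y χ iy good → (λ a → not (A a) ∨ χ a) , agree y χ iy good , number y χ iy good }
    where
    Good : (ℕ → ℕ) → (ℕ → Bool) → Set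
    Good y χ = ∀ a b → a < d → b < d → χ a ≡ false → χ b ≡ false → y a < y b → mj a b ≡ true
    reflects : ∀ y χ → Inj d y → Good y χ → ∀ a b → a < d → b < d → χ a ≡ false → χ b ≡ false →
               mj a b ≡ true → y a < y b
    reflects y χ iy good a b a<d b<d χa χb ab with <-cmp (y a) (y b)
    ... | tri< lo _ _ = lo
    ... | tri≈ _ eq _ with refl ← iy a b a<d b<d eq =
      contradiction (trans (sym ab) (irreflexive a)) λ ()
    ... | tri> _ _ hi = contradiction
      (trans (sym (good b a b<d a<d χb χa hi)) (asymmetric a b ab)) λ ()
    agree : ∀ y χ → Inj d y → Good y χ →
            Agree d (λ a → not (A a) ∨ χ a) (rank d (beforeᵇ mj A)) y
    agree y χ iy good a b a<d b<d ha hb lo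
      with Aa , χa ← ∨-false {not (A a)} ha with Ab , χb ← ∨-false {not (A b)} hb =
      reflects y χ iy good a b a<d b<d χa χb
        (both Aa Ab (rank-reflects before-order a b a<d b<d lo))
      where
      both : ∀ {x y m l} → not x ≡ false → not y ≡ false →
             (if x then (if y then m else true) else (if y then false else l)) ≡ true → m ≡ true
      both {true} {true} _ _ h = h
    hits : ∀ y χ → Inj d y → Good y χ → Hits d mj χ
    hits y χ iy good a b c a<d b<d c<d tri
      with ab , rest ← ∧-split tri with bc , ca ← ∧-split rest
      with χ a in χa | χ b in χb | χ c in χc
    ... | true  | _     | _     = inj₁ refl
    ... | false | true  | _     = inj₂ (inj₁ refl)
    ... | false | false | true  = inj₂ (inj₂ refl)
    ... | false | false | false = contradiction
      (<-trans (reflects y χ iy good a b a<d b<d χa χb ab)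
        (<-trans (reflects y χ iy good b c b<d c<d χb χc bc)
                 (reflects y χ iy good c a c<d a<d χc χa ca))) (<-irrefl refl)
    number : ∀ y χ → Inj d y → Good y χ → count d (λ a → not (A a) ∨ χ a) ≤ 4 * count d χ
    number y χ iy good = begin
      count d (λ a → not (A a) ∨ χ a)                       ≤⟨ m≤m+n _ _ ⟩
      count d (λ a → not (A a) ∨ χ a) + count d (λ a → not (A a) ∧ χ a)
                                                            ≡⟨ count-∨ d (not ∘ A) χ ⟩
      count d (not ∘ A) + count d χ                         ≤⟨ +-monoˡ-≤ _ (few χ (hits y χ iy good)) ⟩
      3 * count d (λ a → not (A a) ∧ χ a) + count d χ       ≤⟨ +-monoˡ-≤ _ (*-monoʳ-≤ 3
        (∑-mono d λ a _ → ∧-≤ (not (A a)) (χ a))) ⟩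
      3 * count d χ + count d χ                             ≡⟨ +-comm (3 * count d χ) _ ⟩
      4 * count d χ                                         ∎
      where
      open ≤-Reasoning
      ∧-≤ : ∀ x y → ι (x ∧ y) ≤ ι y
      ∧-≤ true  y = ≤-refl
      ∧-≤ false y = z≤n

-- The t smallest of the numbers μ 0, …, μ (n - 1), ties broken by the index

keyᵇ : ℕ → (ℕ → ℕ) → ℕ → ℕ → Bool
keyᵇ n μ i j = μ i * n + i <ᵇ μ j * n + j

lex-≤ : ∀ {n a b i j} → j < n → a * n + i ≤ b * n + j → a ≤ b
lex-≤ {n} {a} {b} {i} {j} j<n le = ≮⇒≥ λ b<a → <⇒≱ (begin-strict
  b * n + j ≡⟨ +-comm (b * n) j ⟩
  j + b * n <⟨ +-monoˡ-< (b * n) j<n ⟩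
  suc b * n ≤⟨ *-monoˡ-≤ n b<a ⟩
  a * n     ≤⟨ m≤m+n (a * n) i ⟩
  a * n + i ∎) le
  where open ≤-Reasoning

lex-injective : ∀ {n a b i j} → i < n → j < n → a * n + i ≡ b * n + j → a ≡ b × i ≡ j
lex-injective {n} {a} {b} {i} {j} i<n j<n eq = a≡b ,
  +-cancelˡ-≡ (a * n) i j (trans eq (cong (λ c → c * n + j) (sym a≡b)))
  where
  a≡b : a ≡ b
  a≡b = ≤-antisym (lex-≤ {i = i} {j} j<n (≤-reflexive eq))
                  (lex-≤ {i = j} {i} i<n (≤-reflexive (sym eq)))

key-order : ∀ n μ → StrictOrder n (keyᵇ n μ)
key-order n μ = record
  { irr = λ a _ → <ᵇ-false {key a} ≤-refl
  ; tot = λ a b a<n b<n a≢b h → <ᵇ-true (≤∧≢⇒< (<ᵇ-false⁻¹ h)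
      λ eq → a≢b (sym (proj₂ (lex-injective {n} {μ b} {μ a} b<n a<n eq))))
  ; tra = λ a b c _ _ _ h h′ → <ᵇ-true
      (<-trans (<ᵇ-true⁻¹ {key a} {key b} h) (<ᵇ-true⁻¹ {key b} {key c} h′)) }
  where
  key : ℕ → ℕ
  key i = μ i * n + i

chosen : ℕ → ℕ → (ℕ → ℕ) → ℕ → Bool
chosen n t μ i = rank n (keyᵇ n μ) i <ᵇ t

smallest : ℕ → ℕ → (ℕ → ℕ) → ℕ
smallest n t μ = ∑ n λ i → ι (chosen n t μ i) * μ i

count-< : ∀ n t → t ≤ n → count n (_<ᵇ t) ≡ t
count-< zero    zero    _ = refl
count-< (suc n) t       t≤ with m≤n⇒m<n∨m≡n t≤
... | inj₁ (s≤s t≤n) rewrite <ᵇ-false t≤n = trans (+-identityʳ _) (count-< n t t≤n)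
... | inj₂ refl rewrite <ᵇ-true (n<1+n n) =
  trans (cong (_+ 1) (trans (∑-cong n λ i i<n → cong ι (<ᵇ-true (m≤n⇒m≤1+n i<n)))
    (trans (∑-const n 1) (*-identityʳ n)))) (+-comm n 1)

module _ (n t : ℕ) (μ : ℕ → ℕ) (t≤n : t ≤ n) where

  chosen-count : count n (chosen n t μ) ≡ t
  chosen-count = trans (reindex n (λ r → ι (r <ᵇ t)) (rank-inj (key-order n μ))
    (rank-bounded (key-order n μ))) (count-< n t t≤n)

  -- Exchange argument with the threshold θ separating chosen and other values.
  smallest-least : ∀ χ → t ≤ count n χ → smallest n t μ ≤ ∑ n (λ i → ι (χ i) * μ i)
  smallest-least χ t≤χ = +-cancelʳ-≤ (t * θ) _ _ (begin
    smallest n t μ + t * θ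
      ≤⟨ +-monoʳ-≤ _ (*-monoˡ-≤ θ t≤χ) ⟩
    smallest n t μ + count n χ * θ
      ≡⟨ cong (smallest n t μ +_) (∑-*ʳ n θ) ⟨
    smallest n t μ + ∑ n (λ i → ι (χ i) * θ)
      ≡⟨ ∑-+ n ⟨
    ∑ n (λ i → ι (chosen n t μ i) * μ i + ι (χ i) * θ)
      ≤⟨ ∑-mono n pointwise ⟩
    ∑ n (λ i → ι (χ i) * μ i + ι (chosen n t μ i) * θ)
      ≡⟨ ∑-+ n ⟩
    ∑ n (λ i → ι (χ i) * μ i) + ∑ n (λ i → ι (chosen n t μ i) * θ)
      ≡⟨ cong (_ +_) (trans (∑-*ʳ n θ) (cong (_* θ) chosen-count)) ⟩
    ∑ n (λ i → ι (χ i) * μ i) + t * θ ∎)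
    where
    open ≤-Reasoning
    threshold : ∀ t → t ≤ n → ∃[ θ ]
      (∀ i → i < n → rank n (keyᵇ n μ) i < t → μ i ≤ θ) ×
      (∀ i → i < n → t ≤ rank n (keyᵇ n μ) i → θ ≤ μ i)
    threshold zero    _   = 0 , (λ _ _ ()) , λ _ _ _ → z≤n
    threshold (suc t) t<n
      with i₀ , i₀<n , refl ← onto n (rank-inj (key-order n μ)) (rank-bounded (key-order n μ)) t t<n =
      μ i₀ , below , above
      where
      below : ∀ i → i < n → rank n (keyᵇ n μ) i < suc (rank n (keyᵇ n μ) i₀) → μ i ≤ μ i₀
      below i i<n lo with m<1+n⇒m<n∨m≡n lo
      ... | inj₁ lo′ = lex-≤ {i = i} {i₀} i₀<n (<⇒≤ (<ᵇ-true⁻¹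
        (rank-reflects (key-order n μ) i i₀ i<n i₀<n lo′)))
      ... | inj₂ eq = ≤-reflexive (cong μ (rank-inj (key-order n μ) i i₀ i<n i₀<n eq))
      above : ∀ i → i < n → rank n (keyᵇ n μ) i₀ < rank n (keyᵇ n μ) i → μ i₀ ≤ μ i
      above i i<n hi = lex-≤ {i = i₀} {i} i<n (<⇒≤ (<ᵇ-true⁻¹
        (rank-reflects (key-order n μ) i₀ i i₀<n i<n hi)))
    θ = proj₁ (threshold t t≤n)
    pointwise : ∀ i → i < n → ι (chosen n t μ i) * μ i + ι (χ i) * θ ≤
                              ι (χ i) * μ i + ι (chosen n t μ i) * θ
    pointwise i i<n with chosen n t μ i in ch | χ i
    ... | true  | true  = ≤-reflexive refl
    ... | false | false = ≤-refl
    ... | true  | false = ≤-trans (≤-reflexive (+-identityʳ _))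
      (*-monoʳ-≤ 1 (proj₁ (proj₂ (threshold t t≤n)) i i<n (<ᵇ-true⁻¹ ch)))
    ... | false | true  = ≤-trans
      (*-monoʳ-≤ 1 (proj₂ (proj₂ (threshold t t≤n)) i i<n (<ᵇ-false⁻¹ ch)))
      (≤-reflexive (sym (+-identityʳ _)))

-- Correctness of the programs

constants : (n d k num den t : ℕ) → ℕ → ℕ
constants n d k num den t 0 = n
constants n d k num den t 1 = d
constants n d k num den t 2 = k
constants n d k num den t 3 = num
constants n d k num den t 4 = den
constants n d k num den t 5 = n * d
constants n d k num den t 6 = n ^ 5
constants n d k num den t 7 = n * d + 1
constants n d k num den t 8 = t
constants n d k num den t _ = 0

mod-id : ∀ {a b} → a < b → apply mod a b ≡ a
mod-id {b = suc b} a<b = m<n⇒m%n≡m a<b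

upd-hit : ∀ {X : Set} (f : ℕ → X) {a b} v → a ≡ b → (f ⟨ a ↦ v ⟩) b ≡ v
upd-hit f v refl = upd-same f _ v

row-bound : ∀ {n d i j} → i < n → j < d → i * d + j < n * d
row-bound {n} {d} {i} {j} i<n j<d = begin-strict
  i * d + j ≡⟨ +-comm (i * d) j ⟩
  j + i * d <⟨ +-monoˡ-< (i * d) j<d ⟩
  suc i * d ≤⟨ *-monoˡ-≤ d i<n ⟩
  n * d     ∎
  where open ≤-Reasoning

ι-∧ : ∀ a b → ι a * ι b ≡ ι (a ∧ b)
ι-∧ true  b = +-identityʳ (ι b)
ι-∧ false b = refl

-- Case distinction for `when`: once the condition is known to be the indicator of b, each outcome
-- is treated with the corresponding equation for b.
choose-ι : ∀ (Q : Store → Set) {v σ τ} b → v ≡ ι b →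
           (b ≡ false → Q σ) → (b ≡ true → Q τ) → Q (choose v σ τ)
choose-ι Q true  refl f g = g refl
choose-ι Q false refl f g = f refl

-- Majorities of five orders

tally : (q₁ q₂ q₃ q₄ q₅ : ℕ → ℕ) → ℕ → ℕ → ℕ
tally q₁ q₂ q₃ q₄ q₅ x y =
  ι (q₁ x <ᵇ q₁ y) + ι (q₂ x <ᵇ q₂ y) + ι (q₃ x <ᵇ q₃ y) + ι (q₄ x <ᵇ q₄ y) + ι (q₅ x <ᵇ q₅ y)

majorityᵇ : (q₁ q₂ q₃ q₄ q₅ : ℕ → ℕ) → ℕ → ℕ → Bool
majorityᵇ q₁ q₂ q₃ q₄ q₅ x y = 2 <ᵇ tally q₁ q₂ q₃ q₄ q₅ x y

module _ {d q₁ q₂ q₃ q₄ q₅} (i₁ : Inj d q₁) (i₂ : Inj d q₂) (i₃ : Inj d q₃)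
         (i₄ : Inj d q₄) (i₅ : Inj d q₅) where

  interchange₅ : ∀ a b c e f a′ b′ c′ e′ f′ →
    (a + b + c + e + f) + (a′ + b′ + c′ + e′ + f′) ≡
    (a + a′) + (b + b′) + (c + c′) + (e + e′) + (f + f′)
  interchange₅ = solve-∀

  votes≤ : ∀ (q : ℕ → ℕ) x y → ι (q x <ᵇ q y) + ι (q y <ᵇ q x) ≤ 1
  votes≤ q x y with <-cmp (q x) (q y)
  ... | tri< lo _ _ rewrite <ᵇ-true lo | <ᵇ-false (<⇒≤ lo) = ≤-refl
  ... | tri≈ _ eq _ rewrite <ᵇ-false (≤-reflexive eq) | <ᵇ-false (≤-reflexive (sym eq)) = z≤n
  ... | tri> _ _ hi rewrite <ᵇ-true hi | <ᵇ-false (<⇒≤ hi) = ≤-refl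

  votes≥ : ∀ {q} → Inj d q → ∀ x y → x < d → y < d → x ≢ y → 1 ≤ ι (q x <ᵇ q y) + ι (q y <ᵇ q x)
  votes≥ {q} iq x y x<d y<d x≢y with <-cmp (q x) (q y)
  ... | tri< lo _ _ rewrite <ᵇ-true lo = s≤s z≤n
  ... | tri≈ _ eq _ = contradiction (iq x y x<d y<d eq) x≢y
  ... | tri> _ _ hi rewrite <ᵇ-true hi = m≤n+m 1 _

  -- An injective order casts exactly one vote on a pair of distinct symbols, so the votes for the
  -- two directions add up to five and exactly one direction gets three. Asymmetry needs only that
  -- the sum is at most five.
  majority-tournament : Tournament d (majorityᵇ q₁ q₂ q₃ q₄ q₅)
  majority-tournament = record { irreflexive = irr ; total = tot ; asymmetric = asym }
    where
    T′ : ℕ → ℕ → ℕ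
    T′ = tally q₁ q₂ q₃ q₄ q₅
    both : ∀ a b → T′ a b + T′ b a ≡
      (ι (q₁ a <ᵇ q₁ b) + ι (q₁ b <ᵇ q₁ a)) + (ι (q₂ a <ᵇ q₂ b) + ι (q₂ b <ᵇ q₂ a)) +
      (ι (q₃ a <ᵇ q₃ b) + ι (q₃ b <ᵇ q₃ a)) + (ι (q₄ a <ᵇ q₄ b) + ι (q₄ b <ᵇ q₄ a)) +
      (ι (q₅ a <ᵇ q₅ b) + ι (q₅ b <ᵇ q₅ a))
    both a b = interchange₅ (ι (q₁ a <ᵇ q₁ b)) (ι (q₂ a <ᵇ q₂ b)) (ι (q₃ a <ᵇ q₃ b))
      (ι (q₄ a <ᵇ q₄ b)) (ι (q₅ a <ᵇ q₅ b)) (ι (q₁ b <ᵇ q₁ a)) (ι (q₂ b <ᵇ q₂ a))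
      (ι (q₃ b <ᵇ q₃ a)) (ι (q₄ b <ᵇ q₄ a)) (ι (q₅ b <ᵇ q₅ a))
    irr : ∀ a → majorityᵇ q₁ q₂ q₃ q₄ q₅ a a ≡ false
    irr a rewrite <ᵇ-false (≤-refl {q₁ a}) | <ᵇ-false (≤-refl {q₂ a}) | <ᵇ-false (≤-refl {q₃ a})
                | <ᵇ-false (≤-refl {q₄ a}) | <ᵇ-false (≤-refl {q₅ a}) = refl
    tot : ∀ a b → a < d → b < d → a ≢ b → majorityᵇ q₁ q₂ q₃ q₄ q₅ a b ≡ false →
          majorityᵇ q₁ q₂ q₃ q₄ q₅ b a ≡ true
    tot a b a<d b<d a≢b h = <ᵇ-true {2} {T′ b a} (+-cancelˡ-≤ 2 3 (T′ b a) (begin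
      5                                                   ≤⟨
        +-mono-≤ (+-mono-≤ (+-mono-≤ (+-mono-≤ (v i₁) (v i₂)) (v i₃)) (v i₄)) (v i₅) ⟩
      w q₁ + w q₂ + w q₃ + w q₄ + w q₅                    ≡⟨ both a b ⟨
      T′ a b + T′ b a                                     ≤⟨ +-monoˡ-≤ (T′ b a) (<ᵇ-false⁻¹ {2} {T′ a b} h) ⟩
      2 + T′ b a                                          ∎))
      where
      open ≤-Reasoning
      w : (ℕ → ℕ) → ℕ
      w q = ι (q a <ᵇ q b) + ι (q b <ᵇ q a)
      v : ∀ {q} → Inj d q → 1 ≤ w q
      v iq = votes≥ iq a b a<d b<d a≢b
    asym : ∀ a b → majorityᵇ q₁ q₂ q₃ q₄ q₅ a b ≡ true → majorityᵇ q₁ q₂ q₃ q₄ q₅ b a ≡ false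
    asym a b h = <ᵇ-false {2} {T′ b a} (+-cancelˡ-≤ 3 (T′ b a) 2 (begin
      3 + T′ b a                                          ≤⟨ +-monoˡ-≤ (T′ b a) (<ᵇ-true⁻¹ {2} {T′ a b} h) ⟩
      T′ a b + T′ b a                                     ≡⟨ both a b ⟩
      w q₁ + w q₂ + w q₃ + w q₄ + w q₅                    ≤⟨
        +-mono-≤ (+-mono-≤ (+-mono-≤ (+-mono-≤ (v q₁) (v q₂)) (v q₃)) (v q₄)) (v q₅) ⟩
      5                                                   ∎))
      where
      open ≤-Reasoning
      w : (ℕ → ℕ) → ℕ
      w q = ι (q a <ᵇ q b) + ι (q b <ᵇ q a)
      v : ∀ q → w q ≤ 1
      v q = votes≤ q a b

-- Loop rules, inversion and the construction of candidates

module Verify (n d k num den t : ℕ) where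

  κ : ℕ → ℕ
  κ = constants n d k num den t

  open Semantics κ

  -- For loops whose iteration i establishes a result `P i` of its own. As i counts down, an
  -- iteration has to preserve only the results with larger index.
  for-each : ∀ x y c σ (Inv : Store → Set) (P : ℕ → Store → Set) →
    Inv (set x (κ y) σ) →
    (∀ i τ → i < κ y → Frame (for x y c) σ τ → Inv τ →
      Inv (⟦ c ⟧ (set x i τ)) × P i (⟦ c ⟧ (set x i τ)) ×
      (∀ j → i < j → j < κ y → P j τ → P j (⟦ c ⟧ (set x i τ)))) →
    Inv (⟦ for x y c ⟧ σ) × (∀ i → i < κ y → P i (⟦ for x y c ⟧ σ))
  for-each x y c σ Inv P init step = proj₁ summary , λ i i<y → proj₂ summary i z≤n i<y
    where
    next : ∀ i τ → i < κ y → Frame (for x y c) σ τ →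
      Inv τ × (∀ j → suc i ≤ j → j < κ y → P j τ) →
      Inv (⟦ c ⟧ (set x i τ)) × (∀ j → i ≤ j → j < κ y → P j (⟦ c ⟧ (set x i τ)))
    next i τ i<y F (inv , done) with inv′ , p , stable ← step i τ i<y F inv =
      inv′ , λ j i≤j j<y → extend′ j (m≤n⇒m<n∨m≡n i≤j) j<y
      where
      extend′ : ∀ j → i < j ⊎ i ≡ j → j < κ y → P j (⟦ c ⟧ (set x i τ))
      extend′ j (inj₁ i<j)  j<y = stable j i<j j<y (done j i<j j<y)
      extend′ j (inj₂ refl) j<y = p
    summary : Inv (⟦ for x y c ⟧ σ) × (∀ j → 0 ≤ j → j < κ y → P j (⟦ for x y c ⟧ σ))
    summary = for-rule x y c σ (λ i τ → Inv τ × (∀ j → i ≤ j → j < κ y → P j τ))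
      (init , λ j y≤j j<y → contradiction j<y (≤⇒≯ y≤j)) next

  -- The counter never exceeds the number of iterations, which is at most n d, so its reduction
  -- modulo n d + 1 has no effect.
  count-loop : ∀ x y e r σ χ →
    x ≢ r → κ y ≤ n * d → vars σ r ≡ 0 →
    (∀ i τ → i < κ y → Frame (for x y (when e (r := (var r ⊕ # 1) ⊛ cmax))) σ τ →
      ⟦ e ⟧ᵉ (set x i τ) ≡ ι (χ i)) →
    vars (⟦ for x y (when e (r := (var r ⊕ # 1) ⊛ cmax)) ⟧ σ) r ≡ count (κ y) χ
  count-loop x y e r σ χ x≢r y≤ r≡0 value = trans (sym (+-identityʳ _))
    (for-rule x y (when e (r := (var r ⊕ # 1) ⊛ cmax)) σ
      (λ i τ → vars τ r + count i χ ≡ count (κ y) χ)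
      (cong (_+ count (κ y) χ) (trans (upd-other (vars σ) x r (κ y) x≢r) r≡0)) next)
    where
    next : ∀ i τ → i < κ y → Frame (for x y (when e (r := (var r ⊕ # 1) ⊛ cmax))) σ τ →
      vars τ r + count (suc i) χ ≡ count (κ y) χ →
      vars (⟦ when e (r := (var r ⊕ # 1) ⊛ cmax) ⟧ (set x i τ)) r + count i χ ≡ count (κ y) χ
    next i τ i<y F h = choose-ι (λ υ → vars υ r + count i χ ≡ count (κ y) χ) (χ i) (value i τ i<y F)
      (λ χi → trans (cong (_+ count i χ) same) (trans (sym (cong (vars τ r +_)
        (trans (cong (λ b → count i χ + ι b) χi) (+-identityʳ _)))) h))
      (λ χi → trans (cong (_+ count i χ) (trans (upd-same (vars (set x i τ)) r _)
          (trans (cong (λ v → apply mod (v + 1) (n * d + 1)) same)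
            (mod-id (≤-<-trans (≤-trans (vr χi) (≤-trans (count≤ (κ y)) y≤)) (m<m+n (n * d) (s≤s z≤n)))))))
        (trans (move′ (vars τ r) (count i χ)) (with-χ χi)))
      where
      same : vars (set x i τ) r ≡ vars τ r
      same = upd-other (vars τ) x r i x≢r
      move′ : ∀ v u → v + 1 + u ≡ v + (u + 1)
      move′ = solve-∀
      with-χ : χ i ≡ true → vars τ r + (count i χ + 1) ≡ count (κ y) χ
      with-χ χi = trans (cong (λ b → vars τ r + (count i χ + ι b)) (sym χi)) h
      vr : χ i ≡ true → vars τ r + 1 ≤ count (κ y) χ
      vr χi = ≤-trans (+-monoʳ-≤ (vars τ r) (m≤n+m 1 (count i χ))) (≤-reflexive (with-χ χi))

  module _ (S : ℕ → ℕ → ℕ) (bS : ∀ i → i < n → Bounded d (S i)) (iS : ∀ i → i < n → Inj d (S i)) where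

    Inverted : ℕ → Store → Set
    Inverted i τ = ∀ j → j < d → cells τ apos (i * d + S i j) ≡ j

    invert-spec : ∀ σ → (∀ i j → i < n → j < d → tape σ (i * d + j) ≡ S i j) →
                  ∀ i → i < n → Inverted i (⟦ invert ⟧ σ)
    invert-spec σ tapeS = proj₂ (for-each vi 0 rowLoop σ (λ _ → ⊤) Inverted tt outer)
      where
      rowLoop : Cmd
      rowLoop = for vj 1 (put apos (var vi ⊗ cd ⊕ given (var vi ⊗ cd ⊕ var vj)) (var vj))
      outer : ∀ i τ → i < n → Frame (for vi 0 rowLoop) σ τ → ⊤ →
        ⊤ × Inverted i (⟦ rowLoop ⟧ (set vi i τ)) ×
        (∀ i′ → i < i′ → i′ < n → Inverted i′ τ → Inverted i′ (⟦ rowLoop ⟧ (set vi i τ)))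
      outer i τ i<n F _ =
        tt , proj₂ filled , λ i′ i<i′ i′<n h j j<d → trans
          (proj₁ filled _ λ a a<d eq → <⇒≢ i<i′ (proj₁ (lex-injective a<d (bS i′ i′<n j j<d) eq)))
          (h j j<d)
        where
        Off : Store → Set
        Off υ = ∀ u → (∀ a → a < d → i * d + a ≢ u) → cells υ apos u ≡ cells τ apos u
        Hit : ℕ → Store → Set
        Hit j υ = cells υ apos (i * d + S i j) ≡ j
        entry : Cmd
        entry = put apos (var vi ⊗ cd ⊕ given (var vi ⊗ cd ⊕ var vj)) (var vj)
        inner : ∀ j υ → j < d → Frame rowLoop (set vi i τ) υ → Off υ →
          Off (⟦ entry ⟧ (set vj j υ)) × Hit j (⟦ entry ⟧ (set vj j υ)) ×
          (∀ j′ → j < j′ → j′ < d → Hit j′ υ → Hit j′ (⟦ entry ⟧ (set vj j υ)))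
        inner j υ j<d G inv =
          (λ u off → trans (upd-other (cells υ apos) _ u j
             (subst (_≢ u) (sym at) (off (S i j) (bS i i<n j j<d)))) (inv u off)) ,
          upd-hit (cells υ apos) j at ,
          (λ j′ j<j′ j′<d h → trans (upd-other (cells υ apos) _ _ j λ eq →
             <⇒≢ j<j′ (iS i i<n j j′ j<d j′<d (+-cancelˡ-≡ (i * d) _ _ (trans (sym at) eq)))) h)
          where
          at : vars υ vi * d + tape υ (apply mod (vars υ vi * d + j) (n * d)) ≡ i * d + S i j
          at rewrite sameVar G vi refl | sameTape G refl (apply mod (i * d + j) (n * d))
                   | sameTape F refl (apply mod (i * d + j) (n * d))
                   | mod-id (row-bound i<n j<d) | tapeS i j i<n j<d = refl
        filled : Off (⟦ rowLoop ⟧ (set vi i τ)) × Inverted i (⟦ rowLoop ⟧ (set vi i τ))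
        filled = for-each vj 1 entry (set vi i τ) Off Hit (λ _ _ → refl) inner

  -- Candidate c is built from the five points whose indices are its digits in base n.
  digitOf : ℕ → ℕ → ℕ
  digitOf zero    c = apply mod c n
  digitOf (suc r) c = digitOf r (apply div c n)

  module Construct (p : ℕ → ℕ) (c : ℕ) where

    position : ℕ → ℕ → ℕ
    position r x = p (digitOf r c * d + x)

    mj : ℕ → ℕ → Bool
    mj = majorityᵇ (position 0) (position 1) (position 2) (position 3) (position 4)

    Reads : Store → Set
    Reads τ = (∀ u → cells τ apos u ≡ p u) × vars τ vc ≡ c

    vote-value : ∀ τ → Reads τ → ∀ r e x y → ⟦ e ⟧ᵉ τ ≡ digitOf r c →
      ⟦ vote e (var x) (var y) ⟧ᵉ τ ≡ ι (position r (vars τ x) <ᵇ position r (vars τ y))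
    vote-value τ (pos , _) r e x y eq = cong₂ (λ u v → ι (u <ᵇ v))
      (trans (pos _) (cong (λ i → p (i * d + vars τ x)) eq))
      (trans (pos _) (cong (λ i → p (i * d + vars τ y)) eq))

    majority-value : ∀ τ → Reads τ → ∀ x y →
      ⟦ majority (var x) (var y) ⟧ᵉ τ ≡ ι (mj (vars τ x) (vars τ y))
    majority-value τ R@(_ , refl) x y = cong (λ s → ι (2 <ᵇ s))
      (cong₂ _+_ (cong₂ _+_ (cong₂ _+_ (cong₂ _+_
        (vote-value τ R 0 digit₁ x y refl) (vote-value τ R 1 digit₂ x y refl))
        (vote-value τ R 2 digit₃ x y refl)) (vote-value τ R 3 digit₄ x y refl))
        (vote-value τ R 4 digit₅ x y refl))

    A : Store → ℕ → Bool
    A τ x = 0 <ᵇ cells τ aalive x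

    flag : ∀ {v} → v ≤ 1 → v ≡ ι (0 <ᵇ v)
    flag z≤n       = refl
    flag (s≤s z≤n) = refl

    Valid : Store → Set
    Valid τ = (∀ x → x < d → cells τ aalive x ≤ 1) ×
      (∀ χ → Hits d mj χ → count d (not ∘ A τ) ≤ 3 * count d (λ a → not (A τ a) ∧ χ a))

    Fewer : Store → Store → Set
    Fewer τ σ = ∀ x → cells τ aalive x ≤ cells σ aalive x

    NoTriangle : ℕ → ℕ → ℕ → Store → Set
    NoTriangle x y z τ =
      A τ x ≡ true → A τ y ≡ true → A τ z ≡ true → triangle mj x y z ≡ false

    alive-mono : ∀ {τ σ x} → Fewer τ σ → A τ x ≡ true → A σ x ≡ true
    alive-mono {x = x} le h = <ᵇ-true (<-≤-trans (<ᵇ-true⁻¹ h) (le x))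

    no-triangle-mono : ∀ {x y z τ σ} → Fewer τ σ → NoTriangle x y z σ → NoTriangle x y z τ
    no-triangle-mono {x} {y} {z} {τ} {σ} le h a b e =
      h (alive-mono {τ} {σ} {x} le a) (alive-mono {τ} {σ} {y} le b) (alive-mono {τ} {σ} {z} le e)

    module Kill (τ : Store) (x y z : ℕ) where
      f f₁ f₂ f₃ : ℕ → ℕ
      f  = cells τ aalive
      f₁ = f ⟨ x ↦ 0 ⟩
      f₂ = f₁ ⟨ y ↦ 0 ⟩
      f₃ = f₂ ⟨ z ↦ 0 ⟩

      upd≤ : ∀ (f : ℕ → ℕ) x u → (f ⟨ x ↦ 0 ⟩) u ≤ f u
      upd≤ f x u with x ≡ᵇ u
      ... | true  = z≤n
      ... | false = ≤-refl

      f₃≤f : ∀ u → f₃ u ≤ f u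
      f₃≤f u = ≤-trans (upd≤ f₂ z u) (≤-trans (upd≤ f₁ y u) (upd≤ f x u))

      f₃-z : f₃ z ≡ 0
      f₃-z = upd-same f₂ z 0
      f₃-y : f₃ y ≡ 0
      f₃-y = n≤0⇒n≡0 (≤-trans (upd≤ f₂ z y) (≤-reflexive (upd-same f₁ y 0)))
      f₃-x : f₃ x ≡ 0
      f₃-x = n≤0⇒n≡0 (≤-trans (upd≤ f₂ z x) (≤-trans (upd≤ f₁ y x) (≤-reflexive (upd-same f x 0))))

      deaths : (ℕ → ℕ) → ℕ
      deaths g = count d (λ u → not (0 <ᵇ g u))

      one-death : ∀ g x → x < d → deaths (g ⟨ x ↦ 0 ⟩) ≤ deaths g + 1
      one-death g x x<d = ≤-trans (∑-mono d pw) (≤-reflexive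
        (trans (∑-+ d) (cong (deaths g +_) (∑-δ d (λ _ → 1) x<d))))
        where
        pw : ∀ u → u < d → ι (not (0 <ᵇ (g ⟨ x ↦ 0 ⟩) u)) ≤ ι (not (0 <ᵇ g u)) + ι (u ≡ᵇ x) * 1
        pw u _ rewrite ≡ᵇ-comm u x with x ≡ᵇ u
        ... | true  = m≤n+m 1 _
        ... | false = m≤m+n _ 0

      -- At most three symbols die. The triangle was alive and χ meets it, so the dead symbols in χ
      -- increase by at least one, and 3 + 3 k = 3 (k + 1).
      kill-valid : x < d → y < d → z < d → Valid τ →
        A τ x ≡ true → A τ y ≡ true → A τ z ≡ true → triangle mj x y z ≡ true →
        (∀ u → u < d → f₃ u ≤ 1) ×
        (∀ χ → Hits d mj χ → deaths f₃ ≤ 3 * count d (λ u → not (0 <ᵇ f₃ u) ∧ χ u))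
      kill-valid x<d y<d z<d (≤1 , few) Ax Ay Az tri =
        (λ u u<d → ≤-trans (f₃≤f u) (≤1 u u<d)) , λ χ hits → begin
          deaths f₃                         ≤⟨ one-death f₂ z z<d ⟩
          deaths f₂ + 1                     ≤⟨ +-monoˡ-≤ 1 (one-death f₁ y y<d) ⟩
          deaths f₁ + 1 + 1                 ≤⟨ +-monoˡ-≤ 1 (+-monoˡ-≤ 1 (one-death f x x<d)) ⟩
          deaths f + 1 + 1 + 1              ≡⟨ three (deaths f) ⟩
          3 + deaths f                      ≤⟨ +-monoʳ-≤ 3 (few χ hits) ⟩
          3 + 3 * killed χ f                ≡⟨ *-suc 3 (killed χ f) ⟨
          3 * suc (killed χ f)              ≤⟨ *-monoʳ-≤ 3 (more χ (hits x y z x<d y<d z<d tri)) ⟩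
          3 * killed χ f₃                   ∎
        where
        open ≤-Reasoning
        three : ∀ v → v + 1 + 1 + 1 ≡ 3 + v
        three = solve-∀
        killed : (ℕ → Bool) → (ℕ → ℕ) → ℕ
        killed χ g = count d (λ u → not (0 <ᵇ g u) ∧ χ u)
        more-at : ∀ χ u → u < d → χ u ≡ true → A τ u ≡ true → f₃ u ≡ 0 → killed χ f < killed χ f₃
        more-at χ u u<d χu Au z≡ = ∑-strict d (λ v _ → pw v) u<d grows
          where
          pw : ∀ v → ι (not (0 <ᵇ f v) ∧ χ v) ≤ ι (not (0 <ᵇ f₃ v) ∧ χ v)
          pw v with 0 <ᵇ f v in e
          ... | true  = z≤n
          ... | false rewrite <ᵇ-false (≤-trans (f₃≤f v) (<ᵇ-false⁻¹ e)) = ≤-refl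
          grows : ι (not (0 <ᵇ f u) ∧ χ u) < ι (not (0 <ᵇ f₃ u) ∧ χ u)
          grows rewrite Au | z≡ | χu = ≤-refl
        more : ∀ χ → χ x ≡ true ⊎ χ y ≡ true ⊎ χ z ≡ true → killed χ f < killed χ f₃
        more χ (inj₁ h)        = more-at χ x x<d h Ax f₃-x
        more χ (inj₂ (inj₁ h)) = more-at χ y y<d h Ay f₃-y
        more χ (inj₂ (inj₂ h)) = more-at χ z z<d h Az f₃-z

    Inv : Store → Set
    Inv τ = Reads τ × Valid τ

    cycle : Cmd
    cycle = when (cyclic (var va) (var vb) (var ve)) (kill (var va) ∙ kill (var vb) ∙ kill (var ve))

    cycle-spec : ∀ τ x y z → vars τ va ≡ x → vars τ vb ≡ y → vars τ ve ≡ z →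
      x < d → y < d → z < d → Inv τ →
      Inv (⟦ cycle ⟧ τ) × Fewer (⟦ cycle ⟧ τ) τ × NoTriangle x y z (⟦ cycle ⟧ τ)
    cycle-spec τ x y z refl refl refl x<d y<d z<d (R , V@(≤1 , _)) =
      choose-ι (λ υ → Inv υ × Fewer υ τ × NoTriangle x y z υ)
        (A τ x ∧ A τ y ∧ A τ z ∧ triangle mj x y z)
        value keep drop
      where
      assoc₆ : ∀ a b c e f g → a * b * c * e * f * g ≡ a * (b * (c * (e * (f * g))))
      assoc₆ = solve-∀
      value : ⟦ cyclic (var va) (var vb) (var ve) ⟧ᵉ τ ≡ ι (A τ x ∧ A τ y ∧ A τ z ∧ triangle mj x y z)
      value rewrite majority-value τ R va vb | majority-value τ R vb ve | majority-value τ R ve va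
        = trans (assoc₆ (cells τ aalive x) _ _ (ι (mj x y)) _ _)
          (trans (cong₂ _*_ (flag (≤1 x x<d)) (trans (cong₂ _*_ (flag (≤1 y y<d)) (trans
            (cong₂ _*_ (flag (≤1 z z<d)) (trans (cong (ι (mj x y) *_) (ι-∧ (mj y z) (mj z x)))
              (ι-∧ (mj x y) _))) (ι-∧ (A τ z) _))) (ι-∧ (A τ y) _))) (ι-∧ (A τ x) _))
      keep : (A τ x ∧ A τ y ∧ A τ z ∧ triangle mj x y z) ≡ false →
             Inv τ × Fewer τ τ × NoTriangle x y z τ
      keep h = (R , V) , (λ _ → ≤-refl) , λ a b e →
        trans (sym (cong₂ _∧_ a (cong₂ _∧_ b (cong (_∧ triangle mj x y z) e)))) h
      υ : Store
      υ = ⟦ kill (var va) ∙ kill (var vb) ∙ kill (var ve) ⟧ τ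
      open Kill τ x y z
      drop : (A τ x ∧ A τ y ∧ A τ z ∧ triangle mj x y z) ≡ true →
             Inv υ × Fewer υ τ × NoTriangle x y z υ
      drop h with A τ x in Ax | A τ y in Ay | A τ z in Az
      ... | true | true | true =
        (R , kill-valid x<d y<d z<d V Ax Ay Az h) , f₃≤f ,
        λ a → contradiction (trans (sym a) (cong (0 <ᵇ_) f₃-x)) λ ()

    -- `Fewer` is carried through all three loops because it is what keeps the triples examined
    -- earlier free of triangles.
    untangle-spec : ∀ σ → Inv σ → Inv (⟦ untangle ⟧ σ) ×
      (∀ x → x < d → ∀ y → y < d → ∀ z → z < d → NoTriangle x y z (⟦ untangle ⟧ σ))
    untangle-spec σ inv = for-each va 1 (for vb 1 (for ve 1 cycle)) σ Inv
      (λ x τ → ∀ y → y < d → ∀ z → z < d → NoTriangle x y z τ) inv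
      λ x τ x<d F I →
        let (I₁ , le₁) , none₁ = for-each vb 1 (for ve 1 cycle) (set va x τ)
              (λ υ → Inv υ × Fewer υ τ) (λ y υ → ∀ z → z < d → NoTriangle x y z υ)
              (I , λ _ → ≤-refl) λ y υ y<d G (I′ , le) →
                let (I₂ , le₂) , none₂ = for-each ve 1 cycle (set vb y υ)
                      (λ ω → Inv ω × Fewer ω υ) (λ z ω → NoTriangle x y z ω)
                      (I′ , λ _ → ≤-refl) λ z ω z<d H (I″ , le′) →
                        let I₃ , le₃ , none₃ = cycle-spec (set ve z ω) x y z
                              (trans (sameVar H va refl) (sameVar G va refl))
                              (sameVar H vb refl) refl x<d y<d z<d I″
                        in (I₃ , λ u → ≤-trans (le₃ u) (le′ u)) , none₃ ,
                           λ z′ _ _ → no-triangle-mono {x} {y} {z′}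
                             {⟦ cycle ⟧ (set ve z ω)} {ω} le₃
                in (I₂ , λ u → ≤-trans (le₂ u) (le u)) , none₂ ,
                   λ y′ _ _ h z z<d → no-triangle-mono {x} {y′} {z}
                     {⟦ for ve 1 cycle ⟧ (set vb y υ)} {υ} le₂ (h z z<d)
        in I₁ , none₁ , λ x′ _ _ h y y<d z z<d → no-triangle-mono {x′} {y} {z}
             {⟦ for vb 1 (for ve 1 cycle) ⟧ (set va x τ)} {τ} le₁ (h y y<d z z<d)

    before-value : ∀ τ → Reads τ → ∀ x y → cells τ aalive (vars τ x) ≤ 1 → cells τ aalive (vars τ y) ≤ 1 →
      ⟦ before (var x) (var y) ⟧ᵉ τ ≡ ι (beforeᵇ mj (A τ) (vars τ x) (vars τ y))
    before-value τ R x y hx hy rewrite majority-value τ R x y =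
      go (flag hx) (flag hy) (mj (vars τ x) (vars τ y)) (vars τ x <ᵇ vars τ y)
      where
      go : ∀ {u v a b} → u ≡ ι a → v ≡ ι b → ∀ m l →
        u * (1 ∸ v) + u * v * ι m + (1 ∸ u) * (1 ∸ v) * ι l ≡
        ι (if a then (if b then m else true) else (if b then false else l))
      go {a = true}  {true}  refl refl true  l = refl
      go {a = true}  {true}  refl refl false l = refl
      go {a = true}  {false} refl refl m     l = refl
      go {a = false} {true}  refl refl m     l = refl
      go {a = false} {false} refl refl m true  = refl
      go {a = false} {false} refl refl m false = refl

    arrange-spec : 1 ≤ n → ∀ σ → Inv σ → Tournament d mj → Untangled d mj (A σ) →
      (∀ u → (∀ a → a < d → c * d + a ≢ u) → cells (⟦ arrange ⟧ σ) acand u ≡ cells σ acand u) ×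
      (∀ a → a < d → cells (⟦ arrange ⟧ σ) acand (c * d + rank d (beforeᵇ mj (A σ)) a) ≡ a)
    arrange-spec 1≤n σ ((pos , vc≡c) , (≤1 , _)) tour unt =
      for-each va 1 body σ Off Hit (λ _ _ → refl) step
      where
      ρ : ℕ → ℕ
      ρ = rank d (beforeᵇ mj (A σ))
      counting body : Cmd
      counting = for vb 1 (when (before (var vb) (var va)) (vrank := (var vrank ⊕ # 1) ⊛ cmax))
      body = vrank := # 0 ∙ counting ∙ put acand (var vc ⊗ cd ⊕ var vrank) (var va)
      Off : Store → Set
      Off τ = ∀ u → (∀ a → a < d → c * d + a ≢ u) → cells τ acand u ≡ cells σ acand u
      Hit : ℕ → Store → Set
      Hit a τ = cells τ acand (c * d + ρ a) ≡ a
      step : ∀ a τ → a < d → Frame (for va 1 body) σ τ → Off τ →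
        Off (⟦ body ⟧ (set va a τ)) × Hit a (⟦ body ⟧ (set va a τ)) ×
        (∀ a′ → a < a′ → a′ < d → Hit a′ τ → Hit a′ (⟦ body ⟧ (set va a τ)))
      step a τ a<d F inv =
        (λ u off → trans (upd-other (cells υ acand) _ u _
           (subst (_≢ u) (sym at) (off (ρ a) (rank-bounded (before-order tour unt) a a<d))))
           (trans (sameCells G acand refl u) (inv u off))) ,
        trans (upd-hit (cells υ acand) _ at) (sameVar G va refl) ,
        (λ a′ a<a′ a′<d h → trans (upd-other (cells υ acand) _ _ _ λ eq → <⇒≢ a<a′
           (rank-inj (before-order tour unt) a a′ a<d a′<d
             (+-cancelˡ-≡ (c * d) _ _ (trans (sym at) eq))))
           (trans (sameCells G acand refl _) h))
        where
        start υ : Store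
        start = set vrank 0 (set va a τ)
        υ = ⟦ counting ⟧ start
        G : Frame counting start υ
        G = frame counting start
        value : ∀ b ω → b < d → Frame counting start ω →
          ⟦ before (var vb) (var va) ⟧ᵉ (set vb b ω) ≡ ι (beforeᵇ mj (A σ) b a)
        value b ω b<d H = trans
          (before-value (set vb b ω)
            ((λ u → trans (sameCells H apos refl u) (trans (sameCells F apos refl u) (pos u))) ,
             trans (sameVar H vc refl) (trans (sameVar F vc refl) vc≡c))
            vb va (≤-trans (≤-reflexive (al b)) (≤1 b b<d))
            (subst (λ x → cells ω aalive x ≤ 1) (sym va≡) (≤-trans (≤-reflexive (al a)) (≤1 a a<d))))
          (cong ι (trans (cong (beforeᵇ mj (A ω) b) va≡) same))
          where
          al : ∀ x → cells ω aalive x ≡ cells σ aalive x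
          al x = trans (sameCells H aalive refl x) (sameCells F aalive refl x)
          va≡ : vars ω va ≡ a
          va≡ = sameVar H va refl
          same : beforeᵇ mj (A ω) b a ≡ beforeᵇ mj (A σ) b a
          same rewrite al b | al a = refl
        at : vars υ vc * d + vars υ vrank ≡ c * d + ρ a
        at = cong₂ (λ x y → x * d + y)
          (trans (sameVar G vc refl) (trans (sameVar F vc refl) vc≡c))
          (count-loop vb 1 (before (var vb) (var va)) vrank start (λ b → beforeᵇ mj (A σ) b a)
            (λ ()) (≤-trans (≤-reflexive (sym (+-identityʳ d))) (*-monoˡ-≤ d 1≤n)) refl value)

    construct-spec : 1 ≤ n → ∀ σ → Reads σ → Tournament d mj →
      (∀ u → (∀ a → a < d → c * d + a ≢ u) → cells (⟦ construct ⟧ σ) acand u ≡ cells σ acand u) ×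
      ∃[ ρ ] Candidate d mj ρ ×
        (∀ a → a < d → cells (⟦ construct ⟧ σ) acand (c * d + ρ a) ≡ a)
    construct-spec 1≤n σ (pos , vc≡c) tour =
      (λ u off → trans (proj₁ arranged u off)
        (trans (sameCells (frame untangle σ₁) acand refl u) (sameCells F₁ acand refl u))) ,
      rank d (beforeᵇ mj (A σ₂)) , candidate tour unt , proj₂ arranged
      where
      fresh : Cmd
      fresh = for va 1 (put aalive (var va) (# 1))
      σ₁ σ₂ : Store
      σ₁ = ⟦ fresh ⟧ σ
      σ₂ = ⟦ untangle ⟧ σ₁
      F₁ : Frame fresh σ σ₁
      F₁ = frame fresh σ
      alive₁ : ∀ a → a < d → cells σ₁ aalive a ≡ 1
      alive₁ = proj₂ (for-each va 1 (put aalive (var va) (# 1)) σ (λ _ → ⊤)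
        (λ a τ → cells τ aalive a ≡ 1) tt
        λ a τ a<d F _ → tt , upd-same (cells τ aalive) a 1 ,
          λ a′ a<a′ _ h → trans (upd-other (cells τ aalive) a a′ 1 (<⇒≢ a<a′)) h)
      inv₁ : Inv σ₁
      inv₁ = ((λ u → trans (sameCells F₁ apos refl u) (pos u)) , trans (sameVar F₁ vc refl) vc≡c) ,
        (λ x x<d → ≤-reflexive (alive₁ x x<d)) ,
        λ χ _ → ≤-trans (≤-reflexive (trans (∑-cong d λ x x<d →
          cong (λ v → ι (not (0 <ᵇ v))) (alive₁ x x<d)) (∑-zero d))) z≤n
      untangled : Inv σ₂ ×
        (∀ x → x < d → ∀ y → y < d → ∀ z → z < d → NoTriangle x y z σ₂)
      untangled = untangle-spec σ₁ inv₁
      unt : Untangled d mj (A σ₂)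
      unt = record
        { acyclic = λ x y z x<d y<d z<d → proj₂ untangled x x<d y y<d z z<d
        ; few     = proj₂ (proj₂ (proj₁ untangled)) }
      arranged : (∀ u → (∀ a → a < d → c * d + a ≢ u) → cells (⟦ arrange ⟧ σ₂) acand u ≡ cells σ₂ acand u) ×
        (∀ a → a < d → cells (⟦ arrange ⟧ σ₂) acand (c * d + rank d (beforeᵇ mj (A σ₂)) a) ≡ a)
      arranged = arrange-spec 1≤n σ₂ (proj₁ untangled) tour unt

module _ {d} {ρ s : ℕ → ℕ} (iρ : Inj d ρ) (bρ : Bounded d ρ) (sρ : ∀ a → a < d → s (ρ a) ≡ a) where

  inverse-bounded : Bounded d s
  inverse-bounded j j<d with a , a<d , refl ← onto d iρ bρ j j<d = subst (_< d) (sym (sρ a a<d)) a<d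

  inverse-right : ∀ j → j < d → ρ (s j) ≡ j
  inverse-right j j<d with a , a<d , refl ← onto d iρ bρ j j<d = cong ρ (sρ a a<d)

majority-cong : ∀ (q₁ q₂ q₃ q₄ q₅ r₁ r₂ r₃ r₄ r₅ : ℕ → ℕ) {a b} →
  q₁ a ≡ r₁ a → q₁ b ≡ r₁ b → q₂ a ≡ r₂ a → q₂ b ≡ r₂ b → q₃ a ≡ r₃ a → q₃ b ≡ r₃ b →
  q₄ a ≡ r₄ a → q₄ b ≡ r₄ b → q₅ a ≡ r₅ a → q₅ b ≡ r₅ b →
  majorityᵇ q₁ q₂ q₃ q₄ q₅ a b ≡ majorityᵇ r₁ r₂ r₃ r₄ r₅ a b
majority-cong _ _ _ _ _ _ _ _ _ _ e₁ f₁ e₂ f₂ e₃ f₃ e₄ f₄ e₅ f₅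
  rewrite e₁ | f₁ | e₂ | f₂ | e₃ | f₃ | e₄ | f₄ | e₅ | f₅ = refl

-- The conditions at j concern entries from j on, while the loop, counting down, afterwards writes
-- only below j.
chain-cong : ∀ {d q L L′ j} → (∀ i → j ≤ i → L′ i ≡ L i) → Chain d q L j → Chain d q L′ j
chain-cong {L = L} {L′} {j} eq ch = record
  { positive = subst (1 ≤_) (sym (eq j ≤-refl)) (positive ch)
  ; upper    = λ i j<i i<d lo →
      subst₂ _<_ (sym (eq i (<⇒≤ j<i))) (sym (eq j ≤-refl)) (upper ch i j<i i<d lo)
  ; attained = shift (attained ch) }
  where
  open Chain
  shift : L j ≡ 1 ⊎ (∃[ i ] j < i × i < _ × _ < _ × L j ≡ suc (L i)) →
          L′ j ≡ 1 ⊎ (∃[ i ] j < i × i < _ × _ < _ × L′ j ≡ suc (L′ i))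
  shift (inj₁ one) = inj₁ (trans (eq j ≤-refl) one)
  shift (inj₂ (i , j<i , i<d , lo , h)) = inj₂ (i , j<i , i<d , lo ,
    trans (eq j ≤-refl) (trans h (cong suc (sym (eq i (<⇒≤ j<i))))))

choice : ∀ {N} {B : Set} (P : ℕ → B → Set) → B → (∀ c → c < N → ∃ (P c)) →
         ∃[ f ] ∀ c → c < N → P c (f c)
choice {N} {B} P default h = f , f-spec
  where
  f : ℕ → B
  f c with c <? N
  ... | yes c<N = proj₁ (h c c<N)
  ... | no _    = default
  f-spec : ∀ c → c < N → P c (f c)
  f-spec c c<N with c <? N
  ... | yes c<N′ = proj₂ (h c c<N′)
  ... | no c≮N   = contradiction c<N c≮N

-- Distances of the points from the candidates

module Measuring (n d k num den t : ℕ) (1≤n : 1 ≤ n) where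
  open Verify n d k num den t
  open Semantics κ

  module Row (P s : ℕ → ℕ) (c i : ℕ) where

    q : ℕ → ℕ
    q j = P (s j)

    record Reads (τ : Store) : Set where
      field
        readPos  : ∀ a → a < d → cells τ apos (i * d + a) ≡ P a
        readCand : ∀ j → j < d → cells τ acand (c * d + j) ≡ s j
        readC    : vars τ vc ≡ c
        readI    : vars τ vi ≡ i
    open Reads

    image-value : Bounded d s → ∀ τ → Reads τ → ∀ x → vars τ x < d →
                  ⟦ image (var x) ⟧ᵉ τ ≡ q (vars τ x)
    image-value bs τ R x x<d rewrite readC R | readI R | readCand R (vars τ x) x<d =
      readPos R _ (bs _ x<d)

    reads-frame : ∀ prog {σ τ} → modifiesCells prog apos ≡ false → modifiesCells prog acand ≡ false →
      modifiesVar prog vc ≡ false → modifiesVar prog vi ≡ false →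
      Frame prog σ τ → Reads σ → Reads τ
    reads-frame prog h₁ h₂ h₃ h₄ F R = record
      { readPos  = λ a a<d → trans (sameCells F apos h₁ _) (readPos R a a<d)
      ; readCand = λ j j<d → trans (sameCells F acand h₂ _) (readCand R j j<d)
      ; readC    = trans (sameVar F vc h₃) (readC R)
      ; readI    = trans (sameVar F vi h₄) (readI R) }

    Best : (ℕ → ℕ) → ℕ → ℕ → ℕ → Set
    Best L j from v =
      (∀ i′ → from ≤ i′ → i′ < d → j < i′ → q j < q i′ → L i′ ≤ v) ×
      (v ≡ 0 ⊎ ∃[ i′ ] i′ < d × j < i′ × q j < q i′ × L i′ ≡ v)

    extend-spec : Bounded d s → ∀ σ j → Reads σ → vars σ va ≡ j → j < d → vars σ vmin ≡ 0 →
      Best (cells σ achain) j 0 (vars (⟦ extend ⟧ σ) vmin)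
    extend-spec bs σ j R va≡j j<d v≡0 = for-rule vb 1 body σ
      (λ b τ → Best (cells σ achain) j b (vars τ vmin))
      ((λ i′ d≤i′ i′<d → contradiction i′<d (≤⇒≯ d≤i′)) , inj₁ v≡0) step
      where
      body : Cmd
      body = when ((var va ⊲ var vb) ⊗ (image (var va) ⊲ image (var vb)) ⊗
                   (var vmin ⊲ get achain (var vb)))
               (vmin := get achain (var vb))
      L : ℕ → ℕ
      L = cells σ achain
      step : ∀ b τ → b < d → Frame (for vb 1 body) σ τ → Best L j (suc b) (vars τ vmin) →
             Best L j b (vars (⟦ body ⟧ (set vb b τ)) vmin)
      step b τ b<d F (above , hit) = choose-ι (λ υ → Best L j b (vars υ vmin))
        (((j <ᵇ b) ∧ (q j <ᵇ q b)) ∧ (vars τ vmin <ᵇ L b)) value keep take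
        where
        R′ : Reads (set vb b τ)
        R′ = record
          { readPos = readPos R″ ; readCand = readCand R″ ; readC = readC R″ ; readI = readI R″ }
          where R″ = reads-frame (for vb 1 body) refl refl refl refl F R
        va≡ : vars τ va ≡ j
        va≡ = trans (sameVar F va refl) va≡j
        value : ⟦ (var va ⊲ var vb) ⊗ (image (var va) ⊲ image (var vb)) ⊗
                  (var vmin ⊲ get achain (var vb)) ⟧ᵉ (set vb b τ) ≡
                ι (((j <ᵇ b) ∧ (q j <ᵇ q b)) ∧ (vars τ vmin <ᵇ L b))
        value = trans
          (cong₂ _*_ (cong₂ _*_ (cong (λ x → ι (x <ᵇ b)) va≡)
            (cong₂ (λ x y → ι (x <ᵇ y))
              (trans (image-value bs (set vb b τ) R′ va (subst (_< d) (sym va≡) j<d)) (cong q va≡))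
              (image-value bs (set vb b τ) R′ vb b<d)))
            (cong (λ x → ι (vars τ vmin <ᵇ x)) (sameCells F achain refl b)))
          (trans (cong (_* ι (vars τ vmin <ᵇ L b)) (ι-∧ (j <ᵇ b) (q j <ᵇ q b)))
            (ι-∧ ((j <ᵇ b) ∧ (q j <ᵇ q b)) (vars τ vmin <ᵇ L b)))
        keep : (((j <ᵇ b) ∧ (q j <ᵇ q b)) ∧ (vars τ vmin <ᵇ L b)) ≡ false →
               Best L j b (vars τ vmin)
        keep h = above′ , hit
          where
          above′ : ∀ i′ → b ≤ i′ → i′ < d → j < i′ → q j < q i′ → L i′ ≤ vars τ vmin
          above′ i′ b≤i′ i′<d j<i′ lo with m≤n⇒m<n∨m≡n b≤i′
          ... | inj₁ b<i′ = above i′ b<i′ i′<d j<i′ lo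
          ... | inj₂ refl = <ᵇ-false⁻¹ (trans (cong₂ (λ x y → (x ∧ y) ∧ (vars τ vmin <ᵇ L b))
            (sym (<ᵇ-true j<i′)) (sym (<ᵇ-true lo))) h)
        take : (((j <ᵇ b) ∧ (q j <ᵇ q b)) ∧ (vars τ vmin <ᵇ L b)) ≡ true →
               Best L j b (cells τ achain b)
        take h with h₁ , h₂ ← ∧-split {(j <ᵇ b) ∧ (q j <ᵇ q b)} h
          with h₃ , h₄ ← ∧-split {j <ᵇ b} h₁ =
          subst (Best L j b) (sym (sameCells F achain refl b))
            (above′ , inj₂ (b , b<d , <ᵇ-true⁻¹ h₃ , <ᵇ-true⁻¹ h₄ , refl))
          where
          above′ : ∀ i′ → b ≤ i′ → i′ < d → j < i′ → q j < q i′ → L i′ ≤ L b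
          above′ i′ b≤i′ i′<d j<i′ lo with m≤n⇒m<n∨m≡n b≤i′
          ... | inj₁ b<i′ = ≤-trans (above i′ b<i′ i′<d j<i′ lo) (<⇒≤ (<ᵇ-true⁻¹ h₂))
          ... | inj₂ refl = ≤-refl

    -- The bound `cells τ achain j′ + j′ ≤ d` holds because a chain from j′ has at most d - j′
    -- entries; it ensures that the reduction modulo `cmax` has no effect.
    Progress : ℕ → Store → Set
    Progress j τ =
      (∀ j′ → j ≤ j′ → j′ < d → Chain d q (cells τ achain) j′ ×
         cells τ achain j′ + j′ ≤ d × cells τ achain j′ ≤ vars τ vmax) ×
      (vars τ vmax ≡ 0 ⊎ ∃[ j′ ] j ≤ j′ × j′ < d × cells τ achain j′ ≡ vars τ vmax)

    link : Cmd
    link = vmin := # 0 ∙ extend ∙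
      put achain (var va) ((var vmin ⊕ # 1) ⊛ cmax) ∙
      when (var vmax ⊲ get achain (var va)) (vmax := get achain (var va))

    link-spec : Bounded d s → ∀ τ j → Reads τ → j < d → Progress (suc j) τ →
                Progress j (⟦ link ⟧ (set va j τ))
    link-spec bs τ j R j<d (chains , hit) =
      choose-ι (Progress j) (vars τ₂ vmax <ᵇ new) value keep take
      where
      τ₀ τ₁ τ₂ : Store
      τ₀ = set vmin 0 (set va j τ)
      τ₁ = ⟦ extend ⟧ τ₀
      τ₂ = ⟦ put achain (var va) ((var vmin ⊕ # 1) ⊛ cmax) ⟧ τ₁
      F : Frame extend τ₀ τ₁
      F = frame extend τ₀
      L : ℕ → ℕ
      L = cells τ achain
      v new : ℕ
      v = vars τ₁ vmin
      new = suc v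
      R₀ : Reads τ₀
      R₀ = record { readPos = readPos R ; readCand = readCand R ; readC = readC R ; readI = readI R }
      best : Best L j 0 v
      best = extend-spec bs τ₀ j R₀ refl j<d refl
      new≤ : new + j ≤ d
      new≤ = go (proj₂ best)
        where
        go : v ≡ 0 ⊎ (∃[ i′ ] i′ < d × j < i′ × q j < q i′ × L i′ ≡ v) → new + j ≤ d
        go (inj₁ z) = subst (λ u → suc u + j ≤ d) (sym z) j<d
        go (inj₂ (i′ , i′<d , j<i′ , _ , e)) = ≤-trans
          (≤-trans (≤-reflexive (sym (+-suc v j))) (+-mono-≤ (≤-reflexive (sym e)) j<i′))
          (proj₁ (proj₂ (chains i′ j<i′ i′<d)))
      va₁ : vars τ₁ va ≡ j
      va₁ = sameVar F va refl
      stored : apply mod (v + 1) (n * d + 1) ≡ new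
      stored = trans (cong (λ u → apply mod u (n * d + 1)) (+-comm v 1))
        (mod-id (≤-<-trans (≤-trans (m≤m+n new j) (≤-trans new≤
          (≤-trans (≤-reflexive (sym (+-identityʳ d))) (*-monoˡ-≤ d 1≤n)))) (m<m+n (n * d) (s≤s z≤n))))
      at-j : cells τ₂ achain j ≡ new
      at-j = trans (upd-hit (cells τ₁ achain) _ va₁) stored
      off-j : ∀ i′ → j < i′ → cells τ₂ achain i′ ≡ L i′
      off-j i′ j<i′ = trans (upd-other (cells τ₁ achain) _ i′ _ (subst (_≢ i′) (sym va₁) (<⇒≢ j<i′)))
        (sameCells F achain refl i′)
      vmax₂ : vars τ₂ vmax ≡ vars τ vmax
      vmax₂ = sameVar F vmax refl
      value : ⟦ var vmax ⊲ get achain (var va) ⟧ᵉ τ₂ ≡ ι (vars τ₂ vmax <ᵇ new)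
      value = cong (λ u → ι (vars τ₂ vmax <ᵇ u)) (trans (cong (cells τ₂ achain) va₁) at-j)
      chain-j : Chain d q (cells τ₂ achain) j
      chain-j = record
        { positive = subst (1 ≤_) (sym at-j) (s≤s z≤n)
        ; upper    = λ i′ j<i′ i′<d lo → subst₂ _<_ (sym (off-j i′ j<i′)) (sym at-j)
            (s≤s (proj₁ best i′ z≤n i′<d j<i′ lo))
        ; attained = go (proj₂ best) }
        where
        go : v ≡ 0 ⊎ (∃[ i′ ] i′ < d × j < i′ × q j < q i′ × L i′ ≡ v) →
             cells τ₂ achain j ≡ 1 ⊎
             (∃[ i′ ] j < i′ × i′ < d × q j < q i′ × cells τ₂ achain j ≡ suc (cells τ₂ achain i′))
        go (inj₁ z) = inj₁ (trans at-j (cong suc z))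
        go (inj₂ (i′ , i′<d , j<i′ , lo , e)) = inj₂ (i′ , j<i′ , i′<d , lo ,
          trans at-j (cong suc (sym (trans (off-j i′ j<i′) e))))
      all-chains : ∀ u → new ≤ u → vars τ₂ vmax ≤ u → ∀ j′ → j ≤ j′ → j′ < d →
        Chain d q (cells τ₂ achain) j′ × cells τ₂ achain j′ + j′ ≤ d × cells τ₂ achain j′ ≤ u
      all-chains u new≤u max≤u j′ j≤j′ j′<d with m≤n⇒m<n∨m≡n j≤j′
      ... | inj₂ refl = chain-j , subst (λ u → u + j ≤ d) (sym at-j) new≤ ,
        subst (_≤ u) (sym at-j) new≤u
      ... | inj₁ j<j′ with ch , le , le′ ← chains j′ j<j′ j′<d =
        chain-cong (λ i′ j′≤i′ → off-j i′ (<-≤-trans j<j′ j′≤i′)) ch ,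
        subst (λ u → u + j′ ≤ d) (sym (off-j j′ j<j′)) le ,
        subst (_≤ u) (sym (off-j j′ j<j′)) (≤-trans le′ (subst (_≤ u) vmax₂ max≤u))
      keep : (vars τ₂ vmax <ᵇ new) ≡ false → Progress j τ₂
      keep h = all-chains (vars τ₂ vmax) (<ᵇ-false⁻¹ h) ≤-refl , go hit
        where
        go : vars τ vmax ≡ 0 ⊎ (∃[ j′ ] suc j ≤ j′ × j′ < d × L j′ ≡ vars τ vmax) →
             vars τ₂ vmax ≡ 0 ⊎ (∃[ j′ ] j ≤ j′ × j′ < d × cells τ₂ achain j′ ≡ vars τ₂ vmax)
        go (inj₁ z) = inj₁ (trans vmax₂ z)
        go (inj₂ (j′ , j<j′ , j′<d , e)) =
          inj₂ (j′ , <⇒≤ j<j′ , j′<d , trans (off-j j′ j<j′) (trans e (sym vmax₂)))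
      take : (vars τ₂ vmax <ᵇ new) ≡ true → Progress j (⟦ vmax := get achain (var va) ⟧ τ₂)
      take h = (λ j′ j≤j′ j′<d → all-chains (cells τ₂ achain (vars τ₁ va)) (≤-reflexive (sym set≡))
          (≤-trans (<⇒≤ (<ᵇ-true⁻¹ h)) (≤-reflexive (sym set≡))) j′ j≤j′ j′<d) ,
        inj₂ (j , ≤-refl , j<d , cong (cells τ₂ achain) (sym va₁))
        where
        set≡ : cells τ₂ achain (vars τ₁ va) ≡ new
        set≡ = trans (cong (cells τ₂ achain) va₁) at-j

    measure-spec : ∀ σ ρ → Reads σ → Inj d P → Inj d ρ → Bounded d ρ → Bounded d s →
      (∀ a → a < d → s (ρ a) ≡ a) → (∀ j → j < d → ρ (s j) ≡ j) →
      Dist d P ρ (cells (⟦ measure ⟧ σ) adist (c * n + i)) ×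
      (∀ u → c * n + i ≢ u → cells (⟦ measure ⟧ σ) adist u ≡ cells σ adist u)
    measure-spec σ ρ R iP iρ bρ bs sρ ρs =
      subst (Dist d P ρ) (sym (upd-hit (cells τ adist) (d ∸ vars τ vmax) at))
        (chain-dist (λ j j<d → proj₁ (proj₁ progress j z≤n j<d))
          (λ j j<d → proj₂ (proj₂ (proj₁ progress j z≤n j<d)))
          (top (proj₂ progress)) iP iρ bρ bs sρ ρs (λ _ _ → refl)) ,
      λ u ≢u → trans (upd-other (cells τ adist) _ u _ (subst (_≢ u) (sym at) ≢u))
        (sameCells F adist refl u)
      where
      loop : Cmd
      loop = for va 1 link
      σ₀ τ : Store
      σ₀ = set vmax 0 σ
      τ = ⟦ loop ⟧ σ₀
      F : Frame loop σ₀ τ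
      F = frame loop σ₀
      R₀ : Reads σ₀
      R₀ = record { readPos = readPos R ; readCand = readCand R ; readC = readC R ; readI = readI R }
      progress : Progress 0 τ
      progress = for-rule va 1 link σ₀ Progress
        ((λ j d≤j j<d → contradiction j<d (≤⇒≯ d≤j)) , inj₁ refl)
        λ j υ j<d G → link-spec bs υ j (reads-frame loop refl refl refl refl G R₀) j<d
      at : vars τ vc * n + vars τ vi ≡ c * n + i
      at = cong₂ (λ x y → x * n + y) (trans (sameVar F vc refl) (readC R))
                                     (trans (sameVar F vi refl) (readI R))
      top : vars τ vmax ≡ 0 ⊎ (∃[ j ] 0 ≤ j × j < d × cells τ achain j ≡ vars τ vmax) →
            vars τ vmax ≡ 0 ⊎ (∃[ j ] j < d × cells τ achain j ≡ vars τ vmax)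
      top (inj₁ z) = inj₁ z
      top (inj₂ (j , _ , j<d , e)) = inj₂ (j , j<d , e)

  module _ (S x : ℕ → ℕ → ℕ)
           (bS : ∀ i → i < n → Bounded d (S i)) (bx : ∀ i → i < n → Bounded d (x i))
           (Sx : ∀ i → i < n → ∀ a → a < d → S i (x i a) ≡ a)
           (xS : ∀ i → i < n → ∀ j → j < d → x i (S i j) ≡ j) where

    iS : ∀ i → i < n → Inj d (S i)
    iS i i<n j j′ j<d j′<d e = trans (sym (xS i i<n j j<d)) (trans (cong (x i) e) (xS i i<n j′ j′<d))

    ix : ∀ i → i < n → Inj d (x i)
    ix i i<n a b a<d b<d e = trans (sym (Sx i i<n a a<d)) (trans (cong (S i) e) (Sx i i<n b b<d))

    digit< : ∀ r c → digitOf r c < n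
    digit< zero    c = go n 1≤n
      where
      go : ∀ m → 1 ≤ m → apply mod c m < m
      go (suc m) _ = m%n<n c (suc m)
    digit< (suc r) c = digit< r (apply div c n)

    mjOf : ℕ → ℕ → ℕ → Bool
    mjOf c = majorityᵇ (x (digitOf 0 c)) (x (digitOf 1 c)) (x (digitOf 2 c))
                       (x (digitOf 3 c)) (x (digitOf 4 c))

    record Ready (c : ℕ) (τ : Store) (ρ : ℕ → ℕ) : Set where
      field
        good   : Candidate d (mjOf c) ρ
        listed : ∀ a → a < d → cells τ acand (c * d + ρ a) ≡ a

    Measured : ℕ → (ℕ → ℕ) → Store → Set
    Measured c ρ τ = ∀ i → i < n → Dist d (x i) ρ (cells τ adist (c * n + i))

    record Prepared (σ τ : Store) : Set where
      field
        candidates : ℕ → ℕ → ℕ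
        ready      : ∀ c → c < n ^ 5 → Ready c τ (candidates c)
        measured   : ∀ c → c < n ^ 5 → Measured c (candidates c) τ
        opt≡       : vars τ vopt ≡ n * d + 1
        carry≡     : vars τ vcarry ≡ 0
        idx≡       : ∀ u → cells τ aidx u ≡ cells σ aidx u

    Positioned : Store → Set
    Positioned σ = ∀ i → i < n → ∀ a → a < d → cells σ apos (i * d + a) ≡ x i a

    invert-positioned : ∀ σ → (∀ i j → i < n → j < d → tape σ (i * d + j) ≡ S i j) →
                        Positioned (⟦ invert ⟧ σ)
    invert-positioned σ tapeS i i<n a a<d =
      trans (cong (λ b → cells (⟦ invert ⟧ σ) apos (i * d + b)) (sym (Sx i i<n a a<d)))
        (invert-spec S bS iS σ tapeS i i<n (x i a) (bx i i<n a a<d))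

    construct-all : ∀ σ₁ → Positioned σ₁ →
                    ∀ c → c < n ^ 5 → ∃ (Ready c (⟦ for vc 6 construct ⟧ σ₁))
    construct-all σ₁ pos₁ = built
      where
      module C (c : ℕ) = Construct (cells σ₁ apos) c
      position≡ : ∀ r c a → a < d → C.position c r a ≡ x (digitOf r c) a
      position≡ r c a a<d = pos₁ (digitOf r c) (digit< r c) a a<d
      iposition : ∀ r c → Inj d (C.position c r)
      iposition r c a b a<d b<d e = ix (digitOf r c) (digit< r c) a b a<d b<d
        (trans (sym (position≡ r c a a<d)) (trans e (position≡ r c b b<d)))
      mj≡ : ∀ c a b → a < d → b < d → C.mj c a b ≡ mjOf c a b
      mj≡ c a b a<d b<d = majority-cong
        (C.position c 0) (C.position c 1) (C.position c 2) (C.position c 3) (C.position c 4)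
        (x (digitOf 0 c)) (x (digitOf 1 c)) (x (digitOf 2 c)) (x (digitOf 3 c)) (x (digitOf 4 c))
        (position≡ 0 c a a<d) (position≡ 0 c b b<d) (position≡ 1 c a a<d) (position≡ 1 c b b<d)
        (position≡ 2 c a a<d) (position≡ 2 c b b<d) (position≡ 3 c a a<d) (position≡ 3 c b b<d)
        (position≡ 4 c a a<d) (position≡ 4 c b b<d)
      built : ∀ c → c < n ^ 5 → ∃ (Ready c (⟦ for vc 6 construct ⟧ σ₁))
      built = proj₂ (for-each vc 6 construct σ₁ (λ _ → ⊤) (λ c τ → ∃ (Ready c τ)) tt step)
        where
        step : ∀ c τ → c < n ^ 5 → Frame (for vc 6 construct) σ₁ τ → ⊤ →
          ⊤ × ∃ (Ready c (⟦ construct ⟧ (set vc c τ))) ×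
          (∀ c′ → c < c′ → c′ < n ^ 5 → ∃ (Ready c′ τ) → ∃ (Ready c′ (⟦ construct ⟧ (set vc c τ))))
        step c τ c<N F _ =
          tt , (proj₁ (proj₂ spec) , record
            { good = transport (proj₁ (proj₂ (proj₂ spec))) ; listed = proj₂ (proj₂ (proj₂ spec)) }) ,
          λ c′ c<c′ _ R → proj₁ R , record
            { good   = Ready.good (proj₂ R)
            ; listed = λ a a<d → trans (proj₁ spec _ λ b b<d e → <⇒≢ c<c′
                (proj₁ (lex-injective b<d (Candidate.bounded (Ready.good (proj₂ R)) a a<d) e)))
                (Ready.listed (proj₂ R) a a<d) }
          where
          spec : (∀ u → (∀ a → a < d → c * d + a ≢ u) →
                   cells (⟦ construct ⟧ (set vc c τ)) acand u ≡ cells τ acand u) ×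
                 ∃[ ρ ] Candidate d (C.mj c) ρ ×
                   (∀ a → a < d → cells (⟦ construct ⟧ (set vc c τ)) acand (c * d + ρ a) ≡ a)
          spec = C.construct-spec c 1≤n (set vc c τ) ((λ u → sameCells F apos refl u) , refl)
            (majority-tournament (iposition 0 c) (iposition 1 c) (iposition 2 c)
                                 (iposition 3 c) (iposition 4 c))
          transport : ∀ {ρ} → Candidate d (C.mj c) ρ → Candidate d (mjOf c) ρ
          transport cand = record
            { injective = Candidate.injective cand
            ; bounded   = Candidate.bounded cand
            ; close     = λ y χ iy h → Candidate.close cand y χ iy
                λ a b a<d b<d χa χb lo → trans (mj≡ c a b a<d b<d) (h a b a<d b<d χa χb lo) }

    measure-all : ∀ σ₂ → Positioned σ₂ → (cands : ℕ → ℕ → ℕ) → (∀ c → c < n ^ 5 → Ready c σ₂ (cands c)) →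
      ∀ c → c < n ^ 5 → Measured c (cands c) (⟦ for vc 6 (for vi 0 measure) ⟧ σ₂)
    measure-all σ₂ pos₂ cands ready₂ =
      proj₂ (for-each vc 6 (for vi 0 measure) σ₂ (λ _ → ⊤) (λ c τ → Measured c (cands c) τ) tt step)
      where
      step : ∀ c τ → c < n ^ 5 → Frame (for vc 6 (for vi 0 measure)) σ₂ τ → ⊤ →
        ⊤ × Measured c (cands c) (⟦ for vi 0 measure ⟧ (set vc c τ)) ×
        (∀ c′ → c < c′ → c′ < n ^ 5 → Measured c′ (cands c′) τ →
           Measured c′ (cands c′) (⟦ for vi 0 measure ⟧ (set vc c τ)))
      step c τ c<N F _ = tt , proj₂ row , λ c′ c<c′ _ h i i<n →
        subst (Dist d (x i) (cands c′)) (sym (proj₁ row _ λ i′ i′<n e →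
          <⇒≢ c<c′ (proj₁ (lex-injective i′<n i<n e)))) (h i i<n)
        where
        ρ s : ℕ → ℕ
        ρ = cands c
        s j = cells σ₂ acand (c * d + j)
        iρ : Inj d ρ
        iρ = Candidate.injective (Ready.good (ready₂ c c<N))
        bρ : Bounded d ρ
        bρ = Candidate.bounded (Ready.good (ready₂ c c<N))
        sρ : ∀ a → a < d → s (ρ a) ≡ a
        sρ = Ready.listed (ready₂ c c<N)
        bs : Bounded d s
        bs = inverse-bounded {s = s} iρ bρ sρ
        ρs : ∀ j → j < d → ρ (s j) ≡ j
        ρs = inverse-right {s = s} iρ bρ sρ
        Off : Store → Set
        Off υ = ∀ u → (∀ i → i < n → c * n + i ≢ u) → cells υ adist u ≡ cells τ adist u
        Hit : ℕ → Store → Set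
        Hit i υ = Dist d (x i) ρ (cells υ adist (c * n + i))
        inner : ∀ i υ → i < n → Frame (for vi 0 measure) (set vc c τ) υ → Off υ →
          Off (⟦ measure ⟧ (set vi i υ)) × Hit i (⟦ measure ⟧ (set vi i υ)) ×
          (∀ i′ → i < i′ → i′ < n → Hit i′ υ → Hit i′ (⟦ measure ⟧ (set vi i υ)))
        inner i υ i<n G inv =
          (λ u h → trans (proj₂ spec u (h i i<n)) (inv u h)) , proj₁ spec ,
          λ i′ i<i′ _ h → subst (Dist d (x i′) ρ) (sym (proj₂ spec _ λ e →
            <⇒≢ i<i′ (+-cancelˡ-≡ (c * n) i i′ e))) h
          where
          spec : Hit i (⟦ measure ⟧ (set vi i υ)) ×
            (∀ u → c * n + i ≢ u → cells (⟦ measure ⟧ (set vi i υ)) adist u ≡ cells υ adist u)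
          spec = Row.measure-spec (x i) s c i (set vi i υ) ρ
            (record { readPos  = λ a a<d → trans (sameCells G apos refl _)
                        (trans (sameCells F apos refl _) (pos₂ i i<n a a<d))
                    ; readCand = λ j j<d → trans (sameCells G acand refl _) (sameCells F acand refl _)
                    ; readC    = sameVar G vc refl
                    ; readI    = refl })
            (ix i i<n) iρ bρ bs sρ ρs
        row : Off (⟦ for vi 0 measure ⟧ (set vc c τ)) ×
              (∀ i → i < n → Hit i (⟦ for vi 0 measure ⟧ (set vc c τ)))
        row = for-each vi 0 measure (set vc c τ) Off Hit (λ _ _ → refl) inner

    prepare-spec : ∀ σ → (∀ i j → i < n → j < d → tape σ (i * d + j) ≡ S i j) →
                   Prepared σ (⟦ prepare ⟧ σ)
    prepare-spec σ tapeS = assemble (choice (λ c → Ready c σ₂) id (construct-all σ₁ pos₁))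
      where
      σ₁ σ₂ σ₃ : Store
      σ₁ = ⟦ invert ⟧ σ
      σ₂ = ⟦ for vc 6 construct ⟧ σ₁
      σ₃ = ⟦ for vc 6 (for vi 0 measure) ⟧ σ₂
      F₁ : Frame invert σ σ₁
      F₁ = frame invert σ
      F₂ : Frame (for vc 6 construct) σ₁ σ₂
      F₂ = frame (for vc 6 construct) σ₁
      F₃ : Frame (for vc 6 (for vi 0 measure)) σ₂ σ₃
      F₃ = frame (for vc 6 (for vi 0 measure)) σ₂
      pos₁ : Positioned σ₁
      pos₁ = invert-positioned σ tapeS
      pos₂ : Positioned σ₂
      pos₂ i i<n a a<d = trans (sameCells F₂ apos refl _) (pos₁ i i<n a a<d)
      assemble : (∃[ f ] ∀ c → c < n ^ 5 → Ready c σ₂ (f c)) → Prepared σ (⟦ prepare ⟧ σ)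
      assemble (cands , ready₂) = record
        { candidates = cands
        ; ready      = λ c c<N → record
            { good = Ready.good (ready₂ c c<N)
            ; listed = λ a a<d → trans (sameCells F₃ acand refl _) (Ready.listed (ready₂ c c<N) a a<d) }
        ; measured   = measure-all σ₂ pos₂ cands ready₂
        ; opt≡       = refl
        ; carry≡     = refl
        ; idx≡       = λ u → trans (sameCells F₃ aidx refl u)
            (trans (sameCells F₂ aidx refl u) (sameCells F₁ aidx refl u)) }

IsLeast : ℕ → (ℕ → ℕ) → ℕ → Set
IsLeast k g μ = (∀ j → j < k → μ ≤ g j) × ∃[ j ] j < k × μ ≡ g j

-- The objective value v of the medians e 0, …, e (k - 1), where D c i is the
-- distance of point i from candidate c.
record Objective (n k t : ℕ) (D : ℕ → ℕ → ℕ) (e : ℕ → ℕ) (v : ℕ) : Set where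
  constructor objective
  field
    nearestDist : ℕ → ℕ
    least       : ∀ i → i < n → IsLeast k (λ j → D (e j) i) (nearestDist i)
    value≡      : v ≡ smallest n t nearestDist
open Objective

objective-cong : ∀ {n k t D e f v} → (∀ j → j < k → e j ≡ f j) →
                 Objective n k t D e v → Objective n k t D f v
objective-cong {n} {k} {t} {D} {e} {f} eq (objective μ least v≡) = objective μ least′ v≡
  where
  least′ : ∀ i → i < n → IsLeast k (λ j → D (f j) i) (μ i)
  least′ i i<n with le , j , j<k , h ← least i i<n =
    (λ j j<k → ≤-trans (le j j<k) (≤-reflexive (cong (λ c → D c i) (eq j j<k)))) ,
    j , j<k , trans h (cong (λ c → D c i) (eq j j<k))

-- The k-tuples of candidates are visited in the order of the numbers below
-- N ^ k that they denote in base N.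
num : ℕ → ℕ → (ℕ → ℕ) → ℕ
num N zero    e = 0
num N (suc j) e = num N j e * N + e j

num-cong : ∀ {N e f} k → (∀ j → j < k → e j ≡ f j) → num N k e ≡ num N k f
num-cong zero    h = refl
num-cong {N} (suc k) h =
  cong₂ (λ a b → a * N + b) (num-cong k λ j j<k → h j (m≤n⇒m≤1+n j<k)) (h k ≤-refl)

num-< : ∀ {N e} k → (∀ j → j < k → e j < N) → num N k e < N ^ k
num-< zero    h = s≤s z≤n
num-< {N} (suc k) h = <-≤-trans
  (row-bound (num-< k λ j j<k → h j (m≤n⇒m≤1+n j<k)) (h k ≤-refl))
  (≤-reflexive (*-comm (N ^ k) N))

num-injective : ∀ {N e f} k → (∀ j → j < k → e j < N) → (∀ j → j < k → f j < N) →
                num N k e ≡ num N k f → ∀ j → j < k → e j ≡ f j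
num-injective {N} {e} {f} (suc k) he hf eq j j<1+k
  with eq′ , eqₖ ← lex-injective {N} {num N k e} {num N k f} (he k ≤-refl) (hf k ≤-refl) eq
  with m<1+n⇒m<n∨m≡n j<1+k
... | inj₁ j<k  = num-injective k (λ i i<k → he i (m≤n⇒m≤1+n i<k))
                    (λ i i<k → hf i (m≤n⇒m≤1+n i<k)) eq′ j j<k
... | inj₂ refl = eqₖ

power-split : ∀ N {k j} → j < k → N ^ (k ∸ j) ≡ N * N ^ (k ∸ suc j)
power-split N {suc k} {zero}  _       = refl
power-split N {suc k} {suc j} (s≤s h) = power-split N h

-- Place j has weight `N ^ (k ∸ suc j)`, so digit k - 1 is the lowest. The old and the new
-- contribution of the place are added crosswise to avoid subtraction.
num-upd : ∀ N k j e v → j < k →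
  num N k (e ⟨ j ↦ v ⟩) + e j * N ^ (k ∸ suc j) ≡ num N k e + v * N ^ (k ∸ suc j)
num-upd N (suc k) j e v j<1+k with m<1+n⇒m<n∨m≡n j<1+k
... | inj₂ refl rewrite n∸n≡0 j | upd-same e j v
                      | num-cong {N} j (λ i i<j → upd-other e j i v (>⇒≢ i<j)) =
  go (num N j e * N) v (e j)
  where
  go : ∀ a v b → a + v + b * 1 ≡ a + b + v * 1
  go = solve-∀
... | inj₁ j<k rewrite upd-other e j k v (<⇒≢ j<k) | power-split N j<k = begin
  num N k (e ⟨ j ↦ v ⟩) * N + e k + e j * (N * W)    ≡⟨ go₁ (num N k (e ⟨ j ↦ v ⟩)) N (e k) (e j) W ⟩
  (num N k (e ⟨ j ↦ v ⟩) + e j * W) * N + e k        ≡⟨ cong (λ u → u * N + e k) (num-upd N k j e v j<k) ⟩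
  (num N k e + v * W) * N + e k                      ≡⟨ go₁ (num N k e) N (e k) v W ⟨
  num N k e * N + e k + v * (N * W)                  ∎
  where
  open ≡-Reasoning
  W : ℕ
  W = N ^ (k ∸ suc j)
  go₁ : ∀ a N b c W → a * N + b + c * (N * W) ≡ (a + c * W) * N + b
  go₁ = solve-∀

-- One round of the enumeration

module Rounds (n d k num′ den t : ℕ) (1≤n : 1 ≤ n) (1≤d : 1 ≤ d) (1≤k : 1 ≤ k) (k≤n : k ≤ n)
              (D : ℕ → ℕ → ℕ) (D≤d : ∀ c i → c < n ^ 5 → i < n → D c i ≤ d) where
  open Verify n d k num′ den t
  open Semantics κ

  N : ℕ
  N = n ^ 5

  Distances Indices : Store → Set
  Distances τ = ∀ c i → c < N → i < n → cells τ adist (c * n + i) ≡ D c i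
  Indices τ = ∀ j → j < k → cells τ aidx j < N

  nearest-spec : ∀ σ → Distances σ → Indices σ → ∀ i → i < n →
    IsLeast k (λ j → D (cells σ aidx j) i) (cells (⟦ nearest ⟧ σ) amin i)
  nearest-spec σ ds idx = proj₂ (for-each vi 0 body σ (λ _ → ⊤) Hit tt step)
    where
    scan body : Cmd
    scan = for vj 2 (when (get adist (get aidx (var vj) ⊗ cn ⊕ var vi) ⊲ var vmin)
                          (vmin := get adist (get aidx (var vj) ⊗ cn ⊕ var vi)))
    body = vmin := cd ∙ scan ∙ put amin (var vi) (var vmin)
    Hit : ℕ → Store → Set
    Hit i τ = IsLeast k (λ j → D (cells σ aidx j) i) (cells τ amin i)
    step : ∀ i τ → i < n → Frame (for vi 0 body) σ τ → ⊤ →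
      ⊤ × Hit i (⟦ body ⟧ (set vi i τ)) ×
      (∀ i′ → i < i′ → i′ < n → Hit i′ τ → Hit i′ (⟦ body ⟧ (set vi i τ)))
    step i τ i<n F _ = tt ,
      subst (IsLeast k g) (sym (upd-hit (cells υ amin) (vars υ vmin) vi≡)) (attain (proj₂ partial)) ,
      λ i′ i<i′ _ → subst (IsLeast k (λ j → D (cells σ aidx j) i′)) (sym
        (trans (upd-other (cells υ amin) _ i′ (vars υ vmin) (subst (_≢ i′) (sym vi≡) (<⇒≢ i<i′)))
          (sameCells G amin refl i′)))
      where
      g : ℕ → ℕ
      g j = D (cells σ aidx j) i
      start υ : Store
      start = set vmin d (set vi i τ)
      υ = ⟦ scan ⟧ start
      G : Frame scan start υ
      G = frame scan start
      vi≡ : vars υ vi ≡ i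
      vi≡ = sameVar G vi refl
      I : ℕ → Store → Set
      I j ω = (∀ j′ → j ≤ j′ → j′ < k → vars ω vmin ≤ g j′) ×
              (vars ω vmin ≡ d ⊎ ∃[ j′ ] j′ < k × vars ω vmin ≡ g j′)
      next : ∀ j ω → j < k → Frame scan start ω → I (suc j) ω →
        I j (⟦ when (get adist (get aidx (var vj) ⊗ cn ⊕ var vi) ⊲ var vmin)
                    (vmin := get adist (get aidx (var vj) ⊗ cn ⊕ var vi)) ⟧ (set vj j ω))
      next j ω j<k H (low , hit) = choose-ι (I j) (g j <ᵇ vars ω vmin)
        (cong (λ u → ι (u <ᵇ vars ω vmin)) at)
        (λ h → (λ j′ j≤j′ j′<k → keep h j′ (m≤n⇒m<n∨m≡n j≤j′) j′<k) , hit)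
        (λ h → (λ j′ j≤j′ j′<k → ≤-trans (≤-reflexive at) (take h j′ (m≤n⇒m<n∨m≡n j≤j′) j′<k)) ,
          inj₂ (j , j<k , at))
        where
        at : cells ω adist (cells ω aidx j * n + vars ω vi) ≡ g j
        at = trans (cong₂ (λ c i → cells ω adist (c * n + i))
            (trans (sameCells H aidx refl j) (sameCells F aidx refl j)) (sameVar H vi refl))
          (trans (trans (sameCells H adist refl _) (sameCells F adist refl _))
            (ds (cells σ aidx j) i (idx j j<k) i<n))
        keep : (g j <ᵇ vars ω vmin) ≡ false → ∀ j′ → j < j′ ⊎ j ≡ j′ → j′ < k → vars ω vmin ≤ g j′
        keep h j′ (inj₁ j<j′) j′<k = low j′ j<j′ j′<k
        keep h j′ (inj₂ refl) j′<k = <ᵇ-false⁻¹ h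
        take : (g j <ᵇ vars ω vmin) ≡ true → ∀ j′ → j < j′ ⊎ j ≡ j′ → j′ < k → g j ≤ g j′
        take h j′ (inj₁ j<j′) j′<k = ≤-trans (<⇒≤ (<ᵇ-true⁻¹ h)) (low j′ j<j′ j′<k)
        take h j′ (inj₂ refl) j′<k = ≤-refl
      partial : ⊤ × I 0 υ
      partial = tt , for-rule vj 2 _ start I
        ((λ j′ k≤j′ j′<k → contradiction j′<k (≤⇒≯ k≤j′)) , inj₁ refl) next
      attain : I 0 υ → IsLeast k g (vars υ vmin)
      attain (low , inj₂ hit)  = (λ j → low j z≤n) , hit
      -- A scan that never went below its starting value d still attains it: d is at most the
      -- distance from the first median, which is itself at most d.
      attain (low , inj₁ full) = (λ j → low j z≤n) , 0 , 1≤k ,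
        ≤-antisym (low 0 z≤n 1≤k) (≤-trans (D≤d _ i (idx 0 1≤k) i<n) (≤-reflexive (sym full)))

  select-spec : ∀ σ → (∀ i → i < n → cells σ amin i ≤ d) →
    vars (⟦ select ⟧ σ) vtotal ≡ smallest n t (cells σ amin) × smallest n t (cells σ amin) ≤ n * d
  select-spec σ μ≤d = trans (sym (+-identityʳ _)) final , total≤
    where
    μ g : ℕ → ℕ
    μ = cells σ amin
    g i = ι (chosen n t μ i) * μ i
    g≤ : ∀ i → i < n → g i ≤ d
    g≤ i i<n = ≤-trans (*-mono-≤ (ι≤1 (chosen n t μ i)) (μ≤d i i<n)) (≤-reflexive (*-identityˡ d))
    total≤ : ∑ n g ≤ n * d
    total≤ = ∑-bound n g≤
    key : Exp
    key = get amin (var vi′) ⊗ cn ⊕ var vi′ ⊲ get amin (var vi) ⊗ cn ⊕ var vi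
    counting update body : Cmd
    counting = for vi′ 0 (when key (vrank := (var vrank ⊕ # 1) ⊛ cmax))
    update = when (var vrank ⊲ con 8) (vtotal := (var vtotal ⊕ get amin (var vi)) ⊛ cmax)
    body = vrank := # 0 ∙ counting ∙ update
    I : ℕ → Store → Set
    I i τ = vars τ vtotal + ∑ i g ≡ ∑ n g
    step : ∀ i τ → i < n → Frame (for vi 0 body) (set vtotal 0 σ) τ → I (suc i) τ →
           I i (⟦ body ⟧ (set vi i τ))
    step i τ i<n F h = choose-ι (I i) (chosen n t μ i)
      (cong (λ r → ι (r <ᵇ t)) ranked)
      (λ e → trans (cong (_+ ∑ i g) total≡) (trans (cong (vars τ vtotal +_) (sym (trans
        (cong (λ b → ∑ i g + ι b * μ i) e) (+-identityʳ _)))) h))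
      (λ e → trans (cong (_+ ∑ i g) (added e)) (trans (move′ (vars τ vtotal) (μ i) (∑ i g)) (with-e e)))
      where
      start υ : Store
      start = set vrank 0 (set vi i τ)
      υ = ⟦ counting ⟧ start
      G : Frame counting start υ
      G = frame counting start
      total≡ : vars υ vtotal ≡ vars τ vtotal
      total≡ = sameVar G vtotal refl
      move′ : ∀ a b c → a + b + c ≡ a + (c + b)
      move′ = solve-∀
      with-e : chosen n t μ i ≡ true → vars τ vtotal + (∑ i g + μ i) ≡ ∑ n g
      with-e e = trans (cong (λ u → vars τ vtotal + (∑ i g + u))
        (trans (sym (*-identityˡ (μ i))) (cong (λ b → ι b * μ i) (sym e)))) h
      ranked : vars υ vrank ≡ rank n (keyᵇ n μ) i
      ranked = count-loop vi′ 0 key vrank start (λ i′ → keyᵇ n μ i′ i) (λ ())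
        (≤-trans (≤-reflexive (sym (*-identityʳ n))) (*-monoʳ-≤ n 1≤d)) refl
        λ i′ ω i′<n H → cong₂ (λ a b → ι (a <ᵇ b))
          (cong (λ m → m * n + i′) (trans (sameCells H amin refl i′) (sameCells F amin refl i′)))
          (cong₂ (λ m l → m * n + l)
            (trans (cong (cells ω amin) (sameVar H vi refl))
              (trans (sameCells H amin refl i) (sameCells F amin refl i)))
            (sameVar H vi refl))
      added : chosen n t μ i ≡ true →
        apply mod (vars υ vtotal + cells υ amin (vars υ vi)) (n * d + 1) ≡ vars τ vtotal + μ i
      added e = trans (cong (λ u → apply mod u (n * d + 1)) (cong₂ _+_ total≡
          (trans (cong (cells υ amin) (sameVar G vi refl))
            (trans (sameCells G amin refl i) (sameCells F amin refl i)))))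
        (mod-id (≤-<-trans (≤-trans (+-monoʳ-≤ (vars τ vtotal) (m≤n+m (μ i) (∑ i g)))
          (≤-trans (≤-reflexive (with-e e)) total≤)) (m<m+n (n * d) (s≤s z≤n))))
    final : vars (⟦ select ⟧ σ) vtotal + 0 ≡ ∑ n g
    final = for-rule vi 0 body (set vtotal 0 σ) I refl step

  BestKnown : Store → Set
  BestKnown τ = vars τ vopt ≡ n * d + 1 ⊎
    (∀ j → j < k → cells τ abest j < N) × Objective n k t D (cells τ abest) (vars τ vopt)

  record-spec : ∀ σ → Indices σ → Objective n k t D (cells σ aidx) (vars σ vtotal) → BestKnown σ →
    BestKnown (⟦ record′ ⟧ σ) × vars (⟦ record′ ⟧ σ) vopt ≤ vars σ vtotal ×
    vars (⟦ record′ ⟧ σ) vopt ≤ vars σ vopt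
  record-spec σ idx obj best = choose-ι
    (λ τ → BestKnown τ × vars τ vopt ≤ vars σ vtotal × vars τ vopt ≤ vars σ vopt)
    (vars σ vtotal <ᵇ vars σ vopt) refl
    (λ h → best , <ᵇ-false⁻¹ h , ≤-refl)
    (λ h → inj₂ ((λ j j<k → subst (_< N) (sym (copied j j<k)) (idx j j<k)) ,
        subst (Objective n k t D (cells τ abest)) (sym opt≡)
          (objective-cong (λ j j<k → sym (copied j j<k)) obj)) ,
      ≤-reflexive opt≡ , ≤-trans (≤-reflexive opt≡) (<⇒≤ (<ᵇ-true⁻¹ h)))
    where
    copy : Cmd
    copy = for vj 2 (put abest (var vj) (get aidx (var vj)))
    σ′ τ : Store
    σ′ = set vopt (vars σ vtotal) σ
    τ = ⟦ copy ⟧ σ′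
    opt≡ : vars τ vopt ≡ vars σ vtotal
    opt≡ = sameVar (frame copy σ′) vopt refl
    copied : ∀ j → j < k → cells τ abest j ≡ cells σ aidx j
    copied = proj₂ (for-each vj 2 (put abest (var vj) (get aidx (var vj))) σ′ (λ _ → ⊤)
      (λ j υ → cells υ abest j ≡ cells σ aidx j) tt
      λ j υ j<k F _ → tt , trans (upd-same (cells υ abest) j _) (sameCells F aidx refl j) ,
        λ j′ j<j′ _ h → trans (upd-other (cells υ abest) j j′ _ (<⇒≢ j<j′)) h)

  -- The loop runs from the lowest digit, k - 1, upwards in significance. Invariant: the number plus
  -- the pending carry, weighted by `N ^ (k ∸ j)`, is the old number plus one.
  increment-spec : ∀ σ → Indices σ → Indices (⟦ increment ⟧ σ) ×
    vars (⟦ increment ⟧ σ) vcarry ≤ 1 ×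
    num N k (cells (⟦ increment ⟧ σ) aidx) + vars (⟦ increment ⟧ σ) vcarry * N ^ k ≡
    num N k (cells σ aidx) + 1
  increment-spec σ idx = for-rule vj 2 body (set vcarry 1 σ) I
    (idx , ≤-refl , cong (λ m → num N k (cells σ aidx) + 1 * N ^ m) (n∸n≡0 k)) step
    where
    bump body : Cmd
    bump = put aidx (var vj) ((get aidx (var vj) ⊕ # 1) ⊛ cN) ∙
           when (get aidx (var vj)) (vcarry := # 0)
    body = when (var vcarry) bump
    I : ℕ → Store → Set
    I j τ = Indices τ × vars τ vcarry ≤ 1 ×
      num N k (cells τ aidx) + vars τ vcarry * N ^ (k ∸ j) ≡ num N k (cells σ aidx) + 1
    carryCase : ∀ j τ → j < k → Indices τ → vars τ vcarry ≡ 1 →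
      num N k (cells τ aidx) + 1 * N ^ (k ∸ suc j) ≡ num N k (cells σ aidx) + 1 →
      I j (⟦ bump ⟧ (set vj j τ))
    carryCase j τ j<k idx′ carry eq with m≤n⇒m<n∨m≡n (idx′ j j<k)
    ... | inj₁ small = subst (λ w → I j (choose w υ (set vcarry 0 υ))) (sym stored)
      (indices , z≤n , trans (+-identityʳ _) (+-cancelʳ-≡ (e j * W) _ _ (begin
        num N k e′ + e j * W                 ≡⟨ updated ⟩
        num N k e + new * W                  ≡⟨ cong (λ v → num N k e + v * W) new≡ ⟩
        num N k e + suc (e j) * W            ≡⟨ go (num N k e) (e j) W ⟩
        num N k e + 1 * W + e j * W          ≡⟨ cong (_+ e j * W) eq ⟩
        num N k (cells σ aidx) + 1 + e j * W ∎)))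
      where
      open ≡-Reasoning
      υ : Store
      υ = ⟦ put aidx (var vj) ((get aidx (var vj) ⊕ # 1) ⊛ cN) ⟧ (set vj j τ)
      e e′ : ℕ → ℕ
      e = cells τ aidx
      e′ = cells υ aidx
      W new : ℕ
      W = N ^ (k ∸ suc j)
      new = apply mod (e j + 1) N
      new≡ : new ≡ suc (e j)
      new≡ = trans (cong (λ u → apply mod u N) (+-comm (e j) 1)) (mod-id small)
      stored : e′ j ≡ suc (e j)
      stored = trans (upd-same e j new) new≡
      updated : num N k e′ + e j * W ≡ num N k e + new * W
      updated = num-upd N k j e new j<k
      indices : Indices υ
      indices j′ j′<k with j ≟ j′
      ... | yes refl = subst (_< N) (sym stored) small
      ... | no  j≢j′ = subst (_< N) (sym (upd-other e j j′ new j≢j′)) (idx′ j′ j′<k)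
      go : ∀ a b W → a + suc b * W ≡ a + 1 * W + b * W
      go = solve-∀
    ... | inj₂ full = subst (λ w → I j (choose w υ (set vcarry 0 υ))) (sym stored)
      (indices , ≤-reflexive carry , (begin
        num N k e′ + vars τ vcarry * N ^ (k ∸ j) ≡⟨ cong₂ (λ c p → num N k e′ + c * p) carry (power-split N j<k) ⟩
        num N k e′ + 1 * (N * W)                 ≡⟨ cong (λ m → num N k e′ + 1 * (m * W)) (sym full) ⟩
        num N k e′ + 1 * (suc (e j) * W)         ≡⟨ go (num N k e′) (e j) W ⟩
        num N k e′ + e j * W + 1 * W             ≡⟨ cong (_+ 1 * W) updated ⟩
        num N k e + new * W + 1 * W              ≡⟨ cong (λ v → num N k e + v * W + 1 * W) new≡ ⟩
        num N k e + 0 + 1 * W                    ≡⟨ cong (_+ 1 * W) (+-identityʳ (num N k e)) ⟩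
        num N k e + 1 * W                        ≡⟨ eq ⟩
        num N k (cells σ aidx) + 1               ∎))
      where
      open ≡-Reasoning
      υ : Store
      υ = ⟦ put aidx (var vj) ((get aidx (var vj) ⊕ # 1) ⊛ cN) ⟧ (set vj j τ)
      e e′ : ℕ → ℕ
      e = cells τ aidx
      e′ = cells υ aidx
      W new : ℕ
      W = N ^ (k ∸ suc j)
      new = apply mod (e j + 1) N
      self-mod : ∀ m → apply mod m m ≡ 0
      self-mod zero    = refl
      self-mod (suc m) = n%n≡0 (suc m)
      new≡ : new ≡ 0
      new≡ = trans (cong (λ u → apply mod u N) (trans (+-comm (e j) 1) full)) (self-mod N)
      stored : e′ j ≡ 0
      stored = trans (upd-same e j new) new≡
      updated : num N k e′ + e j * W ≡ num N k e + new * W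
      updated = num-upd N k j e new j<k
      indices : Indices υ
      indices j′ j′<k with j ≟ j′
      ... | yes refl = subst (_< N) (sym stored) (≤-<-trans z≤n (idx′ j j<k))
      ... | no  j≢j′ = subst (_< N) (sym (upd-other e j j′ new j≢j′)) (idx′ j′ j′<k)
      go : ∀ a b W → a + 1 * (suc b * W) ≡ a + b * W + 1 * W
      go = solve-∀
    step : ∀ j τ → j < k → Frame (for vj 2 body) (set vcarry 1 σ) τ → I (suc j) τ →
           I j (⟦ body ⟧ (set vj j τ))
    step j τ j<k F (idx′ , c≤1 , eq) = go (vars τ vcarry) refl c≤1
      where
      go : ∀ c → vars τ vcarry ≡ c → c ≤ 1 → I j (⟦ body ⟧ (set vj j τ))
      go zero c≡ _ = subst (λ w → I j (choose w (set vj j τ) (⟦ bump ⟧ (set vj j τ)))) (sym c≡)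
        (idx′ , c≤1 , trans (cong (λ c → num N k (cells τ aidx) + c * N ^ (k ∸ j)) c≡)
          (trans (sym (cong (λ c → num N k (cells τ aidx) + c * N ^ (k ∸ suc j)) c≡)) eq))
      go (suc zero) c≡ _ = subst (λ w → I j (choose w (set vj j τ) (⟦ bump ⟧ (set vj j τ)))) (sym c≡)
        (carryCase j τ j<k idx′ c≡
          (trans (sym (cong (λ c → num N k (cells τ aidx) + c * N ^ (k ∸ suc j)) c≡)) eq))
      go (suc (suc _)) c≡ (s≤s ())

  -- The part `v ≤ n * d` later excludes that `vopt` still has its initial value n d + 1.
  Covered : ℕ → Store → Set
  Covered m τ = ∀ e → (∀ j → j < k → e j < N) → num N k e < m →
    ∃[ v ] Objective n k t D e v × vars τ vopt ≤ v × v ≤ n * d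

  record Sound (τ : Store) : Set where
    field
      distances : Distances τ
      indices   : Indices τ
      best      : BestKnown τ
  open Sound

  round-spec : ∀ σ → Sound σ → Covered (num N k (cells σ aidx)) σ →
    Sound (⟦ round ⟧ σ) ×
    Covered (suc (num N k (cells σ aidx))) (⟦ round ⟧ σ) ×
    vars (⟦ round ⟧ σ) vcarry ≤ 1 ×
    num N k (cells (⟦ round ⟧ σ) aidx) + vars (⟦ round ⟧ σ) vcarry * N ^ k ≡
    num N k (cells σ aidx) + 1
  round-spec σ S cov =
    record { distances = λ c i c<N i<n → trans (sameCells (frame increment σ₃) adist refl _)
               (trans (sameCells (frame record′ σ₂) adist refl _) (trans (same adist refl _)
                 (distances S c i c<N i<n)))
           ; indices   = proj₁ incremented
           ; best      = transfer (proj₁ recorded) } ,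
    covered , proj₁ (proj₂ incremented) ,
    trans (proj₂ (proj₂ incremented)) (cong (_+ 1) (num-cong k λ j _ →
      trans (sameCells (frame record′ σ₂) aidx refl j) (same aidx refl j)))
    where
    σ₁ σ₂ σ₃ σ₄ : Store
    σ₁ = ⟦ nearest ⟧ σ
    σ₂ = ⟦ select ⟧ σ₁
    σ₃ = ⟦ record′ ⟧ σ₂
    σ₄ = ⟦ increment ⟧ σ₃
    same : ∀ A → modifiesCells (nearest ∙ select) A ≡ false → ∀ u → cells σ₂ A u ≡ cells σ A u
    same A h = sameCells (frame (nearest ∙ select) σ) A h
    near : ∀ i → i < n → IsLeast k (λ j → D (cells σ aidx j) i) (cells σ₁ amin i)
    near = nearest-spec σ (distances S) (indices S)
    selected : vars σ₂ vtotal ≡ smallest n t (cells σ₁ amin) × smallest n t (cells σ₁ amin) ≤ n * d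
    selected = select-spec σ₁ λ i i<n →
      ≤-trans (proj₁ (near i i<n) 0 1≤k) (D≤d _ i (indices S 0 1≤k) i<n)
    obj₂ : Objective n k t D (cells σ aidx) (vars σ₂ vtotal)
    obj₂ = objective (cells σ₁ amin) near (proj₁ selected)
    indices₂ : Indices σ₂
    indices₂ j j<k = subst (_< N) (sym (same aidx refl j)) (indices S j j<k)
    best₂ : BestKnown σ₂
    best₂ with best S
    ... | inj₁ e = inj₁ (trans (sameVar (frame (nearest ∙ select) σ) vopt refl) e)
    ... | inj₂ (lo , obj) = inj₂
      ((λ j j<k → subst (_< N) (sym (same abest refl j)) (lo j j<k)) ,
       subst (Objective n k t D (cells σ₂ abest)) (sym (sameVar (frame (nearest ∙ select) σ) vopt refl))
         (objective-cong (λ j _ → sym (same abest refl j)) obj))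
    recorded : BestKnown σ₃ × vars σ₃ vopt ≤ vars σ₂ vtotal × vars σ₃ vopt ≤ vars σ₂ vopt
    recorded = record-spec σ₂ indices₂ (objective-cong (λ j _ → sym (same aidx refl j)) obj₂) best₂
    indices₃ : Indices σ₃
    indices₃ j j<k = subst (_< N) (sym (sameCells (frame record′ σ₂) aidx refl j)) (indices₂ j j<k)
    incremented : Indices σ₄ × vars σ₄ vcarry ≤ 1 ×
      num N k (cells σ₄ aidx) + vars σ₄ vcarry * N ^ k ≡ num N k (cells σ₃ aidx) + 1
    incremented = increment-spec σ₃ indices₃
    opt₄ : vars σ₄ vopt ≡ vars σ₃ vopt
    opt₄ = sameVar (frame increment σ₃) vopt refl
    transfer : BestKnown σ₃ → BestKnown σ₄
    transfer (inj₁ e) = inj₁ (trans opt₄ e)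
    transfer (inj₂ (lo , obj)) = inj₂
      ((λ j j<k → subst (_< N) (sym (sameCells (frame increment σ₃) abest refl j)) (lo j j<k)) ,
       subst (Objective n k t D (cells σ₄ abest)) (sym opt₄)
         (objective-cong (λ j _ → sym (sameCells (frame increment σ₃) abest refl j)) obj))
    covered : Covered (suc (num N k (cells σ aidx))) σ₄
    covered e e< lo with m<1+n⇒m<n∨m≡n lo
    ... | inj₁ lo′ = earlier (cov e e< lo′)
      where
      earlier : (∃[ v ] Objective n k t D e v × vars σ vopt ≤ v × v ≤ n * d) →
                ∃[ v ] Objective n k t D e v × vars σ₄ vopt ≤ v × v ≤ n * d
      earlier (v , obj , le , le′) = v , obj , ≤-trans (≤-trans (≤-reflexive opt₄)
        (≤-trans (proj₂ (proj₂ recorded))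
          (≤-reflexive (sameVar (frame (nearest ∙ select) σ) vopt refl)))) le , le′
    ... | inj₂ eq = vars σ₂ vtotal ,
      objective-cong (λ j j<k → sym (num-injective k e< (indices S) eq j j<k)) obj₂ ,
      ≤-trans (≤-reflexive opt₄) (proj₁ (proj₂ recorded)) ,
      ≤-trans (≤-reflexive (proj₁ selected)) (proj₂ selected)

  deliver-spec : ∀ σ → ∀ j → j < k → ∀ a → a < d →
    tape (⟦ deliver ⟧ σ) (j * d + a) ≡ cells σ acand (cells σ abest j * d + a)
  deliver-spec σ = proj₂ (for-each vj 2 row σ (λ _ → ⊤) Row tt outer)
    where
    entry row : Cmd
    entry = output (var vj ⊗ cd ⊕ var va) (get acand (get abest (var vj) ⊗ cd ⊕ var va))
    row = for va 1 entry
    Row : ℕ → Store → Set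
    Row j τ = ∀ a → a < d → tape τ (j * d + a) ≡ cells σ acand (cells σ abest j * d + a)
    outer : ∀ j τ → j < k → Frame (for vj 2 row) σ τ → ⊤ →
      ⊤ × Row j (⟦ row ⟧ (set vj j τ)) ×
      (∀ j′ → j < j′ → j′ < k → Row j′ τ → Row j′ (⟦ row ⟧ (set vj j τ)))
    outer j τ j<k F _ = tt , proj₂ written , λ j′ j<j′ _ h a a<d →
      trans (proj₁ written _ λ b b<d e → <⇒≢ j<j′ (proj₁ (lex-injective b<d a<d e))) (h a a<d)
      where
      Off : Store → Set
      Off υ = ∀ u → (∀ a → a < d → j * d + a ≢ u) → tape υ u ≡ tape τ u
      Hit : ℕ → Store → Set
      Hit a υ = tape υ (j * d + a) ≡ cells σ acand (cells σ abest j * d + a)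
      inner : ∀ a υ → a < d → Frame row (set vj j τ) υ → Off υ →
        Off (⟦ entry ⟧ (set va a υ)) × Hit a (⟦ entry ⟧ (set va a υ)) ×
        (∀ a′ → a < a′ → a′ < d → Hit a′ υ → Hit a′ (⟦ entry ⟧ (set va a υ)))
      inner a υ a<d G inv =
        (λ u off → trans (upd-other (tape υ) _ u _ (subst (_≢ u) (sym at) (off a a<d))) (inv u off)) ,
        trans (upd-hit (tape υ) _ at) value ,
        λ a′ a<a′ _ h → trans (upd-other (tape υ) _ _ _ λ e →
          <⇒≢ a<a′ (+-cancelˡ-≡ (j * d) a a′ (trans (sym at) e))) h
        where
        vj≡ : vars υ vj ≡ j
        vj≡ = sameVar G vj refl
        at : apply mod (vars υ vj * d + a) (n * d) ≡ j * d + a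
        at = trans (cong (λ m → apply mod (m * d + a) (n * d)) vj≡)
          (mod-id (row-bound (<-≤-trans j<k k≤n) a<d))
        value : cells υ acand (cells υ abest (vars υ vj) * d + a) ≡
                cells σ acand (cells σ abest j * d + a)
        value = trans (cong (λ m → cells υ acand (m * d + a)) (trans (cong (cells υ abest) vj≡)
            (trans (sameCells G abest refl j) (sameCells F abest refl j))))
          (trans (sameCells G acand refl _) (sameCells F acand refl _))
      written : Off (⟦ row ⟧ (set vj j τ)) × Row j (⟦ row ⟧ (set vj j τ))
      written = for-each va 1 entry (set vj j τ) Off Hit (λ _ _ → refl) inner

-- The ceiling of (1 - p) n for p = num / den; adding den - 1 before the division rounds up.
threshold : (n num den : ℕ) → ℕ
threshold n num den = apply div ((den ∸ num) * n + (den ∸ 1)) den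

-- A complete run of the algorithm

module Execution
  (n d k num′ den : ℕ) (1≤n : 1 ≤ n) (1≤d : 1 ≤ d) (1≤k : 1 ≤ k) (k<n : k < n)
  (w M : ℕ) (2≤M : 2 ≤ M) (fit : M ^ wordExponent ≤ 2 ^ w) where

  t : ℕ
  t = threshold n num′ den

  open Verify n d k num′ den t
  open Semantics κ
  open Simulation κ w M 2≤M fit
  open Small
  open Represents

  N : ℕ
  N = n ^ 5

  1≤nd : 1 ≤ n * d
  1≤nd = *-mono-≤ 1≤n 1≤d

  assign-exact : ∀ {s} r e → Small s → T (fits e) → T (deg e ≤ᵇ rdeg r) →
    Run w (r ≔ e) s (1 + cost e) (state (register s [ r ↦ evalℕ s e ]) (memory s)) ×
    Small (state (register s [ r ↦ evalℕ s e ]) (memory s))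
  assign-exact {s} r e S h h′ =
    subst (λ v → Run w (r ≔ e) s (1 + cost e) (state (register s [ r ↦ v ]) (memory s)))
      (eval-exact S e h) assign ,
    record { smallReg = small-upd 1≤nd (register s) (λ r → M ^ rdeg r) r (evalℕ s e) (smallReg S)
               (≤-trans (evalℕ-bound S e) (^-monoʳ-≤ M (≤ᵇ⇒≤ (deg e) (rdeg r) h′)))
           ; smallMem = smallMem S }

  record Initial (s : State) : Set where
    field
      small : Small s
      reg0  : register s 0 ≡ n
      reg1  : register s 1 ≡ d
      reg2  : register s 2 ≡ k
      reg3  : register s 3 ≡ num′
      reg4  : register s 4 ≡ den
      reg9  : register s 9 ≡ 0
      blank : ∀ a → n * d ≤ a → memory s a ≡ 0
  open Initial

  storeOf : State → Store
  storeOf s = ⟪ (λ x → register s (10 + x)) , (λ A i → memory s (n * d + (16 * i + A))) , memory s ⟫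

  setupTime : ℕ
  setupTime = 30

  setup-run : ∀ s → Initial s → ∃[ s′ ] Run w setup s setupTime s′ × Small s′ ×
              Represents (storeOf s) s′
  setup-run s I = s₄ , seq (proj₁ a₁) (seq (proj₁ a₂) (seq (proj₁ a₃) (proj₁ a₄))) , proj₂ a₄ ,
    record { constant = const ; variable′ = λ _ → refl ; array = λ _ _ _ → refl ; tape≡ = λ _ _ → refl }
    where
    e₁ e₂ e₃ e₄ : Expr
    e₁ = binary mul (reg 0) (reg 1)
    e₂ = binary mul (reg 0) (binary mul (reg 0) (binary mul (reg 0) (binary mul (reg 0) (reg 0))))
    e₃ = binary add (reg 5) (lit 1)
    e₄ = binary div (binary add (binary mul (binary sub (reg 4) (reg 3)) (reg 0))
                                (binary sub (reg 4) (lit 1))) (reg 4)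
    s₁ s₂ s₃ s₄ : State
    s₁ = state (register s [ 5 ↦ evalℕ s e₁ ]) (memory s)
    s₂ = state (register s₁ [ 6 ↦ evalℕ s₁ e₂ ]) (memory s)
    s₃ = state (register s₂ [ 7 ↦ evalℕ s₂ e₃ ]) (memory s)
    s₄ = state (register s₃ [ 8 ↦ evalℕ s₃ e₄ ]) (memory s)
    a₁ = assign-exact 5 e₁ (small I) tt tt
    a₂ = assign-exact 6 e₂ (proj₂ a₁) tt tt
    a₃ = assign-exact 7 e₃ (proj₂ a₂) tt tt
    a₄ = assign-exact 8 e₄ (proj₂ a₃) tt tt
    const : ∀ r → r < 10 → register s₄ r ≡ κ r
    const 0 _ = reg0 I
    const 1 _ = reg1 I
    const 2 _ = reg2 I
    const 3 _ = reg3 I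
    const 4 _ = reg4 I
    const 5 _ = cong₂ _*_ (reg0 I) (reg1 I)
    const 6 _ = trans (cong (λ m → m * (m * (m * (m * m)))) (reg0 I))
      (cong (λ m → n * (n * (n * (n * m)))) (sym (*-identityʳ n)))
    const 7 _ = cong (_+ 1) (cong₂ _*_ (reg0 I) (reg1 I))
    const 8 _ rewrite reg4 I | reg3 I | reg0 I = refl
    const 9 _ = reg9 I
    const (suc (suc (suc (suc (suc (suc (suc (suc (suc (suc r))))))))))
      (s≤s (s≤s (s≤s (s≤s (s≤s (s≤s (s≤s (s≤s (s≤s (s≤s ()))))))))))

  module Enumeration (Tr : ℕ) (hr : time round ≤ Tr) (D : ℕ → ℕ → ℕ) (D≤d : ∀ c i → c < N → i < n → D c i ≤ d) where
    open Rounds n d k num′ den t 1≤n 1≤d 1≤k (<⇒≤ k<n) D D≤d hiding (N)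

    continue-value : ∀ {σ s} → Small s → Represents σ s →
      eval w s (binary lt (reg 20) (lit 1)) ≡ ι (vars σ vcarry <ᵇ 1)
    continue-value S R = trans (eval-exact S (binary lt (reg 20) (lit 1)) tt)
      (cong (λ c → ι (c <ᵇ 1)) (variable′ R vcarry))

    -- `fuel` bounds the number of tuples still to be visited. It cannot be used up before the carry
    -- appears, because the number of a tuple is always below `N ^ k`.
    enumerate-run : ∀ fuel {σ s} → Small s → Represents σ s → Sound σ →
      Covered (num N k (cells σ aidx)) σ → vars σ vcarry ≡ 0 → N ^ k ≤ fuel + num N k (cells σ aidx) →
      ∃[ b ] ∃[ s′ ] ∃[ τ ] Run w enumerate s b s′ × b ≤ fuel * (4 + Tr) + 4 ×
        Small s′ × Represents τ s′ × Sound τ × Covered (N ^ k) τ ×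
        (∀ u → cells τ acand u ≡ cells σ acand u)
    enumerate-run zero {σ} S R snd cov c≡0 le =
      contradiction (num-< k (Sound.indices snd)) (≤⇒≯ le)
    enumerate-run (suc fuel) {σ} {s} S R snd cov c≡0 le = go (vars τ vcarry) refl (proj₁ (proj₂ (proj₂ spec)))
      where
      τ : Store
      τ = ⟦ round ⟧ σ
      Goal : Set
      Goal = ∃[ b ] ∃[ s′ ] ∃[ υ ] Run w enumerate s b s′ × b ≤ suc fuel * (4 + Tr) + 4 ×
        Small s′ × Represents υ s′ × Sound υ × Covered (N ^ k) υ ×
        (∀ u → cells υ acand u ≡ cells σ acand u)
      m : ℕ
      m = num N k (cells σ aidx)
      spec : Sound τ × Covered (suc m) τ × vars τ vcarry ≤ 1 ×
        num N k (cells τ aidx) + vars τ vcarry * N ^ k ≡ m + 1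
      spec = round-spec σ snd cov
      ran : Simulates 1≤nd (compile round) Tr s τ
      ran = loosen (simulate 1≤nd round round-check S R)
        where
        loosen : Simulates 1≤nd (compile round) (time round) s τ → Simulates 1≤nd (compile round) Tr s τ
        loosen (b , s₁ , r₁ , b₁ , rest) = b , s₁ , r₁ , ≤-trans b₁ hr , rest
      running : eval w s (binary lt (reg 20) (lit 1)) ≢ 0
      running z = contradiction (trans (sym (trans (continue-value S R)
        (cong (λ c → ι (c <ᵇ 1)) c≡0))) z) λ ()
      cand≡ : ∀ u → cells τ acand u ≡ cells σ acand u
      cand≡ = sameCells (frame round σ) acand refl
      widen : ∀ {m m′ υ} → m′ ≤ m → Covered m υ → Covered m′ υ
      widen le cov e e< lo = cov e e< (<-≤-trans lo le)
      bound : ∀ {b b′ f} → b ≤ Tr → b′ ≤ f * (4 + Tr) + 4 →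
              1 + (3 + (b + b′)) ≤ suc f * (4 + Tr) + 4
      bound {f = f} le le′ = ≤-trans (+-monoʳ-≤ 4 (+-mono-≤ le le′))
        (≤-reflexive (sym (+-assoc (4 + Tr) (f * (4 + Tr)) 4)))
      next≡ : vars τ vcarry ≡ 0 → num N k (cells τ aidx) ≡ suc m
      next≡ h = trans (sym (+-identityʳ _)) (trans
        (cong (λ c → num N k (cells τ aidx) + c * N ^ k) (sym h))
        (trans (proj₂ (proj₂ (proj₂ spec))) (+-comm m 1)))
      last : vars τ vcarry ≡ 1 → Simulates 1≤nd (compile round) Tr s τ → Goal
      last c≡1 (_ , s₁ , r₁ , b₁ , S₁ , R₁) =
        _ , s₁ , τ , while-step running r₁ (while-done (trans (continue-value S₁ R₁)
            (cong (λ c → ι (c <ᵇ 1)) c≡1))) ,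
        bound {b′ = 4} {f = fuel} b₁ (m≤n+m 4 (fuel * (4 + Tr))) , S₁ , R₁ , proj₁ spec ,
        widen {υ = τ} all (proj₁ (proj₂ spec)) , cand≡
        where
        all : N ^ k ≤ suc m
        -- A carry contributes `N ^ k` to the value m + 1, so the numbers up to m, all covered by
        -- now, include every tuple.
        all = ≤-trans (≤-reflexive (sym (*-identityˡ (N ^ k)))) (≤-trans (m≤n+m _ (num N k (cells τ aidx)))
          (≤-reflexive (trans (trans (cong (λ c → num N k (cells τ aidx) + c * N ^ k) (sym c≡1))
            (proj₂ (proj₂ (proj₂ spec)))) (+-comm m 1))))
      After : State → Set
      After s₁ = ∃[ b ] ∃[ s′ ] ∃[ υ ] Run w enumerate s₁ b s′ × b ≤ fuel * (4 + Tr) + 4 ×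
        Small s′ × Represents υ s′ × Sound υ × Covered (N ^ k) υ ×
        (∀ u → cells υ acand u ≡ cells τ acand u)
      prepend : ∀ {b₁ s₁} → Run w (compile round) s b₁ s₁ → b₁ ≤ Tr → After s₁ → Goal
      prepend r₁ b₁ (_ , s₂ , υ , r₂ , b₂ , S₂ , R₂ , snd₂ , cov₂ , same) =
        _ , s₂ , υ , while-step running r₁ r₂ , bound {f = fuel} b₁ b₂ , S₂ , R₂ , snd₂ , cov₂ ,
        λ u → trans (same u) (cand≡ u)
      next : vars τ vcarry ≡ 0 → Simulates 1≤nd (compile round) Tr s τ → Goal
      next c≡0′ (_ , s₁ , r₁ , b₁ , S₁ , R₁) = prepend r₁ b₁
        (enumerate-run fuel S₁ R₁ (proj₁ spec)
          (subst (λ m → Covered m τ) (sym (next≡ c≡0′)) (proj₁ (proj₂ spec))) c≡0′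
          (≤-trans le (≤-reflexive (trans (sym (+-suc fuel m)) (cong (fuel +_) (sym (next≡ c≡0′)))))))
      go : ∀ c → vars τ vcarry ≡ c → c ≤ 1 → Goal
      go zero          c≡ _ = next c≡ ran
      go (suc zero)    c≡ _ = last c≡ ran
      go (suc (suc _)) _  (s≤s ())

  module _ (S x : ℕ → ℕ → ℕ)
           (bS : ∀ i → i < n → Bounded d (S i)) (bx : ∀ i → i < n → Bounded d (x i))
           (Sx : ∀ i → i < n → ∀ a → a < d → S i (x i a) ≡ a)
           (xS : ∀ i → i < n → ∀ j → j < d → x i (S i j) ≡ j)
           (Tp Tr Td : ℕ) (hp : time prepare ≤ Tp) (hr : time round ≤ Tr) (hd : time deliver ≤ Td) where

    open Measuring n d k num′ den t 1≤n

    mjAt : ℕ → ℕ → ℕ → Bool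
    mjAt = mjOf S x bS bx Sx xS

    record Outcome (s : State) : Set where
      field
        count≡   : register s 0 ≡ k
        base≡    : register s 1 ≡ 0
        cands D  : ℕ → ℕ → ℕ
        e        : ℕ → ℕ
        v        : ℕ
        good     : ∀ c → c < N → Candidate d (mjAt c) (cands c)
        dists    : ∀ c i → c < N → i < n → Dist d (x i) (cands c) (D c i)
        e<N      : ∀ j → j < k → e j < N
        written  : ∀ j a → j < k → a < d → memory s (j * d + cands (e j) a) ≡ a
        obj      : Objective n k t D e v
        optimal  : ∀ f → (∀ j → j < k → f j < N) → ∃[ v′ ] Objective n k t D f v′ × v ≤ v′

    totalTime : ℕ
    totalTime = 1 + (3 + ((setupTime + (Tp + ((N ^ k * (4 + Tr) + 4) + (Td + 4))))))

    module After (s : State) (I : Initial s) (P : Prepared S x bS bx Sx xS (storeOf s) (⟦ prepare ⟧ (storeOf s))) where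
      σ₁ : Store
      σ₁ = ⟦ prepare ⟧ (storeOf s)
      1≤N : 1 ≤ N
      1≤N = m^n>0 n {{>-nonZero 1≤n}} 5
      open Prepared
      D : ℕ → ℕ → ℕ
      D c i = cells σ₁ adist (c * n + i)
      D≤d : ∀ c i → c < N → i < n → D c i ≤ d
      D≤d c i c<N i<n = dist≤ (measured P c c<N i i<n)
      open Enumeration Tr hr D D≤d
      open Rounds n d k num′ den t 1≤n 1≤d 1≤k (<⇒≤ k<n) D D≤d hiding (N)
      -- The enumeration starts at the tuple of zeros without writing it: the memory behind the
      -- input is blank and `prepare` leaves `aidx` alone.
      idx≡0 : ∀ j → cells σ₁ aidx j ≡ 0
      idx≡0 j = trans (idx≡ P j) (blank I _ (m≤m+n (n * d) _))
      sound : Sound σ₁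
      sound = record
        { distances = λ _ _ _ _ → refl
        ; indices   = λ j _ → subst (_< N) (sym (idx≡0 j)) 1≤N
        ; best      = inj₁ (opt≡ P) }
      num-zero : ∀ m → num N m (cells σ₁ aidx) ≡ 0
      num-zero zero    = refl
      num-zero (suc m) = trans (cong₂ (λ a b → a * N + b) (num-zero m) (idx≡0 m)) refl
      covered : Covered (num N k (cells σ₁ aidx)) σ₁
      covered f f<N lo = contradiction (subst (num N k f <_) (num-zero k) lo) λ ()
      ran : ∀ {s₂} → Small s₂ → Represents σ₁ s₂ →
        ∃[ b ] ∃[ s′ ] ∃[ τ ] Run w enumerate s₂ b s′ × b ≤ N ^ k * (4 + Tr) + 4 ×
          Small s′ × Represents τ s′ × Sound τ × Covered (N ^ k) τ ×
          (∀ u → cells τ acand u ≡ cells σ₁ acand u)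
      ran S₂ R₂ = enumerate-run (N ^ k) S₂ R₂ sound covered (carry≡ P) (m≤m+n _ _)
      pick : ∀ {τ s₄} → BestKnown τ → Covered (N ^ k) τ →
        (∀ u → cells τ acand u ≡ cells σ₁ acand u) → Represents (⟦ deliver ⟧ τ) s₄ →
        Outcome (state ((register s₄ [ 0 ↦ register s₄ 2 ]) [ 1 ↦ 0 ]) (memory s₄))
      -- The tuple of zeros has been visited, and its value is at most n d, so the initial n d + 1
      -- cannot have survived.
      pick {τ} (inj₁ none) cov _ _ with v , _ , le , le′ ← cov (λ _ → 0) (λ _ _ → 1≤N)
          (num-< k λ _ _ → 1≤N) =
        contradiction (≤-trans (≤-reflexive (sym none)) (≤-trans le le′)) (<⇒≱ (m<m+n (n * d) (s≤s z≤n)))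
      pick {τ} {s₄} (inj₂ (lo , obj)) cov cand≡ R₄ = record
        { count≡  = constant R₄ 2 (s≤s (s≤s (s≤s z≤n)))
        ; base≡   = refl
        ; cands   = candidates P
        ; D       = D
        ; e       = cells τ abest
        ; v       = vars τ vopt
        ; good    = λ c c<N → Ready.good (ready P c c<N)
        ; dists   = λ c i c<N i<n → measured P c c<N i i<n
        ; e<N     = lo
        ; written = λ j a j<k a<d → trans
            (tape≡ R₄ _ (row-bound (<-trans j<k k<n) (bρ j j<k a a<d)))
            (trans (deliver-spec τ j j<k _ (bρ j j<k a a<d))
              (trans (cand≡ _) (Ready.listed (ready P (cells τ abest j) (lo j j<k)) a a<d)))
        ; obj     = obj
        ; optimal = λ f f<N → let v′ , o , le , _ = cov f f<N (num-< k f<N) in v′ , o , le }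
        where
        bρ : ∀ j → j < k → Bounded d (candidates P (cells τ abest j))
        bρ j j<k = Candidate.bounded (Ready.good (ready P (cells τ abest j) (lo j j<k)))

      outcome : ∀ {τ s₄} → Sound τ → Covered (N ^ k) τ →
        (∀ u → cells τ acand u ≡ cells σ₁ acand u) → Represents (⟦ deliver ⟧ τ) s₄ →
        Outcome (state ((register s₄ [ 0 ↦ register s₄ 2 ]) [ 1 ↦ 0 ]) (memory s₄))
      outcome snd = pick (Sound.best snd)

    module Run-all (s : State) (I : Initial s) (tapeS : ∀ i j → i < n → j < d → memory s (i * d + j) ≡ S i j) where

      σ₁ : Store
      σ₁ = ⟦ prepare ⟧ (storeOf s)

      P : Prepared S x bS bx Sx xS (storeOf s) σ₁
      P = prepare-spec S x bS bx Sx xS (storeOf s) tapeS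

      Result : Set
      Result = ∃[ b ] ∃[ s′ ] Run w algorithm s b s′ × b ≤ totalTime × Outcome s′

      branch : eval w s (binary lt (reg 2) (reg 0)) ≢ 0
      branch z = contradiction (trans (sym value) z) λ ()
        where
        value : eval w s (binary lt (reg 2) (reg 0)) ≡ 1
        value = trans (eval-exact (small I) (binary lt (reg 2) (reg 0)) tt)
          (cong ι (trans (cong₂ _<ᵇ_ (reg2 I) (reg0 I)) (<ᵇ-true k<n)))

      open Rounds n d k num′ den t 1≤n 1≤d 1≤k (<⇒≤ k<n) (After.D s I P) (After.D≤d s I P) hiding (N)

      Enumerated : State → Set
      Enumerated s₂ = ∃[ b ] ∃[ s′ ] ∃[ τ ] Run w enumerate s₂ b s′ × b ≤ N ^ k * (4 + Tr) + 4 ×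
        Small s′ × Represents τ s′ × Sound τ × Covered (N ^ k) τ ×
        (∀ u → cells τ acand u ≡ cells σ₁ acand u)

      last : ∀ {s₁ s₂ s₃ τ b₂ b₃} → Run w setup s setupTime s₁ →
        Run w (compile prepare) s₁ b₂ s₂ → b₂ ≤ time prepare →
        Run w enumerate s₂ b₃ s₃ → b₃ ≤ N ^ k * (4 + Tr) + 4 → Sound τ → Covered (N ^ k) τ →
        (∀ u → cells τ acand u ≡ cells σ₁ acand u) →
        Simulates 1≤nd (compile deliver) (time deliver) s₃ (⟦ deliver ⟧ τ) → Result
      last r₁ r₂ b₂ r₃ b₃ snd cov cand≡ (_ , s₄ , r₄ , b₄ , S₄ , R₄) =
        _ , _ , if-true branch (seq r₁ (seq r₂ (seq r₃ (seq r₄ (seq (proj₁ a₅) (proj₁ a₆)))))) ,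
        +-monoʳ-≤ 4 (+-monoʳ-≤ setupTime (+-mono-≤ (≤-trans b₂ hp)
          (+-mono-≤ b₃ (+-monoˡ-≤ 4 (≤-trans b₄ hd))))) ,
        After.outcome s I P snd cov cand≡ R₄
        where
        a₅ : Run w (0 ≔ reg 2) s₄ 2 (state (register s₄ [ 0 ↦ register s₄ 2 ]) (memory s₄)) ×
             Small (state (register s₄ [ 0 ↦ register s₄ 2 ]) (memory s₄))
        a₅ = assign-exact 0 (reg 2) S₄ tt tt
        a₆ : Run w (1 ≔ lit 0) (state (register s₄ [ 0 ↦ register s₄ 2 ]) (memory s₄)) 2
               (state ((register s₄ [ 0 ↦ register s₄ 2 ]) [ 1 ↦ 0 ]) (memory s₄)) ×
             Small (state ((register s₄ [ 0 ↦ register s₄ 2 ]) [ 1 ↦ 0 ]) (memory s₄))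
        a₆ = assign-exact 1 (lit 0) (proj₂ a₅) tt tt

      third : ∀ {s₁ s₂ b₂} → Run w setup s setupTime s₁ → Run w (compile prepare) s₁ b₂ s₂ →
        b₂ ≤ time prepare → Enumerated s₂ → Result
      third r₁ r₂ b₂ (_ , s₃ , τ , r₃ , b₃ , S₃ , R₃ , snd , cov , cand≡) =
        last r₁ r₂ b₂ r₃ b₃ snd cov cand≡ (simulate 1≤nd deliver deliver-check S₃ R₃)

      second : ∀ {s₁} → Run w setup s setupTime s₁ →
        Simulates 1≤nd (compile prepare) (time prepare) s₁ σ₁ → Result
      second r₁ (_ , s₂ , r₂ , b₂ , S₂ , R₂) = third r₁ r₂ b₂ (After.ran s I P S₂ R₂)

      first : (∃[ s₁ ] Run w setup s setupTime s₁ × Small s₁ × Represents (storeOf s) s₁) → Result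
      first (s₁ , r₁ , S₁ , R₁) = second r₁ (simulate 1≤nd prepare prepare-check S₁ R₁)

    execute : ∀ s → Initial s → (∀ i j → i < n → j < d → memory s (i * d + j) ≡ S i j) →
              ∃[ b ] ∃[ s′ ] Run w algorithm s b s′ × b ≤ totalTime × Outcome s′
    execute s I tapeS = Run-all.first s I tapeS (setup-run s I)

-- The approximation guarantee

-- If every selected i had `count n χ * f i` larger than the total, adding these up over the
-- selected points would exceed the total by a factor. Multiplying by the count avoids division.
average : ∀ n (χ : ℕ → Bool) (f : ℕ → ℕ) → 1 ≤ count n χ →
  ∃[ i ] i < n × χ i ≡ true × count n χ * f i ≤ ∑ n (λ j → ι (χ j) * f j)
average n χ f 1≤s with search n (λ i → χ i ∧ (count n χ * f i <ᵇ suc (∑ n (λ j → ι (χ j) * f j))))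
... | inj₁ (i , i<n , h) with h₁ , h₂ ← ∧-split {χ i} h = i , i<n , h₁ , ≤-pred (<ᵇ-true⁻¹ h₂)
... | inj₂ none = contradiction total (<⇒≱ (m<m+n (s * B) 1≤s))
  where
  s B : ℕ
  s = count n χ
  B = ∑ n (λ j → ι (χ j) * f j)
  pw : ∀ i → i < n → ι (χ i) * suc B ≤ ι (χ i) * (s * f i)
  pw i i<n with χ i | none i i<n
  ... | true  | h = *-monoʳ-≤ 1 (<ᵇ-false⁻¹ h)
  ... | false | _ = z≤n
  total : s * B + s ≤ s * B
  total = begin
    s * B + s                            ≡⟨ trans (+-comm (s * B) s) (sym (*-suc s B)) ⟩
    s * suc B                            ≡⟨ ∑-*ʳ n (suc B) ⟨
    ∑ n (λ i → ι (χ i) * suc B)          ≤⟨ ∑-mono n pw ⟩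
    ∑ n (λ i → ι (χ i) * (s * f i))      ≡⟨ ∑-cong n (λ i _ → swap (ι (χ i)) s (f i)) ⟩
    ∑ n (λ i → s * (ι (χ i) * f i))      ≡⟨ ∑-*ˡ n s ⟩
    s * B                                ∎
    where
    open ≤-Reasoning
    swap : ∀ a b c → a * (b * c) ≡ b * (a * c)
    swap = solve-∀

-- The second elementary symmetric polynomial, nested so that `crowded≤pairs` can treat one variable
-- at a time.
pairs : ℕ → ℕ → ℕ → ℕ → ℕ → ℕ
pairs a b c e f = a * (b + (c + (e + f))) + (b * (c + (e + f)) + (c * (e + f) + e * f))

crowded : Bool → Bool → Bool → Bool → Bool → Bool
crowded a b c e f = 1 <ᵇ ι a + (ι b + (ι c + (ι e + ι f)))

crowded≤pairs : ∀ a b c e f → ι (crowded a b c e f) ≤ pairs (ι a) (ι b) (ι c) (ι e) (ι f)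
crowded≤pairs a b c e f = step a (step b (step c (last e f)))
  where
  step : ∀ {s p} x → ι (1 <ᵇ s) ≤ p → ι (1 <ᵇ ι x + s) ≤ ι x * s + p
  step         false h = h
  step {zero}  true  h = z≤n
  step {suc s} true  h = s≤s z≤n
  last : ∀ x y → ι (1 <ᵇ ι x + ι y) ≤ ι x * ι y
  last true  true  = ≤-refl
  last true  false = z≤n
  last false true  = z≤n
  last false false = z≤n

-- This is where the number five comes from. At an uncrowded symbol at most one point deviates from
-- y, so two such symbols spoil at most two votes; five is the least number of voters for which the
-- remaining votes are a majority.
majority-right : ∀ {d q₁ q₂ q₃ q₄ q₅ y} {I₁ I₂ I₃ I₄ I₅ : ℕ → Bool} →
  Agree d I₁ y q₁ → Agree d I₂ y q₂ → Agree d I₃ y q₃ → Agree d I₄ y q₄ → Agree d I₅ y q₅ →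
  ∀ a b → a < d → b < d → crowded (I₁ a) (I₂ a) (I₃ a) (I₄ a) (I₅ a) ≡ false →
  crowded (I₁ b) (I₂ b) (I₃ b) (I₄ b) (I₅ b) ≡ false → y a < y b →
  majorityᵇ q₁ q₂ q₃ q₄ q₅ a b ≡ true
majority-right {d} {q₁} {q₂} {q₃} {q₄} {q₅} {y} {I₁} {I₂} {I₃} {I₄} {I₅} g₁ g₂ g₃ g₄ g₅ a b a<d b<d ha hb lo =
  <ᵇ-true {2} {tally q₁ q₂ q₃ q₄ q₅ a b} (+-cancelʳ-≤ 2 3 _ (begin
    5 ≤⟨ +-mono-≤ (+-mono-≤ (+-mono-≤ (+-mono-≤ (v g₁) (v g₂)) (v g₃)) (v g₄)) (v g₅) ⟩
    (v₁ + (ι (I₁ a) + ι (I₁ b))) + (v₂ + (ι (I₂ a) + ι (I₂ b))) + (v₃ + (ι (I₃ a) + ι (I₃ b)))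
      + (v₄ + (ι (I₄ a) + ι (I₄ b))) + (v₅ + (ι (I₅ a) + ι (I₅ b)))
      ≡⟨ regroup v₁ v₂ v₃ v₄ v₅ (ι (I₁ a)) (ι (I₂ a)) (ι (I₃ a)) (ι (I₄ a)) (ι (I₅ a))
           (ι (I₁ b)) (ι (I₂ b)) (ι (I₃ b)) (ι (I₄ b)) (ι (I₅ b)) ⟩
    tally q₁ q₂ q₃ q₄ q₅ a b + ((ι (I₁ a) + (ι (I₂ a) + (ι (I₃ a) + (ι (I₄ a) + ι (I₅ a))))) +
      (ι (I₁ b) + (ι (I₂ b) + (ι (I₃ b) + (ι (I₄ b) + ι (I₅ b))))))
      ≤⟨ +-monoʳ-≤ (tally q₁ q₂ q₃ q₄ q₅ a b)
           (+-mono-≤ (<ᵇ-false⁻¹ {1} {Σ₁} ha) (<ᵇ-false⁻¹ {1} {Σ₂} hb)) ⟩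
    tally q₁ q₂ q₃ q₄ q₅ a b + 2 ∎))
  where
  open ≤-Reasoning
  v₁ v₂ v₃ v₄ v₅ Σ₁ Σ₂ : ℕ
  v₁ = ι (q₁ a <ᵇ q₁ b)
  v₂ = ι (q₂ a <ᵇ q₂ b)
  v₃ = ι (q₃ a <ᵇ q₃ b)
  v₄ = ι (q₄ a <ᵇ q₄ b)
  v₅ = ι (q₅ a <ᵇ q₅ b)
  Σ₁ = ι (I₁ a) + (ι (I₂ a) + (ι (I₃ a) + (ι (I₄ a) + ι (I₅ a))))
  Σ₂ = ι (I₁ b) + (ι (I₂ b) + (ι (I₃ b) + (ι (I₄ b) + ι (I₅ b))))
  v : ∀ {q I} → Agree d I y q → 1 ≤ ι (q a <ᵇ q b) + (ι (I a) + ι (I b))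
  v {q} {I} g with I a in Ia | I b in Ib
  ... | true  | _     = ≤-trans (s≤s z≤n) (m≤n+m _ (ι (q a <ᵇ q b)))
  ... | false | true  = m≤n+m 1 (ι (q a <ᵇ q b))
  ... | false | false rewrite <ᵇ-true (g a b a<d b<d Ia Ib lo) = ≤-refl
  regroup : ∀ a b c e f a′ b′ c′ e′ f′ a″ b″ c″ e″ f″ →
    (a + (a′ + a″)) + (b + (b′ + b″)) + (c + (c′ + c″)) + (e + (e′ + e″)) + (f + (f′ + f″)) ≡
    (a + b + c + e + f) + ((a′ + (b′ + (c′ + (e′ + f′)))) + (a″ + (b″ + (c″ + (e″ + f″)))))
  regroup = solve-∀

-- The ratio is G / K, with K = 1000, L = 999 and G = 1999 in the end; the arguments use only the
-- three relations assumed here. The slack 120 is 4 times 30: the factor lost by a candidate times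
-- the constant of `five`.
module Approximation
  (n d N : ℕ) (x : ℕ → ℕ → ℕ) (ix : ∀ i → i < n → Inj d (x i))
  (cands D : ℕ → ℕ → ℕ)
  (dists : ∀ c i → c < N → i < n → Dist d (x i) (cands c) (D c i))
  (iρ : ∀ c → c < N → Inj d (cands c))
  (tuple : ∀ i₁ i₂ i₃ i₄ i₅ → i₁ < n → i₂ < n → i₃ < n → i₄ < n → i₅ < n →
    ∃[ c ] c < N × Candidate d (majorityᵇ (x i₁) (x i₂) (x i₃) (x i₄) (x i₅)) (cands c))
  (1≤n : 1 ≤ n) (K L G : ℕ) (K≡1+L : K ≡ 1 + L) (G≡L+K : G ≡ L + K) (120≤L : 120 ≤ L) where

  module Cluster (χ : ℕ → Bool) (y : ℕ → ℕ) (iy : Inj d y) (δ : ℕ → ℕ) (I : ℕ → ℕ → Bool)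
    (agree : ∀ i → i < n → Agree d (I i) (x i) y) (size≡ : ∀ i → i < n → count d (I i) ≡ δ i) where

    s W : ℕ
    s = count n χ
    W = ∑ n λ i → ι (χ i) * δ i

    g : ℕ → ℕ → ℕ
    g i j = ∑ d λ a → ι (I i a) * ι (I j a)

    R : ℕ → ℕ
    R i = ∑ n λ j → ι (χ j) * g i j

    X : ℕ
    X = ∑ n λ i → ι (χ i) * R i

    cost′ : ℕ → ℕ
    cost′ c = ∑ n λ i → ι (χ i) * D c i

    Solved : Set
    Solved = ∃[ c ] c < N × K * cost′ c ≤ G * W

    reverse : ∀ i → i < n → Agree d (I i) y (x i)
    reverse i i<n = agree-sym (ix i i<n) (agree i i<n)

    D-bound : ∀ {A} c i → c < N → i < n → Agree d A (cands c) y →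
              D c i ≤ count d (λ a → A a ∨ I i a)
    D-bound c i c<N i<n h = minimal (dists c i c<N i<n) _
      (agree-sym (iρ c c<N) (agree-trans h (reverse i i<n)))

    same : ∀ {i} → Agree d (λ _ → false) (x i) (x i)
    same _ _ _ _ _ _ lo = lo

    empty : ∀ A → count d A ≤ 4 * count d (λ _ → false) → ∀ a → a < d → A a ≡ false
    empty A few a a<d with A a in Aa
    ... | false = refl
    ... | true  = contradiction
      (trans (sym (cong ι Aa)) (∑-≡0 d (n≤0⇒n≡0 (≤-trans few (≤-reflexive (cong (4 *_) (∑-zero d))))) a<d))
      λ ()

    -- Five copies of point i have its own order as majority and no crowded symbol, so the candidate
    -- has exactly this order. Its distance from j is at most the size of the union of `I i` and
    -- `I j`, and inclusion-exclusion brings in the overlap.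
    single : ∀ i → i < n → ∃[ c ] c < N × (∀ j → j < n → D c j + g i j ≤ δ i + δ j)
    single i i<n with c , c<N , cand ← tuple i i i i i i<n i<n i<n i<n i<n
      with A , hA , few ← Candidate.close cand (x i) (λ _ → false) (ix i i<n)
        (λ a b a<d b<d _ _ lo → majority-right {d} {y = x i} {λ _ → false} {λ _ → false} {λ _ → false}
          {λ _ → false} {λ _ → false} (same {i}) (same {i}) (same {i}) (same {i}) (same {i}) a b a<d b<d refl refl lo) =
      c , c<N , λ j j<n → begin
        D c j + g i j
          ≤⟨ +-monoˡ-≤ (g i j) (D-bound c j c<N j<n (agree-trans hA (agree i i<n))) ⟩
        count d (λ a → (A a ∨ I i a) ∨ I j a) + g i j
          ≡⟨ cong₂ _+_ (∑-cong d λ a a<d → cong (λ b → ι ((b ∨ I i a) ∨ I j a)) (empty A few a a<d))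
                       (∑-cong d λ a _ → ι-∧ (I i a) (I j a)) ⟩
        count d (λ a → I i a ∨ I j a) + count d (λ a → I i a ∧ I j a)
          ≡⟨ count-∨ d (I i) (I j) ⟩
        count d (I i) + count d (I j)
          ≡⟨ cong₂ _+_ (size≡ i i<n) (size≡ j j<n) ⟩
        δ i + δ j ∎
      where
      open ≤-Reasoning

    weighted : ∀ (f : ℕ → ℕ) i → ∑ n (λ j → ι (χ j) * (f i + f j)) ≡ s * f i + ∑ n (λ j → ι (χ j) * f j)
    weighted f i = trans (∑-cong n λ j _ → *-distribˡ-+ (ι (χ j)) (f i) (f j))
      (trans (∑-+ n) (cong (_+ ∑ n (λ j → ι (χ j) * f j)) (∑-*ʳ n (f i))))

    single-cost : ∀ i c → (∀ j → j < n → D c j + g i j ≤ δ i + δ j) → cost′ c + R i ≤ s * δ i + W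
    single-cost i c h = begin
      cost′ c + R i                                  ≡⟨ ∑-+ n ⟨
      ∑ n (λ j → ι (χ j) * D c j + ι (χ j) * g i j)  ≡⟨ ∑-cong n (λ j _ → *-distribˡ-+ (ι (χ j)) _ _) ⟨
      ∑ n (λ j → ι (χ j) * (D c j + g i j))          ≤⟨ ∑-mono n (λ j j<n → *-monoʳ-≤ (ι (χ j)) (h j j<n)) ⟩
      ∑ n (λ j → ι (χ j) * (δ i + δ j))              ≡⟨ weighted δ i ⟩
      s * δ i + W                                    ∎
      where open ≤-Reasoning

    -- Overlap r lowers the cost bound e + W. If the cost c nevertheless exceeds G W / K, then at
    -- most e - L W / K is left for r.
    expensive : ∀ c r e → G * W < K * c → c + r ≤ e + W → L * W + K * r ≤ K * e
    expensive c r e lo h = +-cancelʳ-≤ (K * W) _ _ (begin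
      L * W + K * r + K * W ≡⟨ regroup L K W r ⟩
      (L + K) * W + K * r   ≡⟨ cong (λ G → G * W + K * r) G≡L+K ⟨
      G * W + K * r         ≤⟨ +-monoˡ-≤ (K * r) (<⇒≤ lo) ⟩
      K * c + K * r         ≡⟨ *-distribˡ-+ K c r ⟨
      K * (c + r)           ≤⟨ *-monoʳ-≤ K h ⟩
      K * (e + W)           ≡⟨ *-distribˡ-+ K e W ⟩
      K * e + K * W         ∎)
      where
      open ≤-Reasoning
      regroup : ∀ L K W r → L * W + K * r + K * W ≡ (L + K) * W + K * r
      regroup = solve-∀

    try : (i : ℕ) → i < n → Solved ⊎ L * W + K * R i ≤ K * (s * δ i)
    try i i<n = decide (single i i<n)
      where
      decide : (∃[ c ] c < N × (∀ j → j < n → D c j + g i j ≤ δ i + δ j)) →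
               Solved ⊎ L * W + K * R i ≤ K * (s * δ i)
      decide (c , c<N , h) with K * cost′ c ≤? G * W
      ... | yes le = inj₁ (c , c<N , le)
      ... | no ¬le = inj₂ (expensive (cost′ c) (R i) (s * δ i) (≰⇒> ¬le) (single-cost i c h))

    try-all : ∀ m → m ≤ n →
      Solved ⊎ (∀ i → i < m → L * W + K * R i ≤ K * (s * δ i))
    try-all zero    _   = inj₂ λ _ ()
    try-all (suc m) m<n = both (try m m<n) (try-all m (<⇒≤ m<n))
      where
      extend′ : L * W + K * R m ≤ K * (s * δ m) → (∀ i → i < m → L * W + K * R i ≤ K * (s * δ i)) →
                ∀ i → i < m ⊎ i ≡ m → L * W + K * R i ≤ K * (s * δ i)
      extend′ h all i (inj₁ i<m)  = all i i<m
      extend′ h all i (inj₂ refl) = h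
      both : Solved ⊎ L * W + K * R m ≤ K * (s * δ m) →
             Solved ⊎ (∀ i → i < m → L * W + K * R i ≤ K * (s * δ i)) →
             Solved ⊎ (∀ i → i < suc m → L * W + K * R i ≤ K * (s * δ i))
      both (inj₁ done) _           = inj₁ done
      both (inj₂ _)    (inj₁ done) = inj₁ done
      both (inj₂ h)    (inj₂ all)  = inj₂ λ i i<1+m → extend′ h all i (m<1+n⇒m<n∨m≡n i<1+m)

    -- Sum the bounds over the points of the cluster. The values δ add up to W, and since K = 1 + L
    -- the terms with L cancel.
    overlap≤ : (∀ i → i < n → L * W + K * R i ≤ K * (s * δ i)) → K * X ≤ s * W
    overlap≤ h = +-cancelˡ-≤ (L * (s * W)) _ _ (begin
      L * (s * W) + K * X
        ≡⟨ cong (_+ K * X) (go₁ L s W) ⟩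
      s * (L * W) + K * X
        ≡⟨ cong₂ _+_ (∑-*ʳ n (L * W)) (trans (∑-cong n (λ i _ → go₂ (ι (χ i)) K (R i))) (∑-*ˡ n K)) ⟨
      ∑ n (λ i → ι (χ i) * (L * W)) + ∑ n (λ i → ι (χ i) * (K * R i))
        ≡⟨ ∑-+ n ⟨
      ∑ n (λ i → ι (χ i) * (L * W) + ι (χ i) * (K * R i))
        ≡⟨ ∑-cong n (λ i _ → *-distribˡ-+ (ι (χ i)) _ _) ⟨
      ∑ n (λ i → ι (χ i) * (L * W + K * R i))
        ≤⟨ ∑-mono n (λ i i<n → *-monoʳ-≤ (ι (χ i)) (h i i<n)) ⟩
      ∑ n (λ i → ι (χ i) * (K * (s * δ i)))
        ≡⟨ ∑-cong n (λ i _ → go₃ K (ι (χ i)) s (δ i)) ⟩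
      ∑ n (λ i → K * s * (ι (χ i) * δ i))
        ≡⟨ ∑-*ˡ n (K * s) ⟩
      K * s * W
        ≡⟨ trans (cong (λ K → K * s * W) K≡1+L) (go₄ L s W) ⟩
      L * (s * W) + s * W ∎)
      where
      open ≤-Reasoning
      go₁ : ∀ L s W → L * (s * W) ≡ s * (L * W)
      go₁ = solve-∀
      go₂ : ∀ a b c → a * (b * c) ≡ b * (a * c)
      go₂ = solve-∀
      go₃ : ∀ K a s c → a * (K * (s * c)) ≡ K * s * (a * c)
      go₃ = solve-∀
      go₄ : ∀ L s W → (1 + L) * s * W ≡ L * (s * W) + s * W
      go₄ = solve-∀

    -- Method of conditional expectations: a point p whose overlap G p with the
    -- points picked before and whose total overlap R p are both small.
    Pick : (ℕ → ℕ) → ℕ → Set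
    Pick G B = ∃[ p ] p < n × s * R p + s * (s * G p) ≤ X + s * B

    pick : 1 ≤ s → ∀ G B → ∑ n (λ i → ι (χ i) * G i) ≡ B → Pick G B
    pick 1≤s G B eq with p , p<n , _ , le ← average n χ (λ i → R i + s * G i) 1≤s =
      p , p<n , (begin
        s * R p + s * (s * G p)                           ≡⟨ *-distribˡ-+ s (R p) (s * G p) ⟨
        s * (R p + s * G p)                               ≤⟨ le ⟩
        ∑ n (λ i → ι (χ i) * (R i + s * G i))             ≡⟨ ∑-cong n (λ i _ → go (ι (χ i)) (R i) s (G i)) ⟩
        ∑ n (λ i → ι (χ i) * R i + s * (ι (χ i) * G i))   ≡⟨ ∑-+ n ⟩
        X + ∑ n (λ i → s * (ι (χ i) * G i))               ≡⟨ cong (X +_) (∑-*ˡ n s) ⟩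
        X + s * ∑ n (λ i → ι (χ i) * G i)                 ≡⟨ cong (λ b → X + s * b) eq ⟩
        X + s * B                                         ∎)
      where
      open ≤-Reasoning
      go : ∀ a r s g → a * (r + s * g) ≡ a * r + s * (a * g)
      go = solve-∀

    g-sum : ∀ (G H : ℕ → ℕ) {B C} → ∑ n (λ i → ι (χ i) * G i) ≡ B → ∑ n (λ i → ι (χ i) * H i) ≡ C →
            ∑ n (λ i → ι (χ i) * (G i + H i)) ≡ B + C
    g-sum G H e f = trans (∑-cong n λ i _ → *-distribˡ-+ (ι (χ i)) (G i) (H i))
      (trans (∑-+ n) (cong₂ _+_ e f))

    pairSum : (p₁ p₂ p₃ p₄ p₅ : ℕ) → ℕ
    pairSum p₁ p₂ p₃ p₄ p₅ =
      g p₁ p₂ + (g p₁ p₃ + g p₂ p₃) + (g p₁ p₄ + (g p₂ p₄ + g p₃ p₄)) +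
        (g p₁ p₅ + (g p₂ p₅ + (g p₃ p₅ + g p₄ p₅)))

    Five : Set
    Five = ∃[ p₁ ] ∃[ p₂ ] ∃[ p₃ ] ∃[ p₄ ] ∃[ p₅ ]
      p₁ < n × p₂ < n × p₃ < n × p₄ < n × p₅ < n × s * (s * pairSum p₁ p₂ p₃ p₄ p₅) ≤ 30 * X

    -- Each pick bounds `s * R p` by X plus the same quantities of the earlier picks, so the bounds
    -- double from X to 16 X. The overlaps with earlier points obey the bounds of the last four
    -- picks, and 2 + 4 + 8 + 16 = 30. The average over all five-tuples would be 10.
    five : 1 ≤ s → Five
    five 1≤s = from₁ (pick 1≤s (λ _ → 0) 0 (trans (∑-cong n λ i _ → *-zeroʳ (ι (χ i))) (∑-zero n)))
      where
      bound : ∀ s X r₁ r₂ r₃ r₄ r₅ m₁ m₂ m₃ m₄ m₅ →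
        s * r₁ + s * (s * m₁) ≤ X + s * 0 → s * r₂ + s * (s * m₂) ≤ X + s * r₁ →
        s * r₃ + s * (s * m₃) ≤ X + s * (r₁ + r₂) → s * r₄ + s * (s * m₄) ≤ X + s * (r₁ + (r₂ + r₃)) →
        s * r₅ + s * (s * m₅) ≤ X + s * (r₁ + (r₂ + (r₃ + r₄))) →
        s * (s * (m₂ + m₃ + m₄ + m₅)) ≤ 30 * X
      bound s X r₁ r₂ r₃ r₄ r₅ m₁ m₂ m₃ m₄ m₅ h₁ h₂ h₃ h₄ h₅ = begin
        s * (s * (m₂ + m₃ + m₄ + m₅))
          ≡⟨ spread s m₂ m₃ m₄ m₅ ⟩
        s * (s * m₂) + s * (s * m₃) + s * (s * m₄) + s * (s * m₅)
          ≤⟨ +-mono-≤ (+-mono-≤ (+-mono-≤ (snd r₂ m₂ b₂) (snd r₃ m₃ b₃)) (snd r₄ m₄ b₄)) (snd r₅ m₅ b₅) ⟩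
        2 * X + 4 * X + 8 * X + 16 * X
          ≡⟨ total X ⟩
        30 * X ∎
        where
        open ≤-Reasoning
        spread : ∀ s a b c e → s * (s * (a + b + c + e)) ≡ s * (s * a) + s * (s * b) + s * (s * c) + s * (s * e)
        spread = solve-∀
        total : ∀ X → 2 * X + 4 * X + 8 * X + 16 * X ≡ 30 * X
        total = solve-∀
        fst : ∀ r m {c} → s * r + s * (s * m) ≤ c → s * r ≤ c
        fst r m = ≤-trans (m≤m+n (s * r) (s * (s * m)))
        snd : ∀ r m {c} → s * r + s * (s * m) ≤ c → s * (s * m) ≤ c
        snd r m = ≤-trans (m≤n+m (s * (s * m)) (s * r))
        b₁ : s * r₁ + s * (s * m₁) ≤ X
        b₁ = ≤-trans h₁ (≤-reflexive (trans (cong (X +_) (*-zeroʳ s)) (+-identityʳ X)))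
        b₂ : s * r₂ + s * (s * m₂) ≤ 2 * X
        b₂ = ≤-trans h₂ (≤-trans (+-monoʳ-≤ X (fst r₁ m₁ b₁)) (≤-reflexive (e₂ X)))
          where
          e₂ : ∀ X → X + X ≡ 2 * X
          e₂ = solve-∀
        b₃ : s * r₃ + s * (s * m₃) ≤ 4 * X
        b₃ = ≤-trans h₃ (≤-trans (+-monoʳ-≤ X (≤-trans (≤-reflexive (*-distribˡ-+ s r₁ r₂))
          (+-mono-≤ (fst r₁ m₁ b₁) (fst r₂ m₂ b₂)))) (≤-reflexive (e₃ X)))
          where
          e₃ : ∀ X → X + (X + 2 * X) ≡ 4 * X
          e₃ = solve-∀
        b₄ : s * r₄ + s * (s * m₄) ≤ 8 * X
        b₄ = ≤-trans h₄ (≤-trans (+-monoʳ-≤ X (≤-trans (≤-reflexive (d₃ s r₁ r₂ r₃))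
          (+-mono-≤ (fst r₁ m₁ b₁) (+-mono-≤ (fst r₂ m₂ b₂) (fst r₃ m₃ b₃))))) (≤-reflexive (e₄ X)))
          where
          d₃ : ∀ s a b c → s * (a + (b + c)) ≡ s * a + (s * b + s * c)
          d₃ = solve-∀
          e₄ : ∀ X → X + (X + (2 * X + 4 * X)) ≡ 8 * X
          e₄ = solve-∀
        b₅ : s * r₅ + s * (s * m₅) ≤ 16 * X
        b₅ = ≤-trans h₅ (≤-trans (+-monoʳ-≤ X (≤-trans (≤-reflexive (d₄ s r₁ r₂ r₃ r₄))
          (+-mono-≤ (fst r₁ m₁ b₁) (+-mono-≤ (fst r₂ m₂ b₂) (+-mono-≤ (fst r₃ m₃ b₃) (fst r₄ m₄ b₄)))))) (≤-reflexive (e₅ X)))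
          where
          d₄ : ∀ s a b c e → s * (a + (b + (c + e))) ≡ s * a + (s * b + (s * c + s * e))
          d₄ = solve-∀
          e₅ : ∀ X → X + (X + (2 * X + (4 * X + 8 * X))) ≡ 16 * X
          e₅ = solve-∀
      from₅ : ∀ p₁ p₂ p₃ p₄ → p₁ < n → p₂ < n → p₃ < n → p₄ < n →
        s * R p₁ + s * (s * 0) ≤ X + s * 0 → s * R p₂ + s * (s * g p₁ p₂) ≤ X + s * R p₁ →
        s * R p₃ + s * (s * (g p₁ p₃ + g p₂ p₃)) ≤ X + s * (R p₁ + R p₂) →
        s * R p₄ + s * (s * (g p₁ p₄ + (g p₂ p₄ + g p₃ p₄))) ≤ X + s * (R p₁ + (R p₂ + R p₃)) →
        Pick (λ i → g p₁ i + (g p₂ i + (g p₃ i + g p₄ i))) (R p₁ + (R p₂ + (R p₃ + R p₄))) → Five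
      from₅ p₁ p₂ p₃ p₄ l₁ l₂ l₃ l₄ h₁ h₂ h₃ h₄ (p₅ , l₅ , h₅) =
        p₁ , p₂ , p₃ , p₄ , p₅ , l₁ , l₂ , l₃ , l₄ , l₅ ,
        bound s X (R p₁) (R p₂) (R p₃) (R p₄) (R p₅) 0 (g p₁ p₂) (g p₁ p₃ + g p₂ p₃)
          (g p₁ p₄ + (g p₂ p₄ + g p₃ p₄)) (g p₁ p₅ + (g p₂ p₅ + (g p₃ p₅ + g p₄ p₅))) h₁ h₂ h₃ h₄ h₅
      from₄ : ∀ p₁ p₂ p₃ → p₁ < n → p₂ < n → p₃ < n →
        s * R p₁ + s * (s * 0) ≤ X + s * 0 → s * R p₂ + s * (s * g p₁ p₂) ≤ X + s * R p₁ →
        s * R p₃ + s * (s * (g p₁ p₃ + g p₂ p₃)) ≤ X + s * (R p₁ + R p₂) →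
        Pick (λ i → g p₁ i + (g p₂ i + g p₃ i)) (R p₁ + (R p₂ + R p₃)) → Five
      from₄ p₁ p₂ p₃ l₁ l₂ l₃ h₁ h₂ h₃ (p₄ , l₄ , h₄) =
        from₅ p₁ p₂ p₃ p₄ l₁ l₂ l₃ l₄ h₁ h₂ h₃ h₄
          (pick 1≤s (λ i → g p₁ i + (g p₂ i + (g p₃ i + g p₄ i))) (R p₁ + (R p₂ + (R p₃ + R p₄)))
            (g-sum (g p₁) (λ i → g p₂ i + (g p₃ i + g p₄ i)) refl
              (g-sum (g p₂) (λ i → g p₃ i + g p₄ i) refl (g-sum (g p₃) (g p₄) refl refl))))
      from₃ : ∀ p₁ p₂ → p₁ < n → p₂ < n →
        s * R p₁ + s * (s * 0) ≤ X + s * 0 → s * R p₂ + s * (s * g p₁ p₂) ≤ X + s * R p₁ →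
        Pick (λ i → g p₁ i + g p₂ i) (R p₁ + R p₂) → Five
      from₃ p₁ p₂ l₁ l₂ h₁ h₂ (p₃ , l₃ , h₃) = from₄ p₁ p₂ p₃ l₁ l₂ l₃ h₁ h₂ h₃
        (pick 1≤s (λ i → g p₁ i + (g p₂ i + g p₃ i)) (R p₁ + (R p₂ + R p₃))
          (g-sum (g p₁) (λ i → g p₂ i + g p₃ i) refl (g-sum (g p₂) (g p₃) refl refl)))
      from₂ : ∀ p₁ → p₁ < n → s * R p₁ + s * (s * 0) ≤ X + s * 0 → Pick (g p₁) (R p₁) → Five
      from₂ p₁ l₁ h₁ (p₂ , l₂ , h₂) = from₃ p₁ p₂ l₁ l₂ h₁ h₂
        (pick 1≤s (λ i → g p₁ i + g p₂ i) (R p₁ + R p₂) (g-sum (g p₁) (g p₂) refl refl))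
      from₁ : Pick (λ _ → 0) 0 → Five
      from₁ (p₁ , l₁ , h₁) = from₂ p₁ l₁ h₁ (pick 1≤s (g p₁) (R p₁) refl)

    crowd-count : ∀ p₁ p₂ p₃ p₄ p₅ →
      count d (λ a → crowded (I p₁ a) (I p₂ a) (I p₃ a) (I p₄ a) (I p₅ a)) ≤
      pairSum p₁ p₂ p₃ p₄ p₅
    crowd-count p₁ p₂ p₃ p₄ p₅ = ≤-trans
      (∑-mono d λ a _ → ≤-trans (crowded≤pairs (I p₁ a) (I p₂ a) (I p₃ a) (I p₄ a) (I p₅ a))
        (≤-reflexive (expand (ι (I p₁ a)) (ι (I p₂ a)) (ι (I p₃ a)) (ι (I p₄ a)) (ι (I p₅ a)))))
      (≤-reflexive (trans (∑-+ d) (cong₂ _+_ (trans (∑-+ d) (cong₂ _+_ (trans (∑-+ d)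
        (cong (g p₁ p₂ +_) (∑-+ d))) (trans (∑-+ d) (cong (g p₁ p₄ +_) (∑-+ d)))))
        (trans (∑-+ d) (cong (g p₁ p₅ +_) (trans (∑-+ d) (cong (g p₂ p₅ +_) (∑-+ d))))))))
      where
      expand : ∀ a b c e f → pairs a b c e f ≡
        a * b + (a * c + b * c) + (a * e + (b * e + c * e)) + (a * f + (b * f + (c * f + e * f)))
      expand = expand′
        where
        expand′ : ∀ a b c e f →
          a * (b + (c + (e + f))) + (b * (c + (e + f)) + (c * (e + f) + e * f)) ≡
          a * b + (a * c + b * c) + (a * e + (b * e + c * e)) + (a * f + (b * f + (c * f + e * f)))
        expand′ = solve-∀

    -- Combining `s * (s * P) ≤ 30 * X` with `K * X ≤ s * W` and cancelling the positive s gives K s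
    -- P ≤ 30 W. The excess of the cost over W is at most 4 s P.
    reconstructed : 1 ≤ s → K * X ≤ s * W → Solved
    reconstructed 1≤s KX≤ = from-five (five 1≤s)
      where
      finish : ∀ A {P c} → count d A ≤ 4 * P → s * (s * P) ≤ 30 * X →
        (∀ i → i < n → D c i ≤ count d A + δ i) → K * cost′ c ≤ G * W
      finish A {P} {c} small few close = begin
        K * cost′ c                          ≤⟨ *-monoʳ-≤ K cost≤ ⟩
        K * (s * (4 * P) + W)                ≡⟨ go₁ K s P W ⟩
        4 * (K * (s * P)) + K * W         ≤⟨ +-monoˡ-≤ (K * W) (*-monoʳ-≤ 4 sP≤) ⟩
        4 * (30 * W) + K * W                    ≡⟨ cong (_+ K * W) (*-assoc 4 30 W) ⟨
        120 * W + K * W                         ≤⟨ +-monoˡ-≤ (K * W) (*-monoˡ-≤ W 120≤L) ⟩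
        L * W + K * W                           ≡⟨ *-distribʳ-+ W L K ⟨
        (L + K) * W                             ≡⟨ cong (_* W) G≡L+K ⟨
        G * W                                   ∎
        where
        open ≤-Reasoning
        go₁ : ∀ K s P W → K * (s * (4 * P) + W) ≡ 4 * (K * (s * P)) + K * W
        go₁ = solve-∀
        cost≤ : cost′ c ≤ s * (4 * P) + W
        cost≤ = begin
          cost′ c                                                  ≤⟨ ∑-mono n (λ i i<n →
            *-monoʳ-≤ (ι (χ i)) (≤-trans (close i i<n) (+-monoˡ-≤ (δ i) small))) ⟩
          ∑ n (λ i → ι (χ i) * (4 * P + δ i))                      ≡⟨ ∑-cong n (λ i _ →
            *-distribˡ-+ (ι (χ i)) (4 * P) (δ i)) ⟩
          ∑ n (λ i → ι (χ i) * (4 * P) + ι (χ i) * δ i)            ≡⟨ ∑-+ n ⟩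
          ∑ n (λ i → ι (χ i) * (4 * P)) + W                        ≡⟨ cong (_+ W) (∑-*ʳ n (4 * P)) ⟩
          s * (4 * P) + W                                          ∎
        sP≤ : K * (s * P) ≤ 30 * W
        sP≤ = *-cancelˡ-≤ s {{>-nonZero 1≤s}} (begin
          s * (K * (s * P)) ≡⟨ swap s K (s * P) ⟩
          K * (s * (s * P)) ≤⟨ *-monoʳ-≤ K few ⟩
          K * (30 * X)      ≡⟨ swap K 30 X ⟩
          30 * (K * X)      ≤⟨ *-monoʳ-≤ 30 KX≤ ⟩
          30 * (s * W)         ≡⟨ swap 30 s W ⟩
          s * (30 * W)         ∎)
          where
          swap : ∀ a b c → a * (b * c) ≡ b * (a * c)
          swap = solve-∀
      from-tuple : ∀ p₁ p₂ p₃ p₄ p₅ → p₁ < n → p₂ < n → p₃ < n → p₄ < n → p₅ < n →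
        s * (s * pairSum p₁ p₂ p₃ p₄ p₅) ≤ 30 * X →
        (∃[ c ] c < N × Candidate d (majorityᵇ (x p₁) (x p₂) (x p₃) (x p₄) (x p₅)) (cands c)) → Solved
      from-tuple p₁ p₂ p₃ p₄ p₅ l₁ l₂ l₃ l₄ l₅ few (c , c<N , cand) = from-close
        (Candidate.close cand y (λ a → crowded (I p₁ a) (I p₂ a) (I p₃ a) (I p₄ a) (I p₅ a)) iy
          (majority-right {y = y} {I p₁} {I p₂} {I p₃} {I p₄} {I p₅}
            (reverse p₁ l₁) (reverse p₂ l₂) (reverse p₃ l₃) (reverse p₄ l₄) (reverse p₅ l₅)))
        where
        from-close : (∃[ A ] Agree d A (cands c) y ×
          count d A ≤ 4 * count d (λ a → crowded (I p₁ a) (I p₂ a) (I p₃ a) (I p₄ a) (I p₅ a))) → Solved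
        from-close (A , hA , small) =
          c , c<N , finish A {pairSum p₁ p₂ p₃ p₄ p₅} {c}
            (≤-trans small (*-monoʳ-≤ 4 (crowd-count p₁ p₂ p₃ p₄ p₅))) few
            (λ i i<n → ≤-trans (D-bound {A} c i c<N i<n hA) (≤-trans (m≤m+n _ _)
              (≤-reflexive (trans (count-∨ d A (I i)) (cong (count d A +_) (size≡ i i<n))))))
      from-five : Five → Solved
      from-five (p₁ , p₂ , p₃ , p₄ , p₅ , l₁ , l₂ , l₃ , l₄ , l₅ , few) =
        from-tuple p₁ p₂ p₃ p₄ p₅ l₁ l₂ l₃ l₄ l₅ few (tuple p₁ p₂ p₃ p₄ p₅ l₁ l₂ l₃ l₄ l₅)

    solved : Solved
    solved = go (try-all n ≤-refl) s refl
      where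
      go : Solved ⊎ (∀ i → i < n → L * W + K * R i ≤ K * (s * δ i)) → ∀ u → s ≡ u → Solved
      go (inj₁ done) _       _  = done
      go (inj₂ all)  (suc _) eq = reconstructed (subst (1 ≤_) (sym eq) (s≤s z≤n)) (overlap≤ all)
      -- In an empty cluster there is nothing to average over, but every candidate has cost 0.
      go (inj₂ all)  zero    eq = trivial (tuple 0 0 0 0 0 1≤n 1≤n 1≤n 1≤n 1≤n)
        where
        trivial : (∃[ c ] c < N × Candidate d _ (cands c)) → Solved
        trivial (c , c<N , _) = c , c<N ,
          ≤-trans (≤-reflexive (trans (cong (K *_) (trans (∑-cong n λ i i<n →
            cong (_* D c i) (∑-≡0 n eq i<n)) (∑-zero n))) (*-zeroʳ K))) z≤n

  cluster : (χ : ℕ → Bool) (y δ : ℕ → ℕ) → Inj d y → (∀ i → i < n → Dist d (x i) y (δ i)) →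
    ∃[ c ] c < N × K * ∑ n (λ i → ι (χ i) * D c i) ≤ G * ∑ n (λ i → ι (χ i) * δ i)
  cluster χ y δ iy h
    with I , hI ← choice {n} (λ i A → Agree d A (x i) y × count d A ≡ δ i) (λ _ → false)
                    (λ i i<n → deleted (h i i<n)) =
    Cluster.solved χ y iy δ I (λ i i<n → proj₁ (hI i i<n)) (λ i i<n → proj₂ (hI i i<n))

  -- The selected points split into clusters by the median a i that serves them; each cluster gets
  -- its own candidate, and the bounds add up.
  approximate : ∀ k (χ : ℕ → Bool) (y δ : ℕ → ℕ → ℕ) (a : ℕ → ℕ) → (∀ i → i < n → a i < k) →
    (∀ j → j < k → Inj d (y j)) → (∀ i j → i < n → j < k → Dist d (x i) (y j) (δ i j)) →
    ∃[ e ] (∀ j → j < k → e j < N) ×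
      K * ∑ n (λ i → ι (χ i) * D (e (a i)) i) ≤ G * ∑ n (λ i → ι (χ i) * δ i (a i))
  approximate k χ y δ a a<k iy h
    with e , he ← choice {k} (λ j c → c < N ×
        K * ∑ n (λ i → ι (χ i ∧ (j ≡ᵇ a i)) * D c i) ≤ G * ∑ n (λ i → ι (χ i ∧ (j ≡ᵇ a i)) * δ i j)) 0
      (λ j j<k → cluster (λ i → χ i ∧ (j ≡ᵇ a i)) (y j) (λ i → δ i j) (iy j j<k) (λ i i<n → h i j i<n j<k)) =
    e , (λ j j<k → proj₁ (he j j<k)) , (begin
      K * ∑ n (λ i → ι (χ i) * D (e (a i)) i)
        ≡⟨ cong (K *_) (split λ i j → D (e j) i) ⟩
      K * ∑ k (λ j → ∑ n (λ i → ι (χ i ∧ (j ≡ᵇ a i)) * D (e j) i))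
        ≡⟨ ∑-*ˡ k K ⟨
      ∑ k (λ j → K * ∑ n (λ i → ι (χ i ∧ (j ≡ᵇ a i)) * D (e j) i))
        ≤⟨ ∑-mono k (λ j j<k → proj₂ (he j j<k)) ⟩
      ∑ k (λ j → G * ∑ n (λ i → ι (χ i ∧ (j ≡ᵇ a i)) * δ i j))
        ≡⟨ ∑-*ˡ k G ⟩
      G * ∑ k (λ j → ∑ n (λ i → ι (χ i ∧ (j ≡ᵇ a i)) * δ i j))
        ≡⟨ cong (G *_) (split δ) ⟨
      G * ∑ n (λ i → ι (χ i) * δ i (a i)) ∎)
    where
    open ≤-Reasoning
    split : (f : ℕ → ℕ → ℕ) → ∑ n (λ i → ι (χ i) * f i (a i)) ≡
                            ∑ k (λ j → ∑ n (λ i → ι (χ i ∧ (j ≡ᵇ a i)) * f i j))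
    split f = trans (∑-cong n λ i i<n → trans (cong (ι (χ i) *_) (sym (∑-δ k (f i) (a<k i i<n))))
      (trans (sym (∑-*ˡ k (ι (χ i)))) (∑-cong k λ j _ → trans (sym (*-assoc (ι (χ i)) _ (f i j)))
        (cong (_* f i j) (ι-∧ (χ i) (j ≡ᵇ a i)))))) (∑-swap n k _)

-- The Ulam metric: character moves and deleted symbols

∑-head : ∀ m (f : ℕ → ℕ) → ∑ (suc m) f ≡ f 0 + ∑ m (f ∘ suc)
∑-head zero    f = +-comm 0 (f 0)
∑-head (suc m) f = trans (cong (_+ f (suc m)) (∑-head m f)) (+-assoc (f 0) _ _)

punchIn-< : ∀ {n} j {p q : Fin n} → p Fin.< q → punchIn j p Fin.< punchIn j q
punchIn-< j {p} {q} p<q = ≰⇒> λ le → <⇒≱ p<q (Finₚ.punchIn-cancel-≤ j q p le)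

punchIn-<⁻¹ : ∀ {n} j {p q : Fin n} → punchIn j p Fin.< punchIn j q → p Fin.< q
punchIn-<⁻¹ j {p} {q} lo = ≰⇒> λ le → <⇒≱ lo (Finₚ.punchIn-mono-≤ j q p le)

lookup-removeAt : ∀ {B : Set} {n} (xs : Vec B (suc n)) i p →
                  lookup (removeAt xs i) p ≡ lookup xs (punchIn i p)
lookup-removeAt xs i p = trans (cong (lookup (removeAt xs i)) (sym (Finₚ.punchOut-punchIn i)))
  (Vecₚ.removeAt-punchOut xs (Finₚ.punchInᵢ≢i i p ∘ sym))

Preserves : ∀ {B : Set} {n} → (B → Bool) → Vec B n → Vec B n → Set
Preserves bad xs ys = ∀ p q → p Fin.< q → bad (lookup xs p) ≡ false → bad (lookup xs q) ≡ false →
  ∃[ p′ ] ∃[ q′ ] p′ Fin.< q′ × lookup ys p′ ≡ lookup xs p × lookup ys q′ ≡ lookup xs q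

move-preserves : ∀ {B : Set} {n} (bad : B → Bool) (xs : Vec B (suc n)) i j →
  bad (lookup xs i) ≡ true → Preserves bad xs (insertAt (removeAt xs i) j (lookup xs i))
move-preserves bad xs i j hi p q p<q hp hq = goal
  where
  i≢ : ∀ p → bad (lookup xs p) ≡ false → i ≢ p
  i≢ p h refl = contradiction (trans (sym hi) h) λ ()
  low : punchIn i (punchOut (i≢ p hp)) Fin.< punchIn i (punchOut (i≢ q hq))
  low rewrite Finₚ.punchIn-punchOut (i≢ p hp) | Finₚ.punchIn-punchOut (i≢ q hq) = p<q
  at : ∀ p (h : bad (lookup xs p) ≡ false) →
       lookup (insertAt (removeAt xs i) j (lookup xs i)) (punchIn j (punchOut (i≢ p h))) ≡ lookup xs p
  at p h = trans (Vecₚ.insertAt-punchIn (removeAt xs i) j (lookup xs i) (punchOut (i≢ p h)))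
    (Vecₚ.removeAt-punchOut xs (i≢ p h))
  goal : ∃[ p′ ] ∃[ q′ ] p′ Fin.< q′ ×
    lookup (insertAt (removeAt xs i) j (lookup xs i)) p′ ≡ lookup xs p ×
    lookup (insertAt (removeAt xs i) j (lookup xs i)) q′ ≡ lookup xs q
  goal = punchIn j (punchOut (i≢ p hp)) , punchIn j (punchOut (i≢ q hq)) ,
    punchIn-< j (punchIn-<⁻¹ i low) , at p hp , at q hq

-- Declare every moved symbol bad: t moves spoil at most t symbols, and no move changes the order of
-- the symbols that it does not pick up.
moves-preserve : ∀ {d n t} {xs ys : Vec (Fin d) n} → Moves t xs ys →
  ∃[ A ] count d A ≤ t × Preserves (A ∘ toℕ) xs ys
moves-preserve {d} [] = (λ _ → false) , ≤-reflexive (∑-zero d) ,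
  λ p q p<q _ _ → p , q , p<q , refl , refl
moves-preserve {d} (_∷_ {t = t} {ys = ys} {zs = zs} (move xs i j _) ms) = extend′ (moves-preserve ms)
  where
  u : ℕ
  u = toℕ (lookup xs i)
  extend′ : (∃[ A ] count d A ≤ t × Preserves (A ∘ toℕ) ys zs) →
            ∃[ A ] count d A ≤ suc t × Preserves (A ∘ toℕ) xs zs
  extend′ (A , few , pres) = (λ a → (a ≡ᵇ u) ∨ A a) ,
    ≤-trans (≤-trans (m≤m+n _ _) (≤-reflexive (count-∨ d (_≡ᵇ u) A)))
      (+-mono-≤ (≤-reflexive (trans (∑-cong d λ a _ → sym (*-identityʳ _))
        (∑-δ d (λ _ → 1) (Finₚ.toℕ<n (lookup xs i))))) few) ,
    λ p q p<q hp hq → compose p q hp hq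
      (move-preserves (λ b → (toℕ b ≡ᵇ u) ∨ A (toℕ b)) xs i j (cong (_∨ A u) (≡ᵇ-refl u)) p q p<q hp hq)
    where
    compose : ∀ p q → ((toℕ (lookup xs p) ≡ᵇ u) ∨ A (toℕ (lookup xs p))) ≡ false →
      ((toℕ (lookup xs q) ≡ᵇ u) ∨ A (toℕ (lookup xs q))) ≡ false →
      (∃[ p′ ] ∃[ q′ ] p′ Fin.< q′ × lookup ys p′ ≡ lookup xs p × lookup ys q′ ≡ lookup xs q) →
      ∃[ p′ ] ∃[ q′ ] p′ Fin.< q′ × lookup zs p′ ≡ lookup xs p × lookup zs q′ ≡ lookup xs q
    compose p q hp hq (p′ , q′ , lo , ep , eq) = finish
      (pres p′ q′ lo (trans (cong (A ∘ toℕ) ep) (proj₂ (∨-false {toℕ (lookup xs p) ≡ᵇ u} hp)))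
                     (trans (cong (A ∘ toℕ) eq) (proj₂ (∨-false {toℕ (lookup xs q) ≡ᵇ u} hq))))
      where
      finish : (∃[ p″ ] ∃[ q″ ] p″ Fin.< q″ × lookup zs p″ ≡ lookup ys p′ × lookup zs q″ ≡ lookup ys q′) →
        ∃[ p″ ] ∃[ q″ ] p″ Fin.< q″ × lookup zs p″ ≡ lookup xs p × lookup zs q″ ≡ lookup xs q
      finish (p″ , q″ , lo′ , ep′ , eq′) = p″ , q″ , lo′ , trans ep′ ep , trans eq′ eq

moves-cons : ∀ {B : Set} {n t} b {xs ys : Vec B n} → Moves t xs ys → Moves t (b ∷ xs) (b ∷ ys)
moves-cons b []                  = []
moves-cons b (move xs@(_ ∷ _) i j i≢j ∷ ms) =
  move (b ∷ xs) (Fin.suc i) (Fin.suc j) (i≢j ∘ Finₚ.suc-injective) ∷ moves-cons b ms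

moves-snoc : ∀ {B : Set} {n t} {xs ys zs : Vec B n} → Moves t xs ys → Move ys zs → Moves (suc t) xs zs
moves-snoc []       m = m ∷ []
moves-snoc (l ∷ ms) m = l ∷ moves-snoc ms m

countV : ∀ {B : Set} {n} → (B → Bool) → Vec B n → ℕ
countV bad []       = 0
countV bad (x ∷ xs) = ι (bad x) + countV bad xs

countV-remove : ∀ {B : Set} {n} (bad : B → Bool) (xs : Vec B (suc n)) i →
                countV bad xs ≡ ι (bad (lookup xs i)) + countV bad (removeAt xs i)
countV-remove bad (x ∷ xs)         Fin.zero    = refl
countV-remove bad (x ∷ xs@(_ ∷ _)) (Fin.suc i) =
  trans (cong (ι (bad x) +_) (countV-remove bad xs i))
    (swap (ι (bad x)) (ι (bad (lookup xs i))) _)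
  where
  swap : ∀ a b c → a + (b + c) ≡ b + (a + c)
  swap = solve-∀

record Rearranged {B : Set} {n} (bad : B → Bool) (xs ys : Vec B n) : Set where
  field
    distinctˡ : ∀ p q → lookup xs p ≡ lookup xs q → p ≡ q
    distinctʳ : ∀ p q → lookup ys p ≡ lookup ys q → p ≡ q
    right     : ∀ p → ∃[ q ] lookup ys q ≡ lookup xs p
    left      : ∀ q → ∃[ p ] lookup xs p ≡ lookup ys q
    ordered   : ∀ p q p′ q′ → p Fin.< q → bad (lookup xs p) ≡ false → bad (lookup xs q) ≡ false →
                lookup ys p′ ≡ lookup xs p → lookup ys q′ ≡ lookup xs q → p′ Fin.< q′
open Rearranged

remove-both : ∀ {B : Set} {n bad} {xs ys : Vec B (suc n)} → Rearranged bad xs ys → ∀ i j →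
  lookup xs i ≡ lookup ys j → Rearranged bad (removeAt xs i) (removeAt ys j)
remove-both {bad = bad} {xs} {ys} R i j eq = record
  { distinctˡ = λ p q e → Finₚ.punchIn-injective i p q
      (distinctˡ R _ _ (trans (sym (lx p)) (trans e (lx q))))
  ; distinctʳ = λ p q e → Finₚ.punchIn-injective j p q
      (distinctʳ R _ _ (trans (sym (ly p)) (trans e (ly q))))
  ; right     = λ p → rightOf p (right R (punchIn i p))
  ; left      = λ q → leftOf q (left R (punchIn j q))
  ; ordered   = λ p q p′ q′ p<q hp hq ep eq → punchIn-<⁻¹ j
      (ordered R (punchIn i p) (punchIn i q) (punchIn j p′) (punchIn j q′) (punchIn-< i p<q)
        (trans (sym (cong bad (lx p))) hp) (trans (sym (cong bad (lx q))) hq)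
        (trans (sym (ly p′)) (trans ep (lx p))) (trans (sym (ly q′)) (trans eq (lx q)))) }
  where
  lx : ∀ p → lookup (removeAt xs i) p ≡ lookup xs (punchIn i p)
  lx = lookup-removeAt xs i
  ly : ∀ p → lookup (removeAt ys j) p ≡ lookup ys (punchIn j p)
  ly = lookup-removeAt ys j
  rightOf : ∀ p → (∃[ q ] lookup ys q ≡ lookup xs (punchIn i p)) →
            ∃[ q ] lookup (removeAt ys j) q ≡ lookup (removeAt xs i) p
  rightOf p (q , e) = punchOut j≢q , trans (Vecₚ.removeAt-punchOut ys j≢q) (trans e (sym (lx p)))
    where
    j≢q : j ≢ q
    j≢q refl = Finₚ.punchInᵢ≢i i p (distinctˡ R _ _ (trans (sym e) (sym eq)))
  leftOf : ∀ q → (∃[ p ] lookup xs p ≡ lookup ys (punchIn j q)) →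
           ∃[ p ] lookup (removeAt xs i) p ≡ lookup (removeAt ys j) q
  leftOf q (p , e) = punchOut i≢p , trans (Vecₚ.removeAt-punchOut xs i≢p) (trans e (sym (ly q)))
    where
    i≢p : i ≢ p
    i≢p refl = Finₚ.punchInᵢ≢i j q (distinctʳ R _ _ (trans (sym e) eq))

-- Bad symbols are moved to the front of xs, or, since moves are reversible,
-- to the front of ys.
rearrange-moves : ∀ {d n} (bad : Fin d → Bool) (xs ys : Vec (Fin d) n) → Rearranged bad xs ys →
  ∃[ t ] t ≤ countV bad xs × Moves t xs ys
rearrange-moves bad [] [] R = 0 , z≤n , []
rearrange-moves {n = suc n} bad xs@(a ∷ xs′) ys@(b ∷ ys′) R with a Finₚ.≟ b
... | yes refl = same (rearrange-moves bad xs′ ys′ (remove-both R Fin.zero Fin.zero refl))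
  where
  same : (∃[ t ] t ≤ countV bad xs′ × Moves t xs′ ys′) → ∃[ t ] t ≤ countV bad xs × Moves t xs ys
  same (t , le , ms) = t , ≤-trans le (m≤n+m _ (ι (bad a))) , moves-cons a ms
... | no a≢b with bad a in ha | bad b in hb
...   | true | _ = moveʳ (right R Fin.zero)
  where
  moveʳ : (∃[ q ] lookup ys q ≡ a) → ∃[ t ] t ≤ suc (countV bad xs′) × Moves t xs ys
  moveʳ (q , e) = finish (rearrange-moves bad xs′ (removeAt ys q) (remove-both R Fin.zero q (sym e)))
    where
    0≢q : Fin.zero ≢ q
    0≢q refl = a≢b (sym e)
    last : Move (a ∷ removeAt ys q) ys
    last = subst (Move (a ∷ removeAt ys q))
      (trans (cong (insertAt (removeAt ys q) q) (sym e)) (Vecₚ.insertAt-removeAt ys q))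
      (move (a ∷ removeAt ys q) Fin.zero q 0≢q)
    finish : (∃[ t ] t ≤ countV bad xs′ × Moves t xs′ (removeAt ys q)) →
             ∃[ t ] t ≤ suc (countV bad xs′) × Moves t xs ys
    finish (t , le , ms) = suc t , s≤s le , moves-snoc (moves-cons a ms) last
...   | false | true = moveˡ (left R Fin.zero)
  where
  moveˡ : (∃[ p ] lookup xs p ≡ b) → ∃[ t ] t ≤ 0 + countV bad xs′ × Moves t xs ys
  moveˡ (p , e) = finish (rearrange-moves bad (removeAt xs p) ys′ (remove-both R p Fin.zero e))
    where
    p≢0 : p ≢ Fin.zero
    p≢0 refl = a≢b e
    count≡ : countV bad xs′ ≡ suc (countV bad (removeAt xs p))
    count≡ = trans (sym (cong (λ c → ι c + countV bad xs′) ha)) (trans (countV-remove bad xs p)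
      (cong (λ c → ι c + countV bad (removeAt xs p)) (trans (cong bad e) hb)))
    finish : (∃[ t ] t ≤ countV bad (removeAt xs p) × Moves t (removeAt xs p) ys′) →
             ∃[ t ] t ≤ 0 + countV bad xs′ × Moves t xs ys
    finish (t , le , ms) = suc t , ≤-trans (s≤s le) (≤-reflexive (sym count≡)) ,
      subst (λ c → Move xs (c ∷ removeAt xs p)) e (move xs p Fin.zero p≢0) ∷ moves-cons b ms
-- Two different good heads are impossible: a comes before b in xs, while b is the first entry of
-- ys.
...   | false | false = clash (right R Fin.zero) (left R Fin.zero)
  where
  clash : (∃[ q ] lookup ys q ≡ a) → (∃[ p ] lookup xs p ≡ b) →
          ∃[ t ] t ≤ 0 + countV bad xs′ × Moves t xs ys
  clash _             (Fin.zero  , e) = contradiction e a≢b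
  clash (q , e) (Fin.suc p , e′) = contradiction
    (ordered R Fin.zero (Fin.suc p) q Fin.zero (s≤s z≤n) ha (trans (cong bad e′) hb) e (sym e′)) λ ()

-- Functions on finite types as functions on ℕ

family : ∀ {B : Set} {m} → B → (Fin m → B) → ℕ → B
family {m = m} default f a with a <? m
... | yes a<m = f (fromℕ< a<m)
... | no  _   = default

family-toℕ : ∀ {B : Set} {m} (default : B) (f : Fin m → B) i → family default f (toℕ i) ≡ f i
family-toℕ {m = m} default f i with toℕ i <? m
... | yes i<m = cong f (Finₚ.fromℕ<-toℕ i i<m)
... | no  i≮m = contradiction (Finₚ.toℕ<n i) i≮m

onℕ : ∀ {m d} → (Fin m → Fin d) → ℕ → ℕ
onℕ f = family 0 (toℕ ∘ f)

onℕ-toℕ : ∀ {m d} (f : Fin m → Fin d) i → onℕ f (toℕ i) ≡ toℕ (f i)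
onℕ-toℕ f = family-toℕ 0 (toℕ ∘ f)

every : ∀ {m} (P : ℕ → Set) → (∀ (i : Fin m) → P (toℕ i)) → ∀ a → a < m → P a
every P h a a<m = subst P (Finₚ.toℕ-fromℕ< a<m) (h (fromℕ< a<m))

module _ {d : ℕ} (x : Perm d) where

  position symbol : ℕ → ℕ
  position = onℕ (x ⟨$⟩ˡ_)
  symbol   = onℕ (x ⟨$⟩ʳ_)

  position-bounded : Bounded d position
  position-bounded = every (λ a → position a < d) λ i →
    subst (_< d) (sym (onℕ-toℕ (x ⟨$⟩ˡ_) i)) (Finₚ.toℕ<n (x ⟨$⟩ˡ i))

  symbol-bounded : Bounded d symbol
  symbol-bounded = every (λ a → symbol a < d) λ i →
    subst (_< d) (sym (onℕ-toℕ (x ⟨$⟩ʳ_) i)) (Finₚ.toℕ<n (x ⟨$⟩ʳ i))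

  symbol-position : ∀ a → a < d → symbol (position a) ≡ a
  symbol-position = every (λ a → symbol (position a) ≡ a) λ i →
    trans (cong symbol (onℕ-toℕ (x ⟨$⟩ˡ_) i)) (trans (onℕ-toℕ (x ⟨$⟩ʳ_) (x ⟨$⟩ˡ i)) (cong toℕ (inverseʳ x)))

  position-symbol : ∀ j → j < d → position (symbol j) ≡ j
  position-symbol = every (λ j → position (symbol j) ≡ j) λ i →
    trans (cong position (onℕ-toℕ (x ⟨$⟩ʳ_) i)) (trans (onℕ-toℕ (x ⟨$⟩ˡ_) (x ⟨$⟩ʳ i)) (cong toℕ (inverseˡ x)))

  position-injective : Inj d position
  position-injective a b a<d b<d e =
    trans (sym (symbol-position a a<d)) (trans (cong symbol e) (symbol-position b b<d))

  symbol-injective : Inj d symbol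
  symbol-injective a b a<d b<d e =
    trans (sym (position-symbol a a<d)) (trans (cong position e) (position-symbol b b<d))

countV-tabulate : ∀ {d n} (A : ℕ → Bool) (f : Fin n → Fin d) (h : ℕ → ℕ) →
  (∀ i → h (toℕ i) ≡ toℕ (f i)) → countV (A ∘ toℕ) (Vec.tabulate f) ≡ count n (A ∘ h)
countV-tabulate {n = zero}  A f h eq = refl
countV-tabulate {n = suc n} A f h eq = trans
  (cong₂ _+_ (cong (ι ∘ A) (sym (eq Fin.zero)))
    (countV-tabulate A (f ∘ Fin.suc) (h ∘ suc) (eq ∘ Fin.suc)))
  (sym (∑-head n (ι ∘ A ∘ h)))

module _ {d : ℕ} (x y : Perm d) where

  at-x : ∀ p → lookup (sequence x) p ≡ x ⟨$⟩ʳ p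
  at-x = Vecₚ.lookup∘tabulate (x ⟨$⟩ʳ_)
  at-y : ∀ p → lookup (sequence y) p ≡ y ⟨$⟩ʳ p
  at-y = Vecₚ.lookup∘tabulate (y ⟨$⟩ʳ_)

  preserves⇒agree : ∀ A → Preserves (A ∘ toℕ) (sequence x) (sequence y) →
                    Agree d A (position x) (position y)
  preserves⇒agree A pres a b a<d b<d = subst₂ Goal (Finₚ.toℕ-fromℕ< a<d) (Finₚ.toℕ-fromℕ< b<d)
    (goal (fromℕ< a<d) (fromℕ< b<d))
    where
    Goal : ℕ → ℕ → Set
    Goal a b = A a ≡ false → A b ≡ false → position x a < position x b → position y a < position y b
    goal : ∀ i j → Goal (toℕ i) (toℕ j)
    goal i j hi hj lo = found (pres (x ⟨$⟩ˡ i) (x ⟨$⟩ˡ j)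
        (subst₂ _<_ (onℕ-toℕ (x ⟨$⟩ˡ_) i) (onℕ-toℕ (x ⟨$⟩ˡ_) j) lo)
        (trans (cong (A ∘ toℕ) (back i)) hi) (trans (cong (A ∘ toℕ) (back j)) hj))
      where
      back : ∀ i → lookup (sequence x) (x ⟨$⟩ˡ i) ≡ i
      back i = trans (at-x (x ⟨$⟩ˡ i)) (inverseʳ x)
      pos-y : ∀ i p → lookup (sequence y) p ≡ lookup (sequence x) (x ⟨$⟩ˡ i) → toℕ p ≡ position y (toℕ i)
      pos-y i p e = sym (trans (onℕ-toℕ (y ⟨$⟩ˡ_) i) (cong toℕ (trans
        (cong (y ⟨$⟩ˡ_) (sym (trans (sym (at-y p)) (trans e (back i))))) (inverseˡ y))))
      found : (∃[ p′ ] ∃[ q′ ] p′ Fin.< q′ ×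
        lookup (sequence y) p′ ≡ lookup (sequence x) (x ⟨$⟩ˡ i) ×
        lookup (sequence y) q′ ≡ lookup (sequence x) (x ⟨$⟩ˡ j)) → position y (toℕ i) < position y (toℕ j)
      found (p′ , q′ , lo′ , ep , eq) = subst₂ _<_ (pos-y i p′ ep) (pos-y j q′ eq) lo′

  agree⇒rearranged : ∀ A → Agree d A (position x) (position y) →
                     Rearranged (A ∘ toℕ) (sequence x) (sequence y)
  agree⇒rearranged A agr = record
    { distinctˡ = λ p q e → trans (sym (inverseˡ x)) (trans
        (cong (x ⟨$⟩ˡ_) (trans (sym (at-x p)) (trans e (at-x q)))) (inverseˡ x))
    ; distinctʳ = λ p q e → trans (sym (inverseˡ y)) (trans
        (cong (y ⟨$⟩ˡ_) (trans (sym (at-y p)) (trans e (at-y q)))) (inverseˡ y))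
    ; right     = λ p → y ⟨$⟩ˡ (x ⟨$⟩ʳ p) , trans (at-y _) (trans (inverseʳ y) (sym (at-x p)))
    ; left      = λ q → x ⟨$⟩ˡ (y ⟨$⟩ʳ q) , trans (at-x _) (trans (inverseʳ x) (sym (at-y q)))
    ; ordered   = λ p q p′ q′ p<q hp hq ep eq → subst₂ _<_ (pos-y p p′ ep) (pos-y q q′ eq)
        (agr (toℕ (x ⟨$⟩ʳ p)) (toℕ (x ⟨$⟩ʳ q)) (Finₚ.toℕ<n _) (Finₚ.toℕ<n _)
          (trans (sym (cong (A ∘ toℕ) (at-x p))) hp) (trans (sym (cong (A ∘ toℕ) (at-x q))) hq)
          (subst₂ _<_ (sym (pos-x p)) (sym (pos-x q)) p<q)) }
    where
    pos-x : ∀ p → position x (toℕ (x ⟨$⟩ʳ p)) ≡ toℕ p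
    pos-x p = trans (onℕ-toℕ (x ⟨$⟩ˡ_) _) (cong toℕ (inverseˡ x))
    pos-y : ∀ p p′ → lookup (sequence y) p′ ≡ lookup (sequence x) p →
            position y (toℕ (x ⟨$⟩ʳ p)) ≡ toℕ p′
    pos-y p p′ e = trans (onℕ-toℕ (y ⟨$⟩ˡ_) _) (cong toℕ (trans
      (cong (y ⟨$⟩ˡ_) (trans (sym (at-x p)) (trans (sym e) (at-y p′)))) (inverseˡ y)))

  -- Deleting the moved symbols makes the orders agree, so fewer than t moves are impossible;
  -- conversely the symbols of a smallest deletion set can be moved one by one.
  dist⇒ulam : ∀ {t} → Dist d (position x) (position y) t → IsUlam x y t
  dist⇒ulam {t} (dist (A , agr , size≡) least) = exact (rearrange-moves (A ∘ toℕ) (sequence x) (sequence y)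
      (agree⇒rearranged A agr)) , lower
    where
    lower : ∀ u → Moves u (sequence x) (sequence y) → t ≤ u
    lower u ms with B , few , pres ← moves-preserve ms = ≤-trans (least B (preserves⇒agree B pres)) few
    total : countV (A ∘ toℕ) (sequence x) ≡ t
    total = trans (countV-tabulate A (x ⟨$⟩ʳ_) (symbol x) (onℕ-toℕ (x ⟨$⟩ʳ_)))
      (trans (reindex d (ι ∘ A) (symbol-injective x) (symbol-bounded x)) size≡)
    exact : (∃[ u ] u ≤ countV (A ∘ toℕ) (sequence x) × Moves u (sequence x) (sequence y)) →
            Moves t (sequence x) (sequence y)
    exact (u , le , ms) = subst (λ v → Moves v (sequence x) (sequence y))
      (≤-antisym (≤-trans le (≤-reflexive total)) (lower u ms)) ms

-- The objective function and the optimum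

isMin-unique : ∀ {P : ℕ → Set} {a b} → IsMin P a → IsMin P b → a ≡ b
isMin-unique (Pa , la) (Pb , lb) = ≤-antisym (la _ Pb) (lb _ Pa)

-- Search upwards from 0. `fuel + u` remains the number v known to satisfy P, so the search ends
-- there at the latest.
least-number : ∀ {P : ℕ → Set} → (∀ v → Dec (P v)) → ∀ {v} → P v → ∃ (IsMin P)
least-number {P} P? {v} Pv = go v 0 (subst P (sym (+-identityʳ v)) Pv) (λ _ ())
  where
  go : ∀ fuel u → P (fuel + u) → (∀ v → v < u → ¬ P v) → ∃ (IsMin P)
  go fuel u Pf none with P? u
  ... | yes Pu = u , Pu , λ v Pv → ≮⇒≥ λ v<u → none v v<u Pv
  go zero       u Pf none | no ¬Pu = contradiction Pf ¬Pu
  go (suc fuel) u Pf none | no ¬Pu = go fuel (suc u) (subst P (sym (+-suc fuel u)) Pf) λ v v<1+u Pv →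
    check′ v (m<1+n⇒m<n∨m≡n v<1+u) Pv
    where
    check′ : ∀ v → v < u ⊎ v ≡ u → ¬ P v
    check′ v (inj₁ v<u)  = none v v<u
    check′ v (inj₂ refl) = ¬Pu

least-exists : ∀ m g → 1 ≤ m → ∃ (IsLeast m g)
least-exists (suc zero)    g _ = g 0 , (λ { zero _ → ≤-refl ; (suc _) (s≤s ()) }) , 0 , s≤s z≤n , refl
least-exists (suc (suc m)) g _ = add′ (least-exists (suc m) g (s≤s z≤n)) (g (suc m)) refl
  where
  add′ : ∃ (IsLeast (suc m) g) → ∀ u → u ≡ g (suc m) → ∃ (IsLeast (suc (suc m)) g)
  add′ (v , low , j , j< , v≡) u u≡ with ≤-total v u
  ... | inj₁ v≤u = v , (λ i i< → bound i (m<1+n⇒m<n∨m≡n i<)) , j , m≤n⇒m≤1+n j< , v≡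
    where
    bound : ∀ i → i < suc m ⊎ i ≡ suc m → v ≤ g i
    bound i (inj₁ i<)  = low i i<
    bound i (inj₂ refl) = ≤-trans v≤u (≤-reflexive u≡)
  ... | inj₂ u≤v = u , (λ i i< → bound i (m<1+n⇒m<n∨m≡n i<)) , suc m , ≤-refl , u≡
    where
    bound : ∀ i → i < suc m ⊎ i ≡ suc m → u ≤ g i
    bound i (inj₁ i<)  = ≤-trans u≤v (low i i<)
    bound i (inj₂ refl) = ≤-reflexive u≡

-- The distance exists because the program computes it.
abstract
  dist-exists : ∀ {d} (x y : Perm d) → ∃[ t ] Dist d (position x) (position y) t
  dist-exists {d} x y = _ , proj₁ (Row.measure-spec (position x) (symbol y) 0 0
      ⟪ (λ _ → 0) , rows , (λ _ → 0) ⟫ (position y)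
      (record { readPos = λ _ _ → refl ; readCand = λ _ _ → refl ; readC = refl ; readI = refl })
      (position-injective x) (position-injective y) (position-bounded y) (symbol-bounded y)
      (symbol-position y) (position-symbol y))
    where
    open Measuring 1 d 1 0 0 0 ≤-refl
    rows : ℕ → ℕ → ℕ
    rows zero    = position x
    rows (suc _) = symbol y

Δ : ∀ {d} → Perm d → Perm d → ℕ
Δ x y = proj₁ (dist-exists x y)

dist-cong : ∀ {d P P′ Q Q′ t} → (∀ a → a < d → P′ a ≡ P a) → (∀ a → a < d → Q′ a ≡ Q a) →
            Dist d P Q t → Dist d P′ Q′ t
dist-cong {d} {P} {P′} {Q} {Q′} eP eQ (dist (A , agr , e) least) =
  dist (A , transfer (λ a h → sym (eP a h)) (λ a h → sym (eQ a h)) agr , e)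
    λ B agr′ → least B (transfer eP eQ agr′)
  where
  transfer : ∀ {A P P′ Q Q′} → (∀ a → a < d → P a ≡ P′ a) → (∀ a → a < d → Q a ≡ Q′ a) →
             Agree d A P Q → Agree d A P′ Q′
  transfer eP eQ agr a b a<d b<d Aa Ab lo = subst₂ _<_ (eQ a a<d) (eQ b b<d)
    (agr a b a<d b<d Aa Ab (subst₂ _<_ (sym (eP a a<d)) (sym (eP b b<d)) lo))

-- Permutations given by positions, and codes for them

mkPerm : ∀ {d} (P : ℕ → ℕ) → Inj d P → Bounded d P → Perm d
mkPerm {d} P iP bP = permutation to from to-from from-to
  where
  from to : Fin d → Fin d
  from a = fromℕ< (bP (toℕ a) (Finₚ.toℕ<n a))
  to j = fromℕ< (proj₁ (proj₂ (onto d iP bP (toℕ j) (Finₚ.toℕ<n j))))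
  P-to : ∀ j → P (toℕ (to j)) ≡ toℕ j
  P-to j = let a , a<d , e = onto d iP bP (toℕ j) (Finₚ.toℕ<n j) in
    trans (cong P (Finₚ.toℕ-fromℕ< a<d)) e
  toℕ-from : ∀ a → toℕ (from a) ≡ P (toℕ a)
  toℕ-from a = Finₚ.toℕ-fromℕ< (bP (toℕ a) (Finₚ.toℕ<n a))
  to-from : ∀ a → to (from a) ≡ a
  to-from a = Finₚ.toℕ-injective (iP _ _ (Finₚ.toℕ<n (to (from a))) (Finₚ.toℕ<n a)
    (trans (P-to (from a)) (toℕ-from a)))
  from-to : ∀ j → from (to j) ≡ j
  from-to j = Finₚ.toℕ-injective (trans (toℕ-from (to j)) (P-to j))

position-mkPerm : ∀ {d} (P : ℕ → ℕ) iP bP → ∀ a → a < d → position (mkPerm {d} P iP bP) a ≡ P a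
position-mkPerm {d} P iP bP = every (λ a → position (mkPerm {d} P iP bP) a ≡ P a) λ i →
  trans (onℕ-toℕ (mkPerm P iP bP ⟨$⟩ˡ_) i) (Finₚ.toℕ-fromℕ< (bP (toℕ i) (Finₚ.toℕ<n i)))

Injectiveᶠ : ∀ {d} → (Fin d → Fin d) → Set
Injectiveᶠ f = ∀ i j → f i ≡ f j → i ≡ j

injectiveᶠ? : ∀ {d} (f : Fin d → Fin d) → Dec (Injectiveᶠ f)
injectiveᶠ? f = Finₚ.all? λ i → Finₚ.all? λ j → (f i Finₚ.≟ f j) →-dec (i Finₚ.≟ j)

onℕ-injective : ∀ {d} (f : Fin d → Fin d) → Injectiveᶠ f → Inj d (onℕ f)
onℕ-injective {d} f inj a b a<d b<d = every P (λ i → every (λ b → onℕ f (toℕ i) ≡ onℕ f b → toℕ i ≡ b)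
  (λ j e → cong toℕ (inj i j (Finₚ.toℕ-injective (trans (sym (onℕ-toℕ f i)) (trans e (onℕ-toℕ f j))))))) a a<d b b<d
  where
  P : ℕ → Set
  P a = ∀ b → b < d → onℕ f a ≡ onℕ f b → a ≡ b

onℕ-bounded : ∀ {d} (f : Fin d → Fin d) → Bounded d (onℕ f)
onℕ-bounded {d} f = every (λ a → onℕ f a < d) λ i → subst (_< d) (sym (onℕ-toℕ f i)) (Finₚ.toℕ<n (f i))

-- A function that is not injective denotes the identity.
permOf : ∀ {d} → (Fin d → Fin d) → Perm d
permOf f with injectiveᶠ? f
... | yes inj = mkPerm (onℕ f) (onℕ-injective f inj) (onℕ-bounded f)
... | no  _   = Permutation.id

permOf-position : ∀ {d} (x : Perm d) (f : Fin d → Fin d) → (∀ i → f i ≡ x ⟨$⟩ˡ i) →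
                  ∀ a → a < d → position (permOf f) a ≡ position x a
permOf-position {d} x f eq a a<d with injectiveᶠ? f
... | yes inj = trans (position-mkPerm (onℕ f) (onℕ-injective f inj) (onℕ-bounded f) a a<d)
  (every (λ a → onℕ f a ≡ position x a) (λ i → trans (onℕ-toℕ f i)
    (trans (cong toℕ (eq i)) (sym (onℕ-toℕ (x ⟨$⟩ˡ_) i)))) a a<d)
... | no ¬inj = contradiction (λ i j e → trans (sym (inverseʳ x))
  (trans (cong (x ⟨$⟩ʳ_) (trans (sym (eq i)) (trans e (eq j)))) (inverseʳ x))) ¬inj

size-count : ∀ {n} (S′ : Subset n) (χ : ℕ → Bool) → (∀ i → χ (toℕ i) ≡ lookup S′ i) →
             ∣ S′ ∣ ≡ count n χ
size-count {zero}  []       χ eq = refl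
size-count {suc n} (b ∷ S′) χ eq = trans (head b)
  (trans (cong₂ (λ c m → ι c + m) (sym (eq Fin.zero)) (size-count S′ (χ ∘ suc) (eq ∘ Fin.suc)))
    (sym (∑-head n (ι ∘ χ))))
  where
  head : ∀ b → ∣ b ∷ S′ ∣ ≡ ι b + ∣ S′ ∣
  head true  = refl
  head false = refl

sum-∑ : ∀ {n} (f : Fin n → ℕ) (g : ℕ → ℕ) → (∀ i → f i ≡ g (toℕ i)) → sum f ≡ ∑ n g
sum-∑ {zero}  f g eq = refl
sum-∑ {suc n} f g eq = trans (cong₂ _+_ (eq Fin.zero) (sum-∑ (f ∘ Fin.suc) (g ∘ suc) (eq ∘ Fin.suc)))
  (sym (∑-head n g))

module Objectives {d n : ℕ} (p : ℚ) (S : Fin n → Perm d) (t : ℕ) (1≤t : 1 ≤ t) (t≤n : t ≤ n)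
  (enough : ∀ c → (1ℚ ℚ.- p) ℚ.* ℕ→ℚ n ℚ.≤ ℕ→ℚ c → t ≤ c)
  (suffices : ∀ c → t ≤ c → (1ℚ ℚ.- p) ℚ.* ℕ→ℚ n ℚ.≤ ℕ→ℚ c) where

  record Medians {m} (Y : Fin m → Perm d) : Set where
    field
      δ        : ℕ → ℕ → ℕ
      μ        : ℕ → ℕ
      distance : ∀ i j → Dist d (position (S i)) (position (Y j)) (δ (toℕ i) (toℕ j))
      least    : ∀ i → i < n → IsLeast m (δ i) (μ i)

  open Medians

  module _ {m} {Y : Fin m → Perm d} (Ym : Medians Y) where

    isDist : ∀ i → IsDist (S i) Y (μ Ym (toℕ i))
    isDist i = attained (proj₂ (least Ym (toℕ i) (Finₚ.toℕ<n i))) , lower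
      where
      attained : (∃[ j ] j < m × μ Ym (toℕ i) ≡ δ Ym (toℕ i) j) →
                 ∃[ j ] IsUlam (S i) (Y j) (μ Ym (toℕ i))
      attained (j , j<m , e) = fromℕ< j<m , subst (IsUlam (S i) (Y (fromℕ< j<m)))
        (trans (cong (δ Ym (toℕ i)) (Finₚ.toℕ-fromℕ< j<m)) (sym e))
        (dist⇒ulam (S i) (Y (fromℕ< j<m)) (distance Ym i (fromℕ< j<m)))
      lower : ∀ u → (∃[ j ] IsUlam (S i) (Y j) u) → μ Ym (toℕ i) ≤ u
      lower u (j , ulam) = ≤-trans (proj₁ (least Ym (toℕ i) (Finₚ.toℕ<n i)) (toℕ j) (Finₚ.toℕ<n j))
        (≤-reflexive (isMin-unique (dist⇒ulam (S i) (Y j) (distance Ym i j)) ulam))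

    -- The t points nearest to the medians are admissible by `suffices`. Every admissible set has at
    -- least t points by `enough`, so the exchange argument applies to it.
    isObjₚ : IsObjₚ p S Y (smallest n t (μ Ym))
    isObjₚ = (S′ , suffices ∣ S′ ∣ (≤-reflexive (sym size≡)) , δ′ , on , off ,
        sym (sum-∑ δ′ (λ i → ι (ch i) * μ Ym i) λ _ → refl)) , lower
      where
      ch : ℕ → Bool
      ch = chosen n t (μ Ym)
      S′ : Subset n
      S′ = Vec.tabulate (ch ∘ toℕ)
      look : ∀ i → lookup S′ i ≡ ch (toℕ i)
      look = Vecₚ.lookup∘tabulate (ch ∘ toℕ)
      size≡ : ∣ S′ ∣ ≡ t
      size≡ = trans (size-count S′ ch (sym ∘ look)) (chosen-count n t (μ Ym) t≤n)
      δ′ : Fin n → ℕ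
      δ′ i = ι (ch (toℕ i)) * μ Ym (toℕ i)
      on : ∀ i → i ∈ S′ → IsDist (S i) Y (δ′ i)
      on i i∈S′ = subst (IsDist (S i) Y) (trans (sym (*-identityˡ (μ Ym (toℕ i))))
        (cong (λ b → ι b * μ Ym (toℕ i)) (sym (trans (sym (look i)) (Vecₚ.[]=⇒lookup i∈S′))))) (isDist i)
      off : ∀ i → i ∉ S′ → δ′ i ≡ 0
      off i i∉S′ with ch (toℕ i) in e
      ... | false = refl
      ... | true  = contradiction (Vecₚ.lookup⇒[]= i S′ (trans (look i) e)) i∉S′
      lower : ∀ u → (Σ[ S″ ∈ Subset n ] ((1ℚ ℚ.- p) ℚ.* ℕ→ℚ n ℚ.≤ ℕ→ℚ ∣ S″ ∣) × IsObj S S″ Y u) →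
              smallest n t (μ Ym) ≤ u
      lower u (S″ , large , δ″ , on″ , off″ , u≡) = ≤-trans
        (smallest-least n t (μ Ym) t≤n χ (≤-trans (enough ∣ S″ ∣ large) (≤-reflexive (size-count S″ χ χ≡))))
        (≤-reflexive (sym (trans u≡ (sum-∑ δ″ (λ i → ι (χ i) * μ Ym i) pw))))
        where
        χ : ℕ → Bool
        χ = family false (lookup S″)
        χ≡ : ∀ i → χ (toℕ i) ≡ lookup S″ i
        χ≡ = family-toℕ false (lookup S″)
        pw : ∀ i → δ″ i ≡ ι (χ (toℕ i)) * μ Ym (toℕ i)
        pw i = trans (byCase (lookup S″ i) refl) (cong (λ b → ι b * μ Ym (toℕ i)) (sym (χ≡ i)))
          where
          byCase : ∀ b → lookup S″ i ≡ b → δ″ i ≡ ι b * μ Ym (toℕ i)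
          byCase true  e = trans (isMin-unique (on″ i (Vecₚ.lookup⇒[]= i S″ e)) (isDist i))
            (sym (+-identityʳ (μ Ym (toℕ i))))
          byCase false e = off″ i λ i∈S″ → contradiction (trans (sym e) (Vecₚ.[]=⇒lookup i∈S″)) λ ()

  medians : ∀ {m} (Y : Fin m → Perm d) → 1 ≤ m → Medians Y
  medians {m} Y 1≤m = record
    { δ        = δ′
    ; μ        = λ i → proj₁ (least-exists m (δ′ i) 1≤m)
    ; distance = λ i j → subst (Dist d (position (S i)) (position (Y j))) (sym (δ≡ i j))
        (proj₂ (dist-exists (S i) (Y j)))
    ; least    = λ i _ → proj₂ (least-exists m (δ′ i) 1≤m) }
    where
    row : Fin n → ℕ → ℕ
    row i = family 0 (λ j → Δ (S i) (Y j))
    δ′ : ℕ → ℕ → ℕ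
    δ′ = family (λ _ → 0) row
    δ≡ : ∀ i j → δ′ (toℕ i) (toℕ j) ≡ Δ (S i) (Y j)
    δ≡ i j = trans (cong (λ f → f (toℕ j)) (family-toℕ (λ _ → 0) row i))
      (family-toℕ 0 (λ j → Δ (S i) (Y j)) j)

  -- As `1≤t`, an admissible set of inliers has a point, and a point has a distance only from a
  -- nonempty family.
  objective-nonempty : ∀ {m} (Y : Fin m → Perm d) {v} → IsObjₚ p S Y v → 1 ≤ m
  objective-nonempty {suc m} Y _ = s≤s z≤n
  objective-nonempty {zero}  Y ((S′ , large , δ , on , _) , _) = contradiction (search n χ) empty
    where
    χ : ℕ → Bool
    χ = family false (lookup S′)
    χ≡ : ∀ i → χ (toℕ i) ≡ lookup S′ i
    χ≡ = family-toℕ false (lookup S′)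
    member : ∀ i → χ (toℕ i) ≡ true → ⊥
    member i h with () , _ ← proj₁ (on i (Vecₚ.lookup⇒[]= i S′ (trans (sym (χ≡ i)) h)))
    empty : (∃[ i ] i < n × χ i ≡ true) ⊎ (∀ i → i < n → χ i ≡ false) → ⊥
    empty (inj₁ (i , i<n , h)) = every (λ i → χ i ≡ true → ⊥) member i i<n h
    empty (inj₂ none) = contradiction
      (≤-trans (≤-trans 1≤t (enough ∣ S′ ∣ large)) (≤-reflexive (trans (size-count S′ χ χ≡)
        (trans (∑-cong n λ i i<n → cong ι (none i i<n)) (∑-zero n))))) λ ()

  -- Families of medians need finitely many codes to make the search for the optimum decidable.
  -- Decoding an encoded family gives permutations with the same positions, hence the same distances
  -- and objective value.
  decode : ∀ {m} → Fin ((d ^ d) ^ m) → Fin m → Perm d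
  decode c j = permOf (Fin.finToFun (Fin.finToFun c j))

  encode : ∀ {m} → (Fin m → Perm d) → Fin ((d ^ d) ^ m)
  encode Y = Fin.funToFin λ j → Fin.funToFin (Y j ⟨$⟩ˡ_)

  decode-encode : ∀ {m} (Y : Fin m → Perm d) j a → a < d →
                  position (decode (encode Y) j) a ≡ position (Y j) a
  decode-encode Y j = permOf-position (Y j) _ λ i → trans
    (cong (λ c → Fin.finToFun c i) (Finₚ.finToFun-funToFin (λ j → Fin.funToFin (Y j ⟨$⟩ˡ_)) j))
    (Finₚ.finToFun-funToFin (Y j ⟨$⟩ˡ_) i)

  coded : ∀ {m} {Y : Fin m → Perm d} → Medians Y → Medians (decode (encode Y))
  coded {Y = Y} Ym = record
    { δ        = δ Ym
    ; μ        = μ Ym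
    ; distance = λ i j → dist-cong (λ _ _ → refl) (decode-encode Y j) (distance Ym i j)
    ; least    = least Ym }

  value : ∀ m → Fin ((d ^ d) ^ suc m) → ℕ
  value m c = smallest n t (μ (medians (decode {suc m} c) (s≤s z≤n)))

  -- The minimum is found by search in the decidable set of values attained by coded families. An m
  -- in `Fin k` stands for `suc m` medians, since the empty family has no objective value.
  opt-exists : ∀ k → 1 ≤ k → Perm d → ∃ (IsOpt p S k)
  opt-exists k 1≤k x₀ = finish (least-number attained? start)
    where
    Attained : ℕ → Set
    Attained v = ∃[ m ] ∃[ c ] value (toℕ {k} m) c ≡ v
    attained? : ∀ v → Dec (Attained v)
    attained? v = Finₚ.any? λ m → Finₚ.any? λ c → value (toℕ {k} m) c ≟ v
    start : Attained (value (toℕ (fromℕ< 1≤k)) (encode {suc (toℕ (fromℕ< 1≤k))} (λ _ → x₀)))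
    start = fromℕ< 1≤k , encode {suc (toℕ (fromℕ< 1≤k))} (λ _ → x₀) , refl
    reached : ∀ m → m ≤ k → (Y : Fin m → Perm d) → ∀ v → IsObjₚ p S Y v → Attained v
    reached zero    m<k Y v obj = contradiction (objective-nonempty Y obj) λ ()
    reached (suc m) m<k Y v obj = fromℕ< m<k ,
      subst (λ m′ → ∃[ c ] value m′ c ≡ v) (sym (Finₚ.toℕ-fromℕ< m<k))
        (encode Y , trans (isMin-unique (isObjₚ (medians (decode (encode Y)) (s≤s z≤n))) (isObjₚ (coded Ym)))
          (isMin-unique (isObjₚ Ym) obj))
      where
      Ym : Medians Y
      Ym = medians Y (s≤s z≤n)
    finish : ∃ (IsMin Attained) → ∃ (IsOpt p S k)
    finish (v , (m , c , e) , low) = v ,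
      (suc (toℕ m) , Finₚ.toℕ<n m , decode c , subst (IsObjₚ p S (decode c)) e (isObjₚ (medians (decode c) (s≤s z≤n)))) ,
      λ v′ (m′ , m′≤k , Y , obj) → low v′ (reached m′ m′≤k Y v′ obj)

-- Rational side conditions

ℕ→ℚᵘ : ∀ m → ℚ.toℚᵘ (ℕ→ℚ m) ℚᵘ.≃ mkℚᵘ (ℤ.+ m) 0
ℕ→ℚᵘ m = ℚₚ.toℚᵘ-fromℚᵘ (mkℚᵘ (ℤ.+ m) 0)

fraction : ∀ a b → .(Coprime a (suc b)) → ℚ
fraction a b co = ℚ.mkℚ (ℤ.+ a) b co

module _ (a b : ℕ) .(co : Coprime a (suc b)) (a≤den : a ≤ suc b) (n c : ℕ) where

  kept : ℚᵘ.ℚᵘ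
  kept = (mkℚᵘ (ℤ.+ 1) 0 ℚᵘ.+ ℚᵘ.- mkℚᵘ (ℤ.+ a) b) ℚᵘ.* mkℚᵘ (ℤ.+ n) 0

  kept≃ : ℚ.toℚᵘ ((1ℚ ℚ.- fraction a b co) ℚ.* ℕ→ℚ n) ℚᵘ.≃ kept
  kept≃ = ℚᵘₚ.≃-trans (ℚₚ.toℚᵘ-homo-* (1ℚ ℚ.- fraction a b co) (ℕ→ℚ n))
    (ℚᵘₚ.*-cong (ℚᵘₚ.≃-trans (ℚₚ.toℚᵘ-homo-+ 1ℚ (ℚ.- fraction a b co))
      (ℚᵘₚ.+-congʳ (mkℚᵘ (ℤ.+ 1) 0) (ℚₚ.toℚᵘ-homo‿- (fraction a b co)))) (ℕ→ℚᵘ n))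

  kept-numerator : ℚᵘ.↥ kept ℤ.* ℤ.+ 1 ≡ ℤ.+ ((suc b ∸ a) * n)
  kept-numerator = trans (ℤₚ.*-identityʳ _) (trans (cong (ℤ._* ℤ.+ n) difference) (sym (ℤₚ.pos-* (suc b ∸ a) n)))
    where
    difference : ℤ.+ 1 ℤ.* ℤ.+ suc b ℤ.+ (ℤ.- ℤ.+ a) ℤ.* ℤ.+ 1 ≡ ℤ.+ (suc b ∸ a)
    difference = trans (cong₂ ℤ._+_ (ℤₚ.*-identityˡ (ℤ.+ suc b)) (ℤₚ.*-identityʳ (ℤ.- ℤ.+ a)))
      (trans (ℤₚ.m-n≡m⊖n (suc b) a) (ℤₚ.⊖-≥ a≤den))

  kept-denominator : ℤ.+ c ℤ.* ℚᵘ.↧ kept ≡ ℤ.+ (c * suc b)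
  kept-denominator = trans (sym (ℤₚ.pos-* c _)) (cong (λ m → ℤ.+ (c * m))
    (trans (*-identityʳ (1 * suc b)) (*-identityˡ (suc b))))

  fraction≤⇒ : (1ℚ ℚ.- fraction a b co) ℚ.* ℕ→ℚ n ℚ.≤ ℕ→ℚ c → (suc b ∸ a) * n ≤ c * suc b
  fraction≤⇒ h = ℤₚ.drop‿+≤+ (subst₂ ℤ._≤_ kept-numerator kept-denominator
    (ℚᵘₚ.drop-*≤* (ℚᵘₚ.≤-respˡ-≃ kept≃ (ℚᵘₚ.≤-respʳ-≃ (ℕ→ℚᵘ c) (ℚₚ.toℚᵘ-mono-≤ h)))))

  fraction≤⇐ : (suc b ∸ a) * n ≤ c * suc b → (1ℚ ℚ.- fraction a b co) ℚ.* ℕ→ℚ n ℚ.≤ ℕ→ℚ c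
  fraction≤⇐ h = ℚₚ.toℚᵘ-cancel-≤ (ℚᵘₚ.≤-respˡ-≃ (ℚᵘₚ.≃-sym kept≃) (ℚᵘₚ.≤-respʳ-≃ (ℚᵘₚ.≃-sym (ℕ→ℚᵘ c))
    (ℚᵘ.*≤* (subst₂ ℤ._≤_ (sym kept-numerator) (sym kept-denominator) (ℤ.+≤+ h)))))

ratio≤ : ∀ A B v o → suc B * v ≤ A * o → ℕ→ℚ v ℚ.≤ (ℤ.+ A ℚ./ suc B) ℚ.* ℕ→ℚ o
ratio≤ A B v o h = ℚₚ.toℚᵘ-cancel-≤ (ℚᵘₚ.≤-respˡ-≃ (ℚᵘₚ.≃-sym (ℕ→ℚᵘ v)) (ℚᵘₚ.≤-respʳ-≃
  (ℚᵘₚ.≃-sym (ℚᵘₚ.≃-trans (ℚₚ.toℚᵘ-homo-* (ℤ.+ A ℚ./ suc B) (ℕ→ℚ o))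
    (ℚᵘₚ.*-cong (ℚₚ.toℚᵘ-fromℚᵘ (mkℚᵘ (ℤ.+ A) B)) (ℕ→ℚᵘ o))))
  (ℚᵘ.*≤* (subst₂ ℤ._≤_ left≡ right≡ (ℤ.+≤+ h)))))
  where
  left≡ : ℤ.+ (suc B * v) ≡ ℤ.+ v ℤ.* ℤ.+ (suc B * 1)
  left≡ = trans (cong ℤ.+_ (trans (*-comm (suc B) v) (cong (v *_) (sym (*-identityʳ (suc B)))))) (ℤₚ.pos-* v _)
  right≡ : ℤ.+ (A * o) ≡ (ℤ.+ A ℤ.* ℤ.+ o) ℤ.* ℤ.+ 1
  right≡ = trans (ℤₚ.pos-* A o) (sym (ℤₚ.*-identityʳ _))

module _ (n a b : ℕ) where

  -- With `threshold≥` this characterises the ceiling: c points are enough exactly when c is at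
  -- least the threshold.
  threshold≤ : ∀ c → (suc b ∸ a) * n ≤ c * suc b → threshold n a (suc b) ≤ c
  threshold≤ c h = ≤-pred (m<n*o⇒m/o<n {o = suc b} (begin-strict
    (suc b ∸ a) * n + b ≤⟨ +-monoˡ-≤ b h ⟩
    c * suc b + b       <⟨ +-monoʳ-< (c * suc b) (n<1+n b) ⟩
    c * suc b + suc b   ≡⟨ +-comm (c * suc b) (suc b) ⟩
    suc c * suc b       ∎))
    where open ≤-Reasoning

  threshold-covers : (suc b ∸ a) * n ≤ threshold n a (suc b) * suc b
  threshold-covers = +-cancelʳ-≤ b _ _ (≤-pred (begin-strict
    (suc b ∸ a) * n + b            ≡⟨ m≡m%n+[m/n]*n ((suc b ∸ a) * n + b) (suc b) ⟩
    ((suc b ∸ a) * n + b) % suc b + threshold n a (suc b) * suc b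
      <⟨ +-monoˡ-< _ (m%n<n ((suc b ∸ a) * n + b) (suc b)) ⟩
    suc b + threshold n a (suc b) * suc b  ≡⟨ cong suc (+-comm b _) ⟩
    suc (threshold n a (suc b) * suc b + b) ∎))
    where open ≤-Reasoning

  threshold≥ : ∀ c → threshold n a (suc b) ≤ c → (suc b ∸ a) * n ≤ c * suc b
  threshold≥ c le = ≤-trans threshold-covers (*-monoˡ-≤ (suc b) le)

module Quota (n a b : ℕ) .(co : Coprime a (suc b)) (1≤n : 1 ≤ n) (a<den : a < suc b) where

  quota : ℕ
  quota = threshold n a (suc b)

  enough : ∀ c → (1ℚ ℚ.- fraction a b co) ℚ.* ℕ→ℚ n ℚ.≤ ℕ→ℚ c → quota ≤ c
  enough c h = threshold≤ n a b c (fraction≤⇒ a b co (<⇒≤ a<den) n c h)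

  suffices : ∀ c → quota ≤ c → (1ℚ ℚ.- fraction a b co) ℚ.* ℕ→ℚ n ℚ.≤ ℕ→ℚ c
  suffices c le = fraction≤⇐ a b co (<⇒≤ a<den) n c (threshold≥ n a b c le)

  t≤n : quota ≤ n
  t≤n = threshold≤ n a b n (≤-trans (*-monoˡ-≤ n (m∸n≤m (suc b) a)) (≤-reflexive (*-comm (suc b) n)))

  1≤t : 1 ≤ quota
  1≤t = ≰⇒> λ t≤0 → contradiction (threshold≥ n a b 0 t≤0)
    (<⇒≱ (*-mono-≤ (m<n⇒0<n∸m a<den) 1≤n))

-- Running time

prepareSize roundSize deliverSize : ℕ
prepareSize = size (polynomialTime prepare)
roundSize   = size (polynomialTime round)
deliverSize = size (polynomialTime deliver)

fold-time : ∀ p r q A B E → 1 ≤ A → 1 ≤ E →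
  1 + (3 + (30 + (p * (A + B) + ((E * (4 + r * A) + 4) + (q * A + 4))))) ≤ (46 + p + r + q) * (E * A + B)
fold-time p r q A B E 1≤A 1≤E = begin
  1 + (3 + (30 + (p * (A + B) + ((E * (4 + r * A) + 4) + (q * A + 4)))))
    ≡⟨ go₁ p r q A B E ⟩
  42 * 1 + p * (A + B) + 4 * (E * 1) + r * (E * A) + q * A
    ≤⟨ +-mono-≤ (+-mono-≤ (+-mono-≤ (+-mono-≤
         (*-monoʳ-≤ 42 (≤-trans (*-mono-≤ 1≤E 1≤A) U₁)) (*-monoʳ-≤ p (+-monoˡ-≤ B A≤)))
         (*-monoʳ-≤ 4 (≤-trans (*-monoʳ-≤ E 1≤A) U₁))) (*-monoʳ-≤ r U₁)) (*-monoʳ-≤ q (≤-trans A≤ U₁)) ⟩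
  42 * U + p * U + 4 * U + r * U + q * U
    ≡⟨ go₂ p r q U ⟩
  (46 + p + r + q) * U ∎
  where
  open ≤-Reasoning
  U : ℕ
  U = E * A + B
  U₁ : E * A ≤ U
  U₁ = m≤m+n (E * A) B
  A≤ : A ≤ E * A
  A≤ = ≤-trans (≤-reflexive (sym (*-identityˡ A))) (*-monoˡ-≤ A 1≤E)
  go₁ : ∀ p r q A B E → 1 + (3 + (30 + (p * (A + B) + ((E * (4 + r * A) + 4) + (q * A + 4))))) ≡
        42 * 1 + p * (A + B) + 4 * (E * 1) + r * (E * A) + q * A
  go₁ = solve-∀
  go₂ : ∀ p r q U → 42 * U + p * U + 4 * U + r * U + q * U ≡ (46 + p + r + q) * U
  go₂ = solve-∀

abstract
  -- Abstract, so that the sizes of the programs are not unfolded wherever the bound occurs.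
  timeFactor : ℕ
  timeFactor = 46 + prepareSize + roundSize + deliverSize

  46≤timeFactor : 46 ≤ timeFactor
  46≤timeFactor = ≤-trans (m≤m+n 46 prepareSize) (≤-trans (m≤m+n _ roundSize) (m≤m+n _ deliverSize))

  total-time : ∀ A B E → 1 ≤ A → 1 ≤ E →
    1 + (3 + (30 + (prepareSize * (A + B) + ((E * (4 + roundSize * A) + 4) + (deliverSize * A + 4))))) ≤
    timeFactor * (E * A + B)
  total-time = fold-time prepareSize roundSize deliverSize

-- If n^e ≤ d, the left-hand side is below d³, and otherwise below n^(2e) d.
square-affordable : ∀ n d e → 1 ≤ n → 2 ≤ d →
  n ^ e * d ^ 2 ≤ n ^ (e + e) * (d * ⌈log₂ d ⌉) + n ^ 5 * d ^ 3
square-affordable n d e 1≤n 2≤d with ≤-total (n ^ e) d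
... | inj₁ n^e≤d = begin
  n ^ e * d ^ 2     ≤⟨ *-monoˡ-≤ (d ^ 2) n^e≤d ⟩
  d ^ 3             ≡⟨ *-identityˡ (d ^ 3) ⟨
  1 * d ^ 3         ≤⟨ *-monoˡ-≤ (d ^ 3) (m^n>0 n {{>-nonZero 1≤n}} 5) ⟩
  n ^ 5 * d ^ 3     ≤⟨ m≤n+m _ _ ⟩
  n ^ (e + e) * (d * ⌈log₂ d ⌉) + n ^ 5 * d ^ 3 ∎
  where open ≤-Reasoning
... | inj₂ d≤n^e = begin
  n ^ e * d ^ 2                 ≡⟨ cong (λ m → n ^ e * (d * m)) (*-identityʳ d) ⟩
  n ^ e * (d * d)               ≤⟨ *-monoʳ-≤ (n ^ e) (*-monoʳ-≤ d d≤n^e) ⟩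
  n ^ e * (d * n ^ e)           ≡⟨ go (n ^ e) d ⟩
  n ^ e * n ^ e * (d * 1)       ≤⟨ *-monoʳ-≤ (n ^ e * n ^ e) (*-monoʳ-≤ d (⌈log₂⌉-mono-≤ 2≤d)) ⟩
  n ^ e * n ^ e * (d * ⌈log₂ d ⌉) ≡⟨ cong (_* (d * ⌈log₂ d ⌉)) (^-distribˡ-+-* n e e) ⟨
  n ^ (e + e) * (d * ⌈log₂ d ⌉) ≤⟨ m≤m+n _ _ ⟩
  n ^ (e + e) * (d * ⌈log₂ d ⌉) + n ^ 5 * d ^ 3 ∎
  where
  open ≤-Reasoning
  go : ∀ a d → a * (d * a) ≡ a * a * (d * 1)
  go = solve-∀

-- The exponent 17 k covers 5 k for the number of tuples and 12 for the work on each;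
-- `square-affordable` doubles it to 34 k in exchange for a factor d.
exponent-bound : ∀ n d k → 1 ≤ n → 1 ≤ k → 2 ≤ d →
  (n ^ 5) ^ k * (n ^ 12 * d ^ 2) + n ^ 5 * d ^ 3 ≤
  2 * (n ^ (34 * k) * (d * ⌈log₂ d ⌉) + n ^ 5 * d ^ 3)
exponent-bound n d k 1≤n 1≤k 2≤d = begin
  (n ^ 5) ^ k * (n ^ 12 * d ^ 2) + n ^ 5 * d ^ 3
    ≤⟨ +-monoˡ-≤ (n ^ 5 * d ^ 3) main ⟩
  n ^ (17 * k) * d ^ 2 + n ^ 5 * d ^ 3
    ≤⟨ +-mono-≤ (square-affordable n d (17 * k) 1≤n 2≤d) (m≤n+m (n ^ 5 * d ^ 3) (n ^ (17 * k + 17 * k) * (d * ⌈log₂ d ⌉))) ⟩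
  V + V
    ≡⟨ cong (V +_) (+-identityʳ V) ⟨
  2 * V
    ≡⟨ cong (λ e → 2 * (n ^ e * (d * ⌈log₂ d ⌉) + n ^ 5 * d ^ 3)) (*-distribʳ-+ k 17 17) ⟨
  2 * (n ^ (34 * k) * (d * ⌈log₂ d ⌉) + n ^ 5 * d ^ 3) ∎
  where
  open ≤-Reasoning
  V : ℕ
  V = n ^ (17 * k + 17 * k) * (d * ⌈log₂ d ⌉) + n ^ 5 * d ^ 3
  main : (n ^ 5) ^ k * (n ^ 12 * d ^ 2) ≤ n ^ (17 * k) * d ^ 2
  main = begin
    (n ^ 5) ^ k * (n ^ 12 * d ^ 2)   ≡⟨ *-assoc ((n ^ 5) ^ k) (n ^ 12) (d ^ 2) ⟨
    (n ^ 5) ^ k * n ^ 12 * d ^ 2     ≡⟨ cong (λ m → m * n ^ 12 * d ^ 2) (^-*-assoc n 5 k) ⟩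
    n ^ (5 * k) * n ^ 12 * d ^ 2     ≡⟨ cong (_* d ^ 2) (^-distribˡ-+-* n (5 * k) 12) ⟨
    n ^ (5 * k + 12) * d ^ 2         ≤⟨ *-monoˡ-≤ (d ^ 2) (^-monoʳ-≤ n {{>-nonZero 1≤n}} (begin
      5 * k + 12      ≤⟨ +-monoʳ-≤ (5 * k) (*-monoʳ-≤ 12 1≤k) ⟩
      5 * k + 12 * k  ≡⟨ *-distribʳ-+ k 5 12 ⟨
      17 * k          ∎)) ⟩
    n ^ (17 * k) * d ^ 2             ∎

inputMemory-entry : ∀ {d n} (S : Fin n → Perm d) i j →
                    inputMemory S (toℕ (combine i j)) ≡ toℕ (S i ⟨$⟩ʳ j)
inputMemory-entry {d} {n} S i j with toℕ (combine i j) <? n * d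
... | no  ≮nd  = contradiction (Finₚ.toℕ<n (combine i j)) ≮nd
... | yes lo  = cong (λ (i , j) → toℕ (S i ⟨$⟩ʳ j))
  (trans (cong (remQuot {n} d) (Finₚ.fromℕ<-toℕ (combine i j) lo)) (Finₚ.remQuot-combine i j))

inputMemory-bound : ∀ {d n} (S : Fin n → Perm d) u → inputMemory S u ≤ d
inputMemory-bound {d} {n} S u with u <? n * d
... | no  _  = z≤n
... | yes lo = <⇒≤ (Finₚ.toℕ<n _)

inputMemory-blank : ∀ {d n} (S : Fin n → Perm d) u → n * d ≤ u → inputMemory S u ≡ 0
inputMemory-blank {d} {n} S u nd≤u with u <? n * d
... | no  _  = refl
... | yes lo = contradiction lo (≤⇒≯ nd≤u)

module Digits (n d k num′ den t : ℕ) (1≤n : 1 ≤ n) where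
  open Verify n d k num′ den t

  low-digit : ∀ {i} r → i < n → apply mod (r * n + i) n ≡ i
  low-digit {i} r i<n = go n 1≤n i<n
    where
    go : ∀ n → 1 ≤ n → i < n → apply mod (r * n + i) n ≡ i
    go (suc m) _ i<n = trans (cong (_% suc m) (+-comm (r * suc m) i))
      (trans ([m+kn]%n≡m%n i r (suc m)) (m<n⇒m%n≡m i<n))

  high-digits : ∀ {i} r → i < n → apply div (r * n + i) n ≡ r
  high-digits {i} r i<n = go n 1≤n i<n
    where
    go : ∀ n → 1 ≤ n → i < n → apply div (r * n + i) n ≡ r
    go (suc m) _ i<n = *-cancelʳ-≡ _ _ (suc m) (+-cancelˡ-≡ i _ _ (begin
      i + (r * suc m + i) / suc m * suc m
        ≡⟨ cong (_+ (r * suc m + i) / suc m * suc m) (sym rem) ⟩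
      (r * suc m + i) % suc m + (r * suc m + i) / suc m * suc m
        ≡⟨ m≡m%n+[m/n]*n (r * suc m + i) (suc m) ⟨
      r * suc m + i
        ≡⟨ +-comm (r * suc m) i ⟩
      i + r * suc m ∎))
      where
      open ≡-Reasoning
      rem : (r * suc m + i) % suc m ≡ i
      rem = trans (cong (_% suc m) (+-comm (r * suc m) i))
        (trans ([m+kn]%n≡m%n i r (suc m)) (m<n⇒m%n≡m i<n))

  digits : ∀ i₁ i₂ i₃ i₄ i₅ → i₁ < n → i₂ < n → i₃ < n → i₄ < n → i₅ < n →
    ∃[ c ] c < n ^ 5 × digitOf 0 c ≡ i₁ × digitOf 1 c ≡ i₂ × digitOf 2 c ≡ i₃ ×
           digitOf 3 c ≡ i₄ × digitOf 4 c ≡ i₅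
  digits i₁ i₂ i₃ i₄ i₅ l₁ l₂ l₃ l₄ l₅ = c₁ ,
    <-≤-trans (row-bound (row-bound (row-bound (row-bound l₅ l₄) l₃) l₂) l₁) (≤-reflexive (go n)) ,
    low-digit c₂ l₁ , trans (cong (digitOf 0) h₁) (low-digit c₃ l₂) ,
    trans (cong (digitOf 1) h₁) (trans (cong (digitOf 0) h₂) (low-digit c₄ l₃)) ,
    trans (cong (digitOf 2) h₁) (trans (cong (digitOf 1) h₂) (trans (cong (digitOf 0) h₃) (low-digit i₅ l₄))) ,
    trans (cong (digitOf 3) h₁) (trans (cong (digitOf 2) h₂) (trans (cong (digitOf 1) h₃)
      (trans (cong (digitOf 0) (high-digits i₅ l₄)) (low-digit 0 l₅))))
    where
    c₄ c₃ c₂ c₁ : ℕ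
    c₄ = i₅ * n + i₄
    c₃ = c₄ * n + i₃
    c₂ = c₃ * n + i₂
    c₁ = c₂ * n + i₁
    h₁ : apply div c₁ n ≡ c₂
    h₁ = high-digits c₂ l₁
    h₂ : apply div c₂ n ≡ c₃
    h₂ = high-digits c₃ l₂
    h₃ : apply div c₃ n ≡ c₄
    h₃ = high-digits c₄ l₃
    go : ∀ n → n * n * n * n * n ≡ n * (n * (n * (n * (n * 1))))
    go = solve-∀

  majority-transport : ∀ (x : ℕ → ℕ → ℕ) {ρ} {a₁ a₂ a₃ a₄ a₅ b₁ b₂ b₃ b₄ b₅ : ℕ} →
    a₁ ≡ b₁ → a₂ ≡ b₂ → a₃ ≡ b₃ → a₄ ≡ b₄ → a₅ ≡ b₅ →
    Candidate d (majorityᵇ (x a₁) (x a₂) (x a₃) (x a₄) (x a₅)) ρ →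
    Candidate d (majorityᵇ (x b₁) (x b₂) (x b₃) (x b₄) (x b₅)) ρ
  majority-transport x refl refl refl refl refl cand = cand

-- Comparison with an optimal solution

pad : ℕ → (ℕ → ℕ) → ℕ → ℕ
pad m f j = if j <ᵇ m then f j else f 0

pad-bound : ∀ m f {N} → 1 ≤ m → (∀ j → j < m → f j < N) → ∀ j → pad m f j < N
pad-bound m f 1≤m f<N j with j <ᵇ m in eq
... | true  = f<N j (<ᵇ-true⁻¹ eq)
... | false = f<N 0 1≤m

pad-≡ : ∀ m f {j} → j < m → pad m f j ≡ f j
pad-≡ m f j<m rewrite <ᵇ-true j<m = refl

objective-≤ : ∀ {n k t D e v} → t ≤ n → ∀ χ → t ≤ count n χ → (α : ℕ → ℕ) → (∀ i → i < n → α i < k) →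
  Objective n k t D e v → v ≤ ∑ n (λ i → ι (χ i) * D (e (α i)) i)
objective-≤ {n} {t = t} t≤n χ t≤χ α α<k (objective μ low v≡) = ≤-trans (≤-reflexive v≡)
  (≤-trans (smallest-least n t μ t≤n χ t≤χ)
    (∑-mono n λ i i<n → *-monoʳ-≤ (ι (χ i)) (proj₁ (low i i<n) (α i) (α<k i i<n))))

-- The inliers and the assignment of the optimum need not be the best ones for the new medians, but
-- they are admissible and so bound the value found. An optimum with fewer than k medians is
-- compared with a k-tuple that repeats its first candidate.
transfer-ratio : ∀ {n m k t} K G v D μ (δ : ℕ → ℕ → ℕ) (α f : ℕ → ℕ) → t ≤ n → m ≤ k →
  (∀ i → i < n → α i < m) → (∀ i → i < n → μ i ≡ δ i (α i)) →
  K * ∑ n (λ i → ι (chosen n t μ i) * D (f (α i)) i) ≤ G * ∑ n (λ i → ι (chosen n t μ i) * δ i (α i)) →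
  (∃[ v′ ] Objective n k t D (pad m f) v′ × v ≤ v′) → K * v ≤ G * smallest n t μ
transfer-ratio {n} {m} {k} {t} K G v D μ δ α f t≤n m≤k α<m μ≡ le (v′ , obj , v≤v′) = begin
  K * v                                               ≤⟨ *-monoʳ-≤ K (≤-trans v≤v′ (objective-≤ t≤n χ
    (≤-reflexive (sym (chosen-count n t μ t≤n))) α (λ i i<n → <-≤-trans (α<m i i<n) m≤k) obj)) ⟩
  K * ∑ n (λ i → ι (χ i) * D (pad m f (α i)) i)       ≡⟨ cong (K *_) (∑-cong n λ i i<n →
    cong (λ c → ι (χ i) * D c i) (pad-≡ m f (α<m i i<n))) ⟩
  K * ∑ n (λ i → ι (χ i) * D (f (α i)) i)             ≤⟨ le ⟩
  G * ∑ n (λ i → ι (χ i) * δ i (α i))                 ≡⟨ cong (G *_) (∑-cong n λ i i<n →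
    cong (ι (χ i) *_) (sym (μ≡ i i<n))) ⟩
  G * smallest n t μ                                  ∎
  where
  open ≤-Reasoning
  χ : ℕ → Bool
  χ = chosen n t μ

Solution : ∀ {d n} → ℕ → (Fin n → Perm d) → ℕ → ℚ → ℕ → Set
Solution {d} w S k p bound = ∃[ t ] ∃[ s ] Run w algorithm (input S k p) t s × t ≤ bound ×
  ∃[ m ] Σ[ Y ∈ (Fin m → Perm d) ] Outputs s Y × IsApproximate (ℤ.+ 1999 ℚ./ 1000) p S k Y

module Large (n d k : ℕ) (1≤n : 1 ≤ n) (2≤d : 2 ≤ d) (1≤k : 1 ≤ k) (k<n : k < n)
  (S : Fin n → Perm d) (a b : ℕ) .(co : Coprime a (suc b)) (a<den : a < suc b)
  (w : ℕ) (fit : (n + d + k + suc b) ^ wordExponent ≤ 2 ^ w) where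

  p : ℚ
  p = fraction a b co

  1≤d : 1 ≤ d
  1≤d = ≤-trans (s≤s z≤n) 2≤d

  M : ℕ
  M = n + d + k + suc b

  2≤M : 2 ≤ M
  2≤M = ≤-trans 2≤d (≤-trans (m≤n+m d n) (≤-trans (m≤m+n (n + d) k) (m≤m+n (n + d + k) (suc b))))

  open Execution n d k a (suc b) 1≤n 1≤d 1≤k k<n w M 2≤M fit
  open Simulation (Verify.κ n d k a (suc b) t) w M 2≤M fit using (Small; M-nonZero)

  x symbols : ℕ → ℕ → ℕ
  x       = family (λ _ → 0) (position ∘ S)
  symbols = family (λ _ → 0) (symbol ∘ S)

  x-toℕ : ∀ i → x (toℕ i) ≡ position (S i)
  x-toℕ = family-toℕ (λ _ → 0) (position ∘ S)

  symbols-toℕ : ∀ i → symbols (toℕ i) ≡ symbol (S i)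
  symbols-toℕ = family-toℕ (λ _ → 0) (symbol ∘ S)

  x-bounded : ∀ i → i < n → Bounded d (x i)
  x-bounded = every (λ i → Bounded d (x i)) λ i →
    subst (Bounded d) (sym (x-toℕ i)) (position-bounded (S i))

  symbols-bounded : ∀ i → i < n → Bounded d (symbols i)
  symbols-bounded = every (λ i → Bounded d (symbols i)) λ i →
    subst (Bounded d) (sym (symbols-toℕ i)) (symbol-bounded (S i))

  symbols-x : ∀ i → i < n → ∀ a → a < d → symbols i (x i a) ≡ a
  symbols-x = every (λ i → ∀ a → a < d → symbols i (x i a) ≡ a) λ i →
    subst₂ (λ f g → ∀ a → a < d → f (g a) ≡ a) (sym (symbols-toℕ i)) (sym (x-toℕ i)) (symbol-position (S i))

  x-symbols : ∀ i → i < n → ∀ j → j < d → x i (symbols i j) ≡ j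
  x-symbols = every (λ i → ∀ j → j < d → x i (symbols i j) ≡ j) λ i →
    subst₂ (λ f g → ∀ j → j < d → f (g j) ≡ j) (sym (x-toℕ i)) (sym (symbols-toℕ i)) (position-symbol (S i))

  x-injective : ∀ i → i < n → Inj d (x i)
  x-injective = every (λ i → Inj d (x i)) λ i →
    subst (Inj d) (sym (x-toℕ i)) (position-injective (S i))

  initial : Initial (input S k p)
  initial = record
    { small = record { smallReg = regs ; smallMem = λ u → ≤-trans (inputMemory-bound S u)
        (≤-trans dM (≤-trans (≤-reflexive (sym (*-identityʳ M))) (^-monoʳ-≤ M (s≤s (z≤n {5}))))) }
    ; reg0 = refl ; reg1 = refl ; reg2 = refl ; reg3 = refl ; reg4 = refl ; reg9 = refl
    ; blank = inputMemory-blank S }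
    where
    dM : d ≤ M
    dM = ≤-trans (m≤n+m d n) (≤-trans (m≤m+n (n + d) k) (m≤m+n (n + d + k) (suc b)))
    one : ∀ {m} → m ≤ M → m ≤ M ^ 1
    one le = ≤-trans le (≤-reflexive (sym (*-identityʳ M)))
    regs : ∀ r → inputRegister S k p r ≤ M ^ rdeg r
    regs 0 = one (≤-trans (m≤m+n n d) (≤-trans (m≤m+n (n + d) k) (m≤m+n (n + d + k) (suc b))))
    regs 1 = one dM
    regs 2 = one (≤-trans (m≤n+m k (n + d)) (m≤m+n (n + d + k) (suc b)))
    regs 3 = one (≤-trans (<⇒≤ a<den) (m≤n+m (suc b) (n + d + k)))
    regs 4 = one (m≤n+m (suc b) (n + d + k))
    regs (suc (suc (suc (suc (suc r))))) = z≤n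

  tape-symbols : ∀ i j → i < n → j < d → inputMemory S (i * d + j) ≡ symbols i j
  tape-symbols i j i<n j<d = every (λ i → ∀ j → j < d → inputMemory S (i * d + j) ≡ symbols i j)
    (λ i → every (λ j → inputMemory S (toℕ i * d + j) ≡ symbols (toℕ i) j) λ j → begin
      inputMemory S (toℕ i * d + toℕ j) ≡⟨ cong (inputMemory S) (trans (cong (_+ toℕ j) (*-comm (toℕ i) d))
        (sym (Finₚ.toℕ-combine i j))) ⟩
      inputMemory S (toℕ (combine i j)) ≡⟨ inputMemory-entry S i j ⟩
      toℕ (S i ⟨$⟩ʳ j)                  ≡⟨ onℕ-toℕ (S i ⟨$⟩ʳ_) j ⟨
      symbol (S i) (toℕ j)              ≡⟨ cong (λ f → f (toℕ j)) (symbols-toℕ i) ⟨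
      symbols (toℕ i) (toℕ j)           ∎) i i<n j j<d
    where open ≡-Reasoning

  open Quota n a b co 1≤n a<den
  open Objectives p S t 1≤t t≤n enough suffices

  κ : ℕ → ℕ
  κ = Verify.κ n d k a (suc b) t
  open Semantics κ using (time)
  instance
    n≢0 : NonZero n
    n≢0 = >-nonZero 1≤n
    d≢0 : NonZero d
    d≢0 = >-nonZero 1≤d
  cheap-time : ∀ c → T (limits c) → T (allTerms cheap (polynomialTime c)) →
               time c ≤ size (polynomialTime c) * (n ^ 12 * d ^ 2)
  cheap-time c h h′ = ≤-trans (time-polynomial n d κ refl refl (<⇒≤ k<n) refl c h)
    (term-bound n d cheap (n ^ 12 * d ^ 2) (cheap-bound n d) (polynomialTime c) h′)
  hp : time prepare ≤ prepareSize * (n ^ 12 * d ^ 2 + n ^ 5 * d ^ 3)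
  hp = ≤-trans (time-polynomial n d κ refl refl (<⇒≤ k<n) refl prepare prepare-limits)
    (term-bound n d affordable (n ^ 12 * d ^ 2 + n ^ 5 * d ^ 3) (affordable-bound n d)
      (polynomialTime prepare) prepare-affordable)
  hr : time round ≤ roundSize * (n ^ 12 * d ^ 2)
  hr = cheap-time round tt round-cheap
  hd : time deliver ≤ deliverSize * (n ^ 12 * d ^ 2)
  hd = cheap-time deliver tt deliver-cheap

  Tp Tr Td : ℕ
  Tp = prepareSize * (n ^ 12 * d ^ 2 + n ^ 5 * d ^ 3)
  Tr = roundSize * (n ^ 12 * d ^ 2)
  Td = deliverSize * (n ^ 12 * d ^ 2)

  Finished : State → Set
  Finished = Outcome symbols x symbols-bounded x-bounded symbols-x x-symbols Tp Tr Td hp hr hd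

  module _ (s : State) (o : Finished s) where
    open Outcome o

    ρ-injective : ∀ c → c < n ^ 5 → Inj d (cands c)
    ρ-injective c c<N = Candidate.injective (good c c<N)

    ρ-bounded : ∀ c → c < n ^ 5 → Bounded d (cands c)
    ρ-bounded c c<N = Candidate.bounded (good c c<N)

    Y : Fin k → Perm d
    Y j = mkPerm (cands (e (toℕ j))) (ρ-injective _ (e<N _ (Finₚ.toℕ<n j))) (ρ-bounded _ (e<N _ (Finₚ.toℕ<n j)))

    Y-position : ∀ j a → a < d → position (Y j) a ≡ cands (e (toℕ j)) a
    Y-position j = position-mkPerm _ (ρ-injective _ (e<N _ (Finₚ.toℕ<n j))) (ρ-bounded _ (e<N _ (Finₚ.toℕ<n j)))

    outputs : Outputs s Y
    outputs = count≡ , λ i j → begin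
      memory s (register s 1 + toℕ (combine i j))
        ≡⟨ cong₂ (λ base u → memory s (base + u)) base≡ (Finₚ.toℕ-combine i j) ⟩
      memory s (d * toℕ i + toℕ j)
        ≡⟨ cong₂ (λ u v → memory s (u + v)) (*-comm d (toℕ i)) (at i j) ⟩
      memory s (toℕ i * d + cands (e (toℕ i)) (toℕ (Y i ⟨$⟩ʳ j)))
        ≡⟨ written (toℕ i) (toℕ (Y i ⟨$⟩ʳ j)) (Finₚ.toℕ<n i) (Finₚ.toℕ<n (Y i ⟨$⟩ʳ j)) ⟩
      toℕ (Y i ⟨$⟩ʳ j) ∎
      where
      open ≡-Reasoning
      at : ∀ i j → toℕ j ≡ cands (e (toℕ i)) (toℕ (Y i ⟨$⟩ʳ j))
      at i j = trans (sym (trans (onℕ-toℕ (Y i ⟨$⟩ˡ_) (Y i ⟨$⟩ʳ j)) (cong toℕ (inverseˡ (Y i)))))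
        (Y-position i _ (Finₚ.toℕ<n (Y i ⟨$⟩ʳ j)))

    found : Medians Y
    found = record
      { δ        = λ i j → D (e j) i
      ; μ        = nearestDist obj
      ; distance = λ i j → subst (λ f → Dist d f (position (Y j)) (D (e (toℕ j)) (toℕ i))) (x-toℕ i)
          (dist-cong (λ _ _ → refl) (Y-position j) (dists (e (toℕ j)) (toℕ i) (e<N _ (Finₚ.toℕ<n j)) (Finₚ.toℕ<n i)))
      ; least    = least obj }

    found-objective : IsObjₚ p S Y v
    found-objective = subst (IsObjₚ p S Y) (sym (value≡ obj)) (isObjₚ found)

    tuple : ∀ i₁ i₂ i₃ i₄ i₅ → i₁ < n → i₂ < n → i₃ < n → i₄ < n → i₅ < n →
      ∃[ c ] c < n ^ 5 × Candidate d (majorityᵇ (x i₁) (x i₂) (x i₃) (x i₄) (x i₅)) (cands c)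
    tuple i₁ i₂ i₃ i₄ i₅ l₁ l₂ l₃ l₄ l₅ = go (digits i₁ i₂ i₃ i₄ i₅ l₁ l₂ l₃ l₄ l₅)
      where
      open Verify n d k a (suc b) t using (digitOf)
      open Digits n d k a (suc b) t 1≤n
      go : (∃[ c ] c < n ^ 5 × digitOf 0 c ≡ i₁ × digitOf 1 c ≡ i₂ × digitOf 2 c ≡ i₃ ×
             digitOf 3 c ≡ i₄ × digitOf 4 c ≡ i₅) →
           ∃[ c ] c < n ^ 5 × Candidate d (majorityᵇ (x i₁) (x i₂) (x i₃) (x i₄) (x i₅)) (cands c)
      go (c , c<N , e₁ , e₂ , e₃ , e₄ , e₅) =
        c , c<N , majority-transport x e₁ e₂ e₃ e₄ e₅ (good c c<N)

    open Approximation n d (n ^ 5) x x-injective cands D dists ρ-injective tuple 1≤n using (approximate)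

    module _ {m} (m≤k : m ≤ k) (Y* : Fin m → Perm d) (opt : ℕ) (obj* : IsObjₚ p S Y* opt) where

      1≤m : 1 ≤ m
      1≤m = objective-nonempty Y* obj*

      best : Medians Y*
      best = medians Y* 1≤m

      open Medians best renaming (δ to δ*; μ to μ*; distance to distance*; least to least*)

      opt≡ : opt ≡ smallest n t μ*
      opt≡ = isMin-unique obj* (isObjₚ best)

      y : ℕ → ℕ → ℕ
      y = family (λ _ → 0) (position ∘ Y*)

      y-toℕ : ∀ j → y (toℕ j) ≡ position (Y* j)
      y-toℕ = family-toℕ (λ _ → 0) (position ∘ Y*)

      χ : ℕ → Bool
      χ = chosen n t μ*

      close : ∃[ α ] (∀ i → i < n → α i < m × μ* i ≡ δ* i (α i))
      close = choice (λ i j → j < m × μ* i ≡ δ* i j) 0 (λ i i<n → proj₂ (least* i i<n))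

      approximation : ∀ K G (α : ℕ → ℕ) → (∀ i → i < n → α i < m × μ* i ≡ δ* i (α i)) →
        (∃[ f ] (∀ j → j < m → f j < n ^ 5) ×
          K * ∑ n (λ i → ι (χ i) * D (f (α i)) i) ≤ G * ∑ n (λ i → ι (χ i) * δ* i (α i))) →
        K * v ≤ G * opt
      approximation K G α hα (f , f<N , le) = subst (λ u → K * v ≤ G * u) (sym opt≡)
        (transfer-ratio {n} {m} {k} {t} K G v D μ* δ* α f t≤n m≤k (λ i i<n → proj₁ (hα i i<n))
          (λ i i<n → proj₂ (hα i i<n)) le (optimal (pad m f) (λ j _ → pad-bound m f 1≤m f<N j)))

      good-value : ∀ K L G → K ≡ 1 + L → G ≡ L + K → 120 ≤ L → K * v ≤ G * opt
      good-value K L G hK hG hL = approximation K G (proj₁ close) (proj₂ close)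
        (approximate K L G hK hG hL m χ y δ* (proj₁ close) (λ i i<n → proj₁ (proj₂ close i i<n))
          (every (λ j → Inj d (y j)) λ j → subst (Inj d) (sym (y-toℕ j)) (position-injective (Y* j)))
          λ i j i<n j<m → every (λ i → ∀ j → j < m → Dist d (x i) (y j) (δ* i j))
            (λ i → every (λ j → Dist d (x (toℕ i)) (y j) (δ* (toℕ i) j)) λ j →
              subst₂ (λ f g → Dist d f g (δ* (toℕ i) (toℕ j))) (sym (x-toℕ i)) (sym (y-toℕ j)) (distance* i j))
            i i<n j j<m)

    approximates : IsApproximate (ℤ.+ 1999 ℚ./ 1000) p S k Y
    approximates = go (opt-exists k 1≤k (S (fromℕ< 1≤n)))
      where
      go : ∃ (IsOpt p S k) → IsApproximate (ℤ.+ 1999 ℚ./ 1000) p S k Y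
      go (opt , isOpt@((m , m≤k , Y* , obj*) , _)) =
        ≤-refl , v , opt , found-objective , isOpt , ratio≤ 1999 999 v opt (good-value m≤k Y* opt obj* (suc 999) 999 1999 refl refl (≤ᵇ⇒≤ 120 999 tt))

  solution : Solution w S k p (timeFactor * ((n ^ 5) ^ k * (n ^ 12 * d ^ 2) + n ^ 5 * d ^ 3))
  solution = go (execute symbols x symbols-bounded x-bounded symbols-x x-symbols Tp Tr Td hp hr hd
      (input S k p) initial tape-symbols)
    where
    go : (∃[ u ] ∃[ s ] Run w algorithm (input S k p) u s × u ≤ totalTime symbols x symbols-bounded x-bounded symbols-x x-symbols Tp Tr Td hp hr hd × Finished s) →
         Solution w S k p (timeFactor * ((n ^ 5) ^ k * (n ^ 12 * d ^ 2) + n ^ 5 * d ^ 3))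
    go (u , s , run , u≤ , o) = u , s , run ,
      ≤-trans u≤ (total-time (n ^ 12 * d ^ 2) (n ^ 5 * d ^ 3) ((n ^ 5) ^ k)
        (*-mono-≤ (m^n>0 n 12) (m^n>0 d 2)) (m^n>0 (n ^ 5) {{>-nonZero (m^n>0 n 5)}} k)) ,
      k , Y s o , outputs s o , approximates s o

same-distance : ∀ {d P t} → Dist d P P t → t ≡ 0
same-distance {d} h = n≤0⇒n≡0 (≤-trans (minimal h (λ _ → false) λ _ _ _ _ _ _ lo → lo)
  (≤-reflexive (∑-zero d)))

module Small-input (n d k : ℕ) (1≤n : 1 ≤ n) (1≤k : 1 ≤ k) (n≤k : n ≤ k) (S : Fin n → Perm d)
  (a b : ℕ) .(co : Coprime a (suc b)) (a<den : a < suc b) (w : ℕ) where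

  p : ℚ
  p = fraction a b co

  open Quota n a b co 1≤n a<den
  open Objectives p S quota 1≤t t≤n enough suffices

  truncate-zero : truncate w 0 ≡ 0
  truncate-zero = m<n⇒m%n≡m {{m^n≢0 2 w}} (m^n>0 2 w)

  s : State
  s = state (inputRegister S k p [ 1 ↦ truncate w 0 ]) (inputMemory S)

  run : Run w algorithm (input S k p) 6 s
  run = if-false (trans (cong (λ c → truncate w (ι c)) (<ᵇ-false n≤k)) truncate-zero) assign

  outputs : Outputs s S
  outputs = refl , λ i j → trans (cong (λ u → inputMemory S (u + toℕ (combine i j))) truncate-zero)
    (inputMemory-entry S i j)

  all : Medians S
  all = medians S 1≤n

  open Medians all renaming (least to nearest-least)

  μ≡0 : ∀ i → i < n → μ i ≡ 0
  μ≡0 i i<n = n≤0⇒n≡0 (≤-trans (proj₁ (nearest-least i i<n) i i<n)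
    (≤-reflexive (every (λ i → δ i i ≡ 0) (λ i → same-distance (distance i i)) i i<n)))

  value≡0 : smallest n quota μ ≡ 0
  value≡0 = trans (∑-cong n λ i i<n →
    trans (cong (ι (chosen n quota μ i) *_) (μ≡0 i i<n)) (*-zeroʳ (ι (chosen n quota μ i)))) (∑-zero n)

  approximates : IsApproximate (ℤ.+ 1999 ℚ./ 1000) p S k S
  approximates = go (opt-exists k 1≤k (S (fromℕ< 1≤n)))
    where
    go : ∃ (IsOpt p S k) → IsApproximate (ℤ.+ 1999 ℚ./ 1000) p S k S
    go (opt , isOpt) = n≤k , 0 , opt , subst (IsObjₚ p S S) value≡0 (isObjₚ all) , isOpt ,
      ratio≤ 1999 999 0 opt (≤-trans (≤-reflexive (*-zeroʳ 1000)) z≤n)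

  solution : ∀ {bound} → 6 ≤ bound → Solution w S k p bound
  solution 6≤ = 6 , s , run , 6≤ , n , S , outputs , approximates

-- There is only one permutation of a single symbol. With d ≥ 2 the logarithm is at least 1, so the
-- first term of the time bound does not vanish in the main branch.
two-symbols : ∀ {d n} (S : Fin n → Perm d) → IsSet S → 1 ≤ d → 2 ≤ n → 2 ≤ d
two-symbols {suc (suc d)} S isSet _ _ = s≤s (s≤s z≤n)
two-symbols {suc zero} {suc zero} S _ _ (s≤s ())
two-symbols {suc zero} {suc (suc n)} S isSet _ _ =
  contradiction (isSet {Fin.zero} {Fin.suc Fin.zero} λ i → unique (S Fin.zero ⟨$⟩ʳ i) _) λ ()
  where
  unique : ∀ (i j : Fin 1) → i ≡ j
  unique Fin.zero Fin.zero = refl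

timeBound : ℕ → ℕ → ℕ → ℕ
timeBound n d k = timeFactor * 2 * (n ^ (34 * k) * (d * ⌈log₂ d ⌉) + n ^ 5 * d ^ 3)

loosen : ∀ {n d k w} {S : Fin n → Perm d} {p} → 1 ≤ n → 1 ≤ k → 2 ≤ d →
  Solution w S k p (timeFactor * ((n ^ 5) ^ k * (n ^ 12 * d ^ 2) + n ^ 5 * d ^ 3)) →
  Solution w S k p (timeBound n d k)
loosen {n} {d} {k} 1≤n 1≤k 2≤d (t , s , run , t≤ , rest) = t , s , run , ≤-trans t≤ (≤-trans
  (*-monoʳ-≤ timeFactor (exponent-bound n d k 1≤n 1≤k 2≤d))
  (≤-reflexive (sym (*-assoc timeFactor 2 _)))) , rest

-- In the branch k ≥ n the case d = 1, with logarithm 0, can occur; there the summand n^5 d^3 ≥ 1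
-- carries the bound.
six≤timeBound : ∀ n d k → 1 ≤ n → 1 ≤ d → 6 ≤ timeBound n d k
six≤timeBound n d k 1≤n 1≤d = ≤-trans (≤ᵇ⇒≤ 6 46 tt) (≤-trans 46≤timeFactor (begin
  timeFactor              ≡⟨ trans (*-identityʳ (timeFactor * 1)) (*-identityʳ timeFactor) ⟨
  timeFactor * 1 * 1      ≤⟨ *-mono-≤ (*-monoʳ-≤ timeFactor (s≤s z≤n)) (≤-trans
    (*-mono-≤ (m^n>0 n {{>-nonZero 1≤n}} 5) (m^n>0 d {{>-nonZero 1≤d}} 3))
    (m≤n+m (n ^ 5 * d ^ 3) (n ^ (34 * k) * (d * ⌈log₂ d ⌉)))) ⟩
  timeBound n d k         ∎))
  where open ≤-Reasoning

solution : ∀ n d k → 1 ≤ n → 1 ≤ d → 1 ≤ k → (S : Fin n → Perm d) → IsSet S →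
  ∀ a b .(co : Coprime a (suc b)) → a < suc b → ∀ w → (n + d + k + suc b) ^ wordExponent ≤ 2 ^ w →
  Dec (k < n) → Solution w S k (fraction a b co) (timeBound n d k)
solution n d k 1≤n 1≤d 1≤k S isSet a b co a<den w fit (no k≮n) =
  Small-input.solution n d k 1≤n 1≤k (≮⇒≥ k≮n) S a b co a<den w (six≤timeBound n d k 1≤n 1≤d)
solution n d k 1≤n 1≤d 1≤k S isSet a b co a<den w fit (yes k<n) =
  loosen {k = k} 1≤n 1≤k 2≤d (Large.solution n d k 1≤n 2≤d 1≤k k<n S a b co a<den w fit)
  where
  2≤d : 2 ≤ d
  2≤d = two-symbols S isSet 1≤d (≤-trans (s≤s 1≤k) k<n)

solution-ℚ : ∀ n d k → 1 ≤ n → 1 ≤ d → 1 ≤ k → (S : Fin n → Perm d) → IsSet S →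
  (p : ℚ) → 0ℚ ℚ.≤ p → p ℚ.< 1ℚ → ∀ w → WordLength wordExponent n d k p w →
  Solution w S k p (timeBound n d k)
solution-ℚ n d k 1≤n 1≤d 1≤k S isSet (ℚ.mkℚ ℤ.-[1+ a ] b co) (ℚ.*≤* ()) p<1 w fit
solution-ℚ n d k 1≤n 1≤d 1≤k S isSet (ℚ.mkℚ (ℤ.+ a) b co) 0≤p p<1 w fit =
  solution n d k 1≤n 1≤d 1≤k S isSet a b co
    (ℤₚ.drop‿+<+ (subst₂ ℤ._<_ (ℤₚ.*-identityʳ (ℤ.+ a)) (ℤₚ.*-identityˡ (ℤ.+ suc b)) (ℚₚ.drop-*<* p<1)))
    w fit (k <? n)

open import Data.Integer using (+_)

theorem3p5 : ∃[ algorithm ] ∃[ a ] ∃[ b ] ∃[ C ]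
    ∀ (n d k : ℕ) .{{_ : NonZero n}} .{{_ : NonZero d}} .{{_ : NonZero k}}
    (S : Fin n → Perm d) → IsSet S →
    (p : ℚ) → 0ℚ ℚ.≤ p → p ℚ.< 1ℚ →
    (w : ℕ) → WordLength b n d k p w →
    ∃[ t ] ∃[ s ] Run w algorithm (input S k p) t s ×
    t ≤ C * (n ^ (a * k) * (d * ⌈log₂ d ⌉) + n ^ 5 * d ^ 3) ×
    ∃[ m ] Σ[ Y ∈ (Fin m → Perm d) ]
    Outputs s Y × IsApproximate (+ 1999 ℚ./ 1000) p S k Y
theorem3p5 = algorithm , 34 , wordExponent , timeFactor * 2 , λ n d k S isSet p 0≤p p<1 w fit →
  solution-ℚ n d k (>-nonZero⁻¹ n) (>-nonZero⁻¹ d) (>-nonZero⁻¹ k) S isSet p 0≤p p<1 w fit
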